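{- Let $T$ be an Ammann--Beenker tiling. The smallest number of colours in a proper face colouring of $T$ is $2$. Moreover, a proper 2-colouring of the faces can be obtained by colouring the tiles based on their orientation, i.e. there is a proper face colouring of $T$ with two colours in which any two tiles that are translates of each other (for triangles: translates of each other together with their arrows) receive the same colour.
   Context: Ammann--Beenker substitution. Prototiles: a right isosceles triangle with sides $1,1,\sqrt2$ whose hypotenuse carries an arrow pointing from one of its endpoints (tail) to the other (head), and a rhombus of side $1$ with an angle of $45^\circ$. Let $\lambda=1+\sqrt2$, $h=\sqrt2/2$. The substitution $\omega$ expands by $\lambda$ and dissects as follows. (1) The triangle with vertices $(0,0),(\sqrt2,0),(h,h)$ and arrow from $(0,0)$ to $(\sqrt2,0)$: the expanded triangle with vertices $(0,0),(2+\sqrt2,0),(1+h,1+h)$ is dissected into the triangle $(0,0),(1,0),(1,1)$ with arrow from $(1,1)$ to $(0,0)$; the triangle $(1,0),(1+\sqrt2,0),(1+h,h)$ with arrow from $(1+\sqrt2,0)$ to $(1,0)$; the triangle $(1+h,h),(2+h,h),(1+h,1+h)$ with arrow from $(2+h,h)$ to $(1+h,1+h)$; the rhombus $(1,0),(1,1),(1+h,1+h),(1+h,h)$; and the rhombus $(1+\sqrt2,0),(2+\sqrt2,0),(2+h,h),(1+h,h)$. (2) The rhombus with vertices $(0,0),(1,0),(1+h,h),(h,h)$: the expanded rhombus with vertices $(0,0),(\lambda,0),(2+3h,1+h),(1+h,1+h)$ is dissected into the rhombus $(0,0),(1,0),(1+h,h),(h,h)$; the rhombus $(1+h,h),(\lambda,0),(\lambda,1),(1+h,1+h)$;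 the rhombus $(\lambda,1),(\lambda+1,1),(2+3h,1+h),(1+3h,1+h)$; the triangle $(h,h),(1+h,h),(1+h,1+h)$ with arrow from $(h,h)$ to $(1+h,1+h)$; the triangle $(1,0),(\lambda,0),(1+h,h)$ with arrow from $(1,0)$ to $(\lambda,0)$; the triangle $(\lambda,0),(\lambda,1),(\lambda+1,1)$ with arrow from $(\lambda+1,1)$ to $(\lambda,0)$; and the triangle $(\lambda,1),(1+h,1+h),(1+3h,1+h)$ with arrow from $(1+3h,1+h)$ to $(1+h,1+h)$. The rule is extended to all congruent copies (including reflections) of the prototiles, and to collections of tiles, covariantly. An Ammann--Beenker tiling is a tiling $T$ of $\mathbb{R}^2$ by congruent copies of the (arrowed) prototiles such that every finite set of tiles of $T$ is contained in a congruent copy of $\omega^n(p)$ for some $n\ge0$ and some prototile $p$. A proper face colouring is an assignment of colours to the tiles such that any two distinct tiles whose boundaries share a segment of positive length have different colours. -}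

module Defs where

open import Level using (Level; 0ℓ)
open import Algebra.Core using (Op₁; Op₂)
open import Algebra.Structures using (IsCommutativeRing)
open import Data.Empty using (⊥)
open import Data.Fin.Base using (Fin)
open import Data.List.Base using (List; []; _∷_; map; concatMap)
open import Data.List.Relation.Unary.All using (All)
open import Data.List.Relation.Unary.Any using (Any)
open import Data.Nat.Base as ℕ using (ℕ; zero; suc)
open import Data.Product.Base using (∃; ∃-syntax; _×_; _,_; proj₁)
open import Data.Product.Relation.Binary.Pointwise.NonDependent using (Pointwise)
open import Data.Vec.Base as Vec using (Vec; []; _∷_)
import Data.Vec.Relation.Unary.All as VecAll
open import Function.Bundles using (_⇔_)
open import Relation.Binary.Core using (Rel)
open import Relation.Binary.PropositionalEquality.Core using (_≡_; _≢_)
open import Relation.Binary.Structures using (IsDecTotalOrder)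
open import Relation.Nullary.Negation.Core using (¬_)
open import Relation.Unary using (Pred; _∈_; _∪_)

-- The real numbers, given axiomatically as a complete ordered field; the
-- axioms are the classical ones (decidable total order, suprema of all
-- inhabited bounded subsets) and determine ℝ up to isomorphism.  As usual for
-- a total inverse function, the value of 0# ⁻¹ is unspecified.
record RealNumbers : Set₁ where
  infix  8 _⁻¹ -_
  infixl 7 _*_
  infixl 6 _+_ _-_
  infix  4 _≈_ _≤_ _<_
  field
    Carrier : Set
    _≈_ _≤_ : Rel Carrier 0ℓ
    _+_ _*_ : Op₂ Carrier
    -_ _⁻¹  : Op₁ Carrier
    0# 1#   : Carrier

  UpperBound : Pred Carrier 0ℓ → Pred Carrier 0ℓ
  UpperBound S u = ∀ x → x ∈ S → x ≤ u

  field
    isCommutativeRing : IsCommutativeRing _≈_ _+_ _*_ -_ 0# 1#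
    0≉1               : ¬ (0# ≈ 1#)
    *-inverseʳ        : ∀ x → ¬ (x ≈ 0#) → x * x ⁻¹ ≈ 1#
    isDecTotalOrder   : IsDecTotalOrder _≈_ _≤_
    +-monoˡ-≤         : ∀ z {x y} → x ≤ y → x + z ≤ y + z
    *-nonNegative     : ∀ {x y} → 0# ≤ x → 0# ≤ y → 0# ≤ x * y
    supremum          : ∀ (S : Pred Carrier 0ℓ) → ∃ S → ∃ (UpperBound S) →
                        ∃[ s ] UpperBound S s × (∀ u → UpperBound S u → s ≤ u)

  _<_ : Rel Carrier 0ℓ
  x < y = x ≤ y × ¬ (x ≈ y)

  _-_ : Op₂ Carrier
  x - y = x + - y

-- Exists (by completeness) and is unique up to ≈.
record SquareRootOfTwo (ℝ : RealNumbers) : Set where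
  open RealNumbers ℝ
  field
    √2          : Carrier
    nonNegative : 0# ≤ √2
    square      : √2 * √2 ≈ 1# + 1#

module AmmannBeenker (ℝ : RealNumbers) (root : SquareRootOfTwo ℝ) where

  open RealNumbers ℝ
  open SquareRootOfTwo root using (√2)

  2# 3# h Λ : Carrier
  2# = 1# + 1#
  3# = 2# + 1#
  h  = √2 * 2# ⁻¹
  Λ  = 1# + √2

  ----------------------------------------------------------------------
  -- The Euclidean plane

  Point : Set
  Point = Carrier × Carrier

  infix  4 _≈ₚ_
  infixl 6 _⊕_ _⊖_
  infixr 7 _·_

  _≈ₚ_ : Rel Point 0ℓ
  _≈ₚ_ = Pointwise _≈_ _≈_

  _⊕_ _⊖_ : Op₂ Point
  (x , y) ⊕ (x′ , y′) = x + x′ , y + y′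
  (x , y) ⊖ (x′ , y′) = x - x′ , y - y′

  _·_ : Carrier → Point → Point
  r · (x , y) = r * x , r * y

  dist² : Point → Point → Carrier
  dist² (x , y) (x′ , y′) = (x - x′) * (x - x′) + (y - y′) * (y - y′)

  record Isometry : Set where
    field
      apply     : Point → Point
      preserves : ∀ p q → dist² (apply p) (apply q) ≈ dist² p q

  Region : Set₁
  Region = Pred Point 0ℓ

  sum : ∀ {n} → Vec Carrier n → Carrier
  sum = Vec.foldr′ _+_ 0#

  combination : ∀ {n} → Vec Carrier n → Vec Point n → Point
  combination ws ps = Vec.foldr′ _⊕_ (0# , 0#) (Vec.zipWith _·_ ws ps)

  ConvexHull : ∀ {n} → Vec Point n → Region
  ConvexHull ps x =
    ∃[ ws ] VecAll.All (0# ≤_) ws × sum ws ≈ 1# × combination ws ps ≈ₚ x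

  Segment : Point → Point → Region
  Segment p q = ConvexHull (p ∷ q ∷ [])

  Interior : Region → Region
  Interior A x = ∃[ ε ] 0# < ε × (∀ y → dist² x y < ε * ε → y ∈ A)

  ----------------------------------------------------------------------
  -- Tiles

  -- A triangle is given by the tail and the head of the arrow on its
  -- hypotenuse and by the opposite vertex; a rhombus by its vertices in cyclic
  -- order, the first one being at a 45° angle.  A rhombus thus has four such
  -- presentations, which _≅_ identifies.
  data Tile : Set where
    triangle : (tail head apex : Point) → Tile
    rhombus  : (a b c d : Point) → Tile

  data Shape : Set where
    tri rho : Shape

  prototile : Shape → Tile
  prototile tri = triangle (0# , 0#) (√2 , 0#) (h , h)
  prototile rho = rhombus (0# , 0#) (1# , 0#) (1# + h , h) (h , h)

  mapTile : (Point → Point) → Tile → Tile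
  mapTile f (triangle s t a)  = triangle (f s) (f t) (f a)
  mapTile f (rhombus a b c d) = rhombus (f a) (f b) (f c) (f d)

  arity : Tile → ℕ
  arity (triangle _ _ _)  = 3
  arity (rhombus _ _ _ _) = 4

  vertices : (t : Tile) → Vec Point (arity t)
  vertices (triangle s t a)  = s ∷ t ∷ a ∷ []
  vertices (rhombus a b c d) = a ∷ b ∷ c ∷ d ∷ []

  region : Tile → Region
  region t = ConvexHull (vertices t)

  boundary : Tile → Region
  boundary (triangle s t a)  = Segment s t ∪ Segment t a ∪ Segment a s
  boundary (rhombus a b c d) =
    Segment a b ∪ Segment b c ∪ Segment c d ∪ Segment d a

  infix 4 _≐_ _≅_

  -- Same vertices, in the same order.
  _≐_ : Rel Tile 0ℓ
  triangle s t a  ≐ triangle s′ t′ a′    = s ≈ₚ s′ × t ≈ₚ t′ × a ≈ₚ a′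
  rhombus a b c d ≐ rhombus a′ b′ c′ d′ =
    a ≈ₚ a′ × b ≈ₚ b′ × c ≈ₚ c′ × d ≈ₚ d′
  _               ≐ _                    = ⊥

  SameRegion : Rel Tile 0ℓ
  SameRegion s t = ∀ x → x ∈ region s ⇔ x ∈ region t

  -- Equality of tiles: the same subset of the plane and, for triangles, the
  -- same arrow.
  _≅_ : Rel Tile 0ℓ
  T@(triangle s t _)  ≅ T′@(triangle s′ t′ _)  = s ≈ₚ s′ × t ≈ₚ t′ × SameRegion T T′
  R@(rhombus _ _ _ _) ≅ R′@(rhombus _ _ _ _) = SameRegion R R′
  _                   ≅ _                     = ⊥

  infix 7 _∙_

  _∙_ : Isometry → Tile → Tile
  g ∙ t = mapTile (Isometry.apply g) t

  ----------------------------------------------------------------------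
  -- The substitution

  -- The dissection of the prototile expanded by Λ about the origin.
  dissection : Shape → List Tile
  dissection tri =
      triangle (1# , 1#) (0# , 0#) (1# , 0#)
    ∷ triangle (1# + √2 , 0#) (1# , 0#) (1# + h , h)
    ∷ triangle (2# + h , h) (1# + h , 1# + h) (1# + h , h)
    ∷ rhombus (1# , 0#) (1# , 1#) (1# + h , 1# + h) (1# + h , h)
    ∷ rhombus (2# + √2 , 0#) (2# + h , h) (1# + h , h) (1# + √2 , 0#)
    ∷ []
  dissection rho =
      rhombus (0# , 0#) (1# , 0#) (1# + h , h) (h , h)
    ∷ rhombus (Λ , 0#) (Λ , 1#) (1# + h , 1# + h) (1# + h , h)
    ∷ rhombus (Λ , 1#) (Λ + 1# , 1#) (2# + 3# * h , 1# + h) (1# + 3# * h , 1# + h)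
    ∷ triangle (h , h) (1# + h , 1# + h) (1# + h , h)
    ∷ triangle (1# , 0#) (Λ , 0#) (1# + h , h)
    ∷ triangle (Λ + 1# , 1#) (Λ , 0#) (Λ , 1#)
    ∷ triangle (1# + 3# * h , 1# + h) (1# + h , 1# + h) (Λ , 1#)
    ∷ []

  shape : Tile → Shape
  shape (triangle _ _ _)  = tri
  shape (rhombus _ _ _ _) = rho

  -- The affine map carrying prototile (shape t) to t, vertex by vertex; if t
  -- is g ∙ prototile (shape t) for an isometry g, this map is g.  In
  -- the prototiles' coordinates, the unit vectors along the axes are
  -- h · head and h · (2# · apex ⊖ head) for the triangle (with tail at the
  -- origin), and b and √2 · d ⊖ b for the rhombus (with a at the origin).
  frame : Tile → Point → Point
  frame (triangle s t a) (x , y) =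
    s ⊕ x · h · (t ⊖ s) ⊕ y · h · (2# · (a ⊖ s) ⊖ (t ⊖ s))
  frame (rhombus a b c d) (x , y) =
    a ⊕ x · (b ⊖ a) ⊕ y · (√2 · (d ⊖ a) ⊖ (b ⊖ a))

  -- For g as above, the conjugate of g by the expansion: it carries the
  -- expanded prototile to the expanded copy.
  expandedFrame : Tile → Point → Point
  expandedFrame t x = Λ · frame t (Λ ⁻¹ · x)

  ω : Tile → List Tile
  ω t = map (mapTile (expandedFrame t)) (dissection (shape t))

  ω^ : ℕ → Tile → List Tile
  ω^ zero    t = t ∷ []
  ω^ (suc n) t = concatMap ω (ω^ n t)

  ----------------------------------------------------------------------
  -- Tilings

  -- A collection T of tiles may contain several presentations of one tile;
  -- tiles of T are only ever compared up to _≅_.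
  record IsTiling {ℓ : Level} (T : Pred Tile ℓ) : Set ℓ where
    field
      copies   : ∀ t → t ∈ T → ∃[ s ] ∃[ g ] t ≐ g ∙ prototile s
      covers   : ∀ x → ∃[ t ] t ∈ T × x ∈ region t
      disjoint : ∀ s t → s ∈ T → t ∈ T → ¬ (s ≅ t) →
                 ∀ x → ¬ (x ∈ Interior (region s) × x ∈ Interior (region t))

  record IsAmmannBeenkerTiling {ℓ : Level} (T : Pred Tile ℓ) : Set ℓ where
    field
      isTiling : IsTiling T
      legal    : ∀ (ts : List Tile) → All (_∈ T) ts →
                 ∃[ n ] ∃[ s ] ∃[ g ]
                   All (λ t → Any (t ≅_) (map (g ∙_) (ω^ n (prototile s)))) ts

  ----------------------------------------------------------------------
  -- Face colourings

  Adjacent : Rel Tile 0ℓ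
  Adjacent s t = ∃[ p ] ∃[ q ] ¬ (p ≈ₚ q) ×
    (∀ x → x ∈ Segment p q → x ∈ boundary s × x ∈ boundary t)

  Translates : Rel Tile 0ℓ
  Translates s t = ∃[ v ] mapTile (v ⊕_) s ≅ t

  record IsProperColouring {ℓ : Level} (T : Pred Tile ℓ) {k : ℕ}
                           (c : ∃ T → Fin k) : Set ℓ where
    field
      respects : ∀ s t → proj₁ s ≅ proj₁ t → c s ≡ c t
      proper   : ∀ s t → ¬ (proj₁ s ≅ proj₁ t) →
                 Adjacent (proj₁ s) (proj₁ t) → c s ≢ c t

  Colourable : {ℓ : Level} → Pred Tile ℓ → ℕ → Set ℓ
  Colourable T k = ∃[ c ] IsProperColouring T {k} c

  SmallestNumberOfColours : {ℓ : Level} → Pred Tile ℓ → ℕ → Set ℓ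
  SmallestNumberOfColours T k =
    Colourable T k × (∀ j → Colourable T j → k ℕ.≤ j)

  OrientationBased : {ℓ : Level} (T : Pred Tile ℓ) {k : ℕ} → (∃ T → Fin k) → Set ℓ
  OrientationBased T c = ∀ s t → Translates (proj₁ s) (proj₁ t) → c s ≡ c t

{-# OPTIONS --safe #-}
module Submission where

-- The tiles of a patch ωⁿ(p) have their vertices in ℤ[ζ], ζ = exp(πi/4), and are
-- images of the prototiles under translations composed with elements of the
-- dihedral group D₈ of order 16.  Colour a tile by the character of D₈ that is -1
-- on the rotation by 45° and on complex conjugation, changing the colour of all
-- triangles; the symmetries of the rhombus lie in the kernel of the character.
--
-- Any two tiles of a patch are equal, or in one of 31 relative positions in which
-- they share an edge and have different colours, or separated by two lines at an
-- angle of 45°, so that they meet in at most one point.  This trichotomy is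
-- inherited by the subtiles: separated tiles have separated subtiles because a
-- dissection stays inside the expanded tile, and for equal and for neighbouring
-- tiles it is a finite computation in ℤ[ζ].
--
-- In the tiling the character is the sign of cos 4θ, where θ is the angle between
-- the axes of a tile and of a fixed tile.  For the lower bound, a tile covering a
-- certain point close to an edge of a given tile, on its outer side, can only be
-- the neighbour across that edge, again by the trichotomy.
open import Defs
open import Level using (Level; 0ℓ)
open import Algebra.Bundles using (CommutativeRing; RawRing)
import Algebra.Properties.AbelianGroup
import Algebra.Properties.Ring
import Algebra.Properties.Semiring.Mult.TCOptimised
import Algebra.Solver.Ring as RingSolver
open import Algebra.Solver.Ring.AlmostCommutativeRing
  using (fromCommutativeRing; _-Raw-AlmostCommutative⟶_)
open import Data.Bool.Base using (Bool; true; false; not; _xor_)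
import Data.Bool.Properties as Bool
open import Data.Empty using (⊥; ⊥-elim)
open import Data.Fin.Base as Fin using (Fin; zero; suc)
open import Data.Fin.Patterns
open import Data.Fin.Properties as Fin using (all?; any?)
open import Data.Integer.Base as ℤ using (ℤ; +_; -[1+_])
import Data.Integer.Properties as ℤ
open import Data.Integer.Solver using (module +-*-Solver)
open import Data.List.Base as List using (List; []; _∷_)
open import Data.List.Membership.Propositional using (find) renaming (_∈_ to _∈ˡ_)
import Data.List.Membership.Propositional.Properties as List
open import Data.List.Relation.Binary.Pointwise.Base as Pointwise using (Pointwise; []; _∷_)
open import Data.List.Relation.Unary.All as All using (All; []; _∷_)
import Data.List.Relation.Unary.All.Properties as All
open import Data.List.Relation.Unary.Any as Any using (Any; here; there)
import Data.List.Relation.Unary.Any.Properties as Any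
open import Data.Maybe.Base using (Maybe; just; nothing)
open import Data.Nat.Base as ℕ using (ℕ; zero; suc; z≤n; s≤s)
import Data.Nat.Properties as ℕ
open import Data.Product.Base using (∃; ∃-syntax; _×_; _,_; proj₁; proj₂; uncurry)
import Data.Product.Properties as Product
open import Data.Sum.Base using (_⊎_; inj₁; inj₂; [_,_]′)
open import Data.Vec.Base as Vec using (Vec; []; _∷_; lookup)
import Data.Vec.Properties as Vec
open import Data.Vec.Relation.Binary.Pointwise.Inductive as VecPointwise using ([]; _∷_)
import Data.Vec.Relation.Unary.All as VecAll
open VecAll using ([]; _∷_)
open import Function.Base using (_∘_; id)
open import Function.Bundles using (mk⇔; Equivalence)
open import Relation.Binary.Definitions using (DecidableEquality)
open import Relation.Binary.PropositionalEquality as ≡ using (_≡_; _≢_)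
open import Relation.Binary.Structures using (IsDecTotalOrder)
open import Relation.Nullary.Decidable using (Dec; yes; no; does; toWitness; _×-dec_; _⊎-dec_; map′)
open import Relation.Nullary.Negation.Core using (¬_)
open import Relation.Unary using (Pred; Decidable; _∈_)

-- A tile of `T` carries no lattice coordinates. Legality puts each finite set of tiles into some
-- congruent patch, and the patch and its isometry change with the set. The colouring has to be a
-- function of the tile alone, measured against one fixed tile, in which the isometry cancels. A
-- polynomial in inner products has this property. The axis is taken at 22.5° to the base of the
-- prototile, so that reflection in the base moves it by 45°; hence cos 4θ changes sign under the
-- reflection as well as under the rotation by 45°, as the character does. The polynomial is even,
-- so the two ends of the axis of a rhombus need not be told apart.
--
-- One separating line would not exclude adjacency, since two tiles can share an edge lying on it.
-- Two lines in different directions leave at most their intersection.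
--
-- A further obstacle is that `≅` compares rhombi as bare sets and triangles by region and arrow.
-- Vertices, and with them axes and boundaries, must be recovered from regions by metric arguments,
-- up to the four presentations of a rhombus.

-- Ordered field arithmetic and a ring solver with integer coefficients.

module Reals (ℝ : RealNumbers) where

  open RealNumbers ℝ public

  commutativeRing : CommutativeRing 0ℓ 0ℓ
  commutativeRing = record { isCommutativeRing = isCommutativeRing }

  open CommutativeRing commutativeRing public
    using (refl; sym; trans; reflexive; setoid; ring; semiring; +-abelianGroup
          ; +-cong; *-cong; -‿cong; +-comm; *-comm; +-assoc; *-assoc
          ; +-identityˡ; +-identityʳ; *-identityˡ; *-identityʳ; zeroˡ; zeroʳ
          ; -‿inverseˡ; -‿inverseʳ)
  open IsDecTotalOrder isDecTotalOrder public
    using (_≟_; _≤?_; total; antisym)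
    renaming (reflexive to ≤-reflexive; trans to ≤-trans; refl to ≤-refl)

  module IntegerCoefficients where
    open Algebra.Properties.Ring ring
    open Algebra.Properties.AbelianGroup +-abelianGroup using (⁻¹-∙-comm; ⁻¹-involutive; ε⁻¹≈ε)
    private module N = Algebra.Properties.Semiring.Mult.TCOptimised semiring
    open import Relation.Binary.Reasoning.Setoid setoid

    -- The optimised multiple makes `fromℕ 1` and `fromℕ 2` unfold to `1#` and `1# + 1#`, so
    -- numerals in solved polynomials agree with `1#` and `2#` by computation.
    fromℕ : ℕ → Carrier
    fromℕ n = n N.× 1#

    fromℤ : ℤ → Carrier
    fromℤ (+ n)    = fromℕ n
    fromℤ -[1+ n ] = - fromℕ (suc n)

    fromℕ-+ : ∀ m n → fromℕ (m ℕ.+ n) ≈ fromℕ m + fromℕ n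
    fromℕ-+ m n = N.×-homo-+ 1# m n

    fromℤ-neg : ∀ i → fromℤ (ℤ.- i) ≈ - fromℤ i
    fromℤ-neg (+ zero)  = sym ε⁻¹≈ε
    fromℤ-neg (+ suc n) = refl
    fromℤ-neg -[1+ n ]  = sym (⁻¹-involutive _)

    fromℤ-⊖ : ∀ m n → fromℤ (m ℤ.⊖ n) ≈ fromℕ m - fromℕ n
    fromℤ-⊖ zero    zero    = sym (-‿inverseʳ 0#)
    fromℤ-⊖ zero    (suc n) = sym (+-identityˡ _)
    fromℤ-⊖ (suc m) zero    = sym (trans (+-cong refl ε⁻¹≈ε) (+-identityʳ _))
    fromℤ-⊖ (suc m) (suc n) = begin
      fromℤ (suc m ℤ.⊖ suc n)                    ≡⟨ ≡.cong fromℤ (ℤ.[1+m]⊖[1+n]≡m⊖n m n) ⟩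
      fromℤ (m ℤ.⊖ n)                            ≈⟨ fromℤ-⊖ m n ⟩
      fromℕ m - fromℕ n                          ≈⟨ +-cong (+-identityˡ _) refl ⟨
      0# + fromℕ m - fromℕ n                     ≈⟨ +-cong (+-cong (-‿inverseʳ 1#) refl) refl ⟨
      1# - 1# + fromℕ m - fromℕ n                ≈⟨ +-cong (+-assoc _ _ _) refl ⟩
      1# + (- 1# + fromℕ m) - fromℕ n            ≈⟨ +-cong (+-cong refl (+-comm _ _)) refl ⟩
      1# + (fromℕ m - 1#) - fromℕ n              ≈⟨ +-cong (+-assoc _ _ _) refl ⟨
      1# + fromℕ m - 1# - fromℕ n                ≈⟨ +-assoc _ _ _ ⟩
      1# + fromℕ m + (- 1# - fromℕ n)            ≈⟨ +-cong refl (⁻¹-∙-comm _ _) ⟩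
      1# + fromℕ m - (1# + fromℕ n)              ≈⟨ +-cong (fromℕ-+ 1 m) (-‿cong (fromℕ-+ 1 n)) ⟨
      fromℕ (suc m) - fromℕ (suc n)              ∎

    fromℤ-+ : ∀ i j → fromℤ (i ℤ.+ j) ≈ fromℤ i + fromℤ j
    fromℤ-+ (+ m)    (+ n)    = fromℕ-+ m n
    fromℤ-+ (+ m)    -[1+ n ] = fromℤ-⊖ m (suc n)
    fromℤ-+ -[1+ m ] (+ n)    = trans (fromℤ-⊖ n (suc m)) (+-comm _ _)
    fromℤ-+ -[1+ m ] -[1+ n ] = begin
      - fromℕ (suc (suc (m ℕ.+ n)))       ≡⟨ ≡.cong (λ k → - fromℕ (suc k)) (ℕ.+-suc m n) ⟨
      - fromℕ (suc m ℕ.+ suc n)           ≈⟨ -‿cong (fromℕ-+ (suc m) (suc n)) ⟩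
      - (fromℕ (suc m) + fromℕ (suc n))   ≈⟨ ⁻¹-∙-comm _ _ ⟨
      - fromℕ (suc m) - fromℕ (suc n)     ∎

    fromℕ-* : ∀ m j → fromℤ (+ m ℤ.* j) ≈ fromℕ m * fromℤ j
    fromℕ-* m (+ n) = begin
      fromℤ (+ m ℤ.* + n)  ≡⟨ ≡.cong fromℤ (ℤ.pos-* m n) ⟨
      fromℕ (m ℕ.* n)      ≈⟨ N.×1-homo-* m n ⟩
      fromℕ m * fromℕ n    ∎
    fromℕ-* m -[1+ n ] = begin
      fromℤ (+ m ℤ.* -[1+ n ])        ≡⟨ ≡.cong fromℤ (ℤ.neg-distribʳ-* (+ m) (+ suc n)) ⟨
      fromℤ (ℤ.- (+ m ℤ.* + suc n))   ≈⟨ fromℤ-neg (+ m ℤ.* + suc n) ⟩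
      - fromℤ (+ m ℤ.* + suc n)       ≈⟨ -‿cong (fromℕ-* m (+ suc n)) ⟩
      - (fromℕ m * fromℕ (suc n))     ≈⟨ -‿distribʳ-* _ _ ⟩
      fromℕ m * - fromℕ (suc n)       ∎
    fromℤ-* : ∀ i j → fromℤ (i ℤ.* j) ≈ fromℤ i * fromℤ j
    fromℤ-* (+ m)    j = fromℕ-* m j
    fromℤ-* -[1+ m ] j = begin
      fromℤ (-[1+ m ] ℤ.* j)          ≡⟨ ≡.cong fromℤ (ℤ.neg-distribˡ-* (+ suc m) j) ⟨
      fromℤ (ℤ.- (+ suc m ℤ.* j))     ≈⟨ fromℤ-neg (+ suc m ℤ.* j) ⟩
      - fromℤ (+ suc m ℤ.* j)         ≈⟨ -‿cong (fromℕ-* (suc m) j) ⟩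
      - (fromℕ (suc m) * fromℤ j)     ≈⟨ -‿distribˡ-* _ _ ⟩
      - fromℕ (suc m) * fromℤ j       ∎

    ℤ-rawRing : RawRing 0ℓ 0ℓ
    ℤ-rawRing = record
      { Carrier = ℤ ; _≈_ = _≡_ ; _+_ = ℤ._+_ ; _*_ = ℤ._*_ ; -_ = ℤ.-_ ; 0# = + 0 ; 1# = + 1 }

    -- Coefficients are taken in ℤ because their equality is decided by evaluation; the solver can
    -- then cancel numerals, which it could not do with an abstract `Carrier`.
    homomorphism : ℤ-rawRing -Raw-AlmostCommutative⟶ fromCommutativeRing commutativeRing
    homomorphism = record
      { ⟦_⟧ = fromℤ ; +-homo = fromℤ-+ ; *-homo = fromℤ-* ; -‿homo = fromℤ-neg
      ; 0-homo = refl ; 1-homo = refl }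

    ≟-weak : ∀ i j → Maybe (fromℤ i ≈ fromℤ j)
    ≟-weak i j with i ℤ.≟ j
    ... | yes i≡j = just (reflexive (≡.cong fromℤ i≡j))
    ... | no  _   = nothing

  open IntegerCoefficients public
    using (fromℕ; fromℤ; fromℤ-+; fromℤ-neg; fromℤ-*)

  module Solver = RingSolver IntegerCoefficients.ℤ-rawRing
    (fromCommutativeRing commutativeRing)
    IntegerCoefficients.homomorphism IntegerCoefficients.≟-weak
  open Solver public using (solve; _:=_; _:+_; _:*_; _:-_; :-_; con; Polynomial)

  :0 :1 :2 : ∀ {n} → Polynomial n
  :0 = con (+ 0)
  :1 = con (+ 1)
  :2 = con (+ 2)

  -- Equations are proved by exhibiting the difference of the two sides as a
  -- multiple of a known zero.
  ≈-from-zero : ∀ {x y z k} → z ≈ 0# → x ≈ y + k * z → x ≈ y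
  ≈-from-zero z≈0 eq =
    trans eq (trans (+-cong refl (trans (*-cong refl z≈0) (zeroʳ _))) (+-identityʳ _))

  x-x≈0 : ∀ {x y} → x ≈ y → x - y ≈ 0#
  x-x≈0 x≈y = trans (+-cong x≈y refl) (-‿inverseʳ _)

  x-y≈0⇒x≈y : ∀ {x y} → x - y ≈ 0# → x ≈ y
  x-y≈0⇒x≈y {x} {y} eq = ≈-from-zero {k = 1#} eq
    (solve 2 (λ x y → x := y :+ :1 :* (x :- y)) refl x y)

  ≤-respʳ : ∀ {x y z} → x ≤ y → y ≈ z → x ≤ z
  ≤-respʳ x≤y y≈z = ≤-trans x≤y (≤-reflexive y≈z)

  ≤-respˡ : ∀ {x y z} → x ≈ y → y ≤ z → x ≤ z
  ≤-respˡ x≈y y≤z = ≤-trans (≤-reflexive x≈y) y≤z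

  +-mono-≤ : ∀ {x y u v} → x ≤ y → u ≤ v → x + u ≤ y + v
  +-mono-≤ {x} {y} {u} {v} x≤y u≤v = ≤-trans (+-monoˡ-≤ u x≤y)
    (≤-respˡ (+-comm _ _) (≤-respʳ (+-monoˡ-≤ y u≤v) (+-comm _ _)))

  +-nonNegative : ∀ {x y} → 0# ≤ x → 0# ≤ y → 0# ≤ x + y
  +-nonNegative 0≤x 0≤y = ≤-respˡ (sym (+-identityˡ 0#)) (+-mono-≤ 0≤x 0≤y)

  0≤y-x : ∀ {x y} → x ≤ y → 0# ≤ y - x
  0≤y-x {x} x≤y = ≤-respˡ (sym (-‿inverseʳ x)) (+-monoˡ-≤ (- x) x≤y)

  x≤y-from-0≤ : ∀ {x y} → 0# ≤ y - x → x ≤ y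
  x≤y-from-0≤ {x} {y} p = ≤-respˡ (sym (+-identityˡ x))
    (≤-respʳ (+-monoˡ-≤ x p) (solve 2 (λ x y → y :- x :+ x := y) refl x y))

  *-monoˡ-≤ : ∀ {c x y} → 0# ≤ c → x ≤ y → c * x ≤ c * y
  *-monoˡ-≤ {c} {x} {y} 0≤c x≤y = x≤y-from-0≤ (≤-respʳ (*-nonNegative 0≤c (0≤y-x x≤y))
    (solve 3 (λ c x y → c :* (y :- x) := c :* y :- c :* x) refl c x y))

  square-nonNegative : ∀ x → 0# ≤ x * x
  square-nonNegative x with total 0# x
  ... | inj₁ 0≤x = *-nonNegative 0≤x 0≤x
  ... | inj₂ x≤0 = ≤-respʳ (*-nonNegative 0≤-x 0≤-x)
    (solve 1 (λ x → (:0 :- x) :* (:0 :- x) := x :* x) refl x)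
    where 0≤-x = 0≤y-x x≤0

  0≤1 : 0# ≤ 1#
  0≤1 = ≤-respʳ (square-nonNegative 1#) (*-identityˡ 1#)

  1≰0 : ¬ 1# ≤ 0#
  1≰0 1≤0 = 0≉1 (antisym 0≤1 1≤0)

  fromℕ-nonNegative : ∀ n → 0# ≤ fromℕ n
  fromℕ-nonNegative zero    = ≤-refl
  fromℕ-nonNegative (suc n) = ≤-respʳ (+-nonNegative 0≤1 (fromℕ-nonNegative n))
    (sym (fromℤ-+ (+ 1) (+ n)))

  fromℤ-nonNegative : ∀ {i} → + 0 ℤ.≤ i → 0# ≤ fromℤ i
  fromℤ-nonNegative (ℤ.+≤+ {n = n} _) = fromℕ-nonNegative n

  fromℕ≉0 : ∀ n → ¬ fromℕ (suc n) ≈ 0#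
  fromℕ≉0 n eq = 1≰0 (≤-respʳ (≤-respˡ (sym (+-identityʳ 1#)) (+-mono-≤ ≤-refl (fromℕ-nonNegative n)))
    (trans (sym (fromℤ-+ (+ 1) (+ n))) eq))

  xy≈0⇒ : ∀ {x y} → x * y ≈ 0# → x ≈ 0# ⊎ y ≈ 0#
  xy≈0⇒ {x} {y} eq with x ≟ 0#
  ... | yes x≈0 = inj₁ x≈0
  ... | no  x≉0 = inj₂ (≈-from-zero {k = x ⁻¹} eq (≈-from-zero {k = - y} (x-x≈0 (*-inverseʳ x x≉0))
    (solve 3 (λ x y i → y := :0 :+ i :* (x :* y) :+ (:- y) :* (x :* i :- :1)) refl x y (x ⁻¹))))

  *-cancel : ∀ {x y} → ¬ x ≈ 0# → x * y ≈ 0# → y ≈ 0#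
  *-cancel x≉0 eq with xy≈0⇒ eq
  ... | inj₁ x≈0 = ⊥-elim (x≉0 x≈0)
  ... | inj₂ y≈0 = y≈0

  a+b≈0⇒a≈0 : ∀ {a b} → 0# ≤ a → 0# ≤ b → a + b ≈ 0# → a ≈ 0#
  a+b≈0⇒a≈0 {a} {b} 0≤a 0≤b eq = antisym
    (≤-respˡ (sym (+-identityʳ a)) (≤-respʳ (+-mono-≤ ≤-refl 0≤b) eq)) 0≤a

  x²≈0⇒x≈0 : ∀ {x} → x * x ≈ 0# → x ≈ 0#
  x²≈0⇒x≈0 eq with xy≈0⇒ eq
  ... | inj₁ p = p
  ... | inj₂ p = p

  x²+y²≈0⇒x≈0 : ∀ {x y} → x * x + y * y ≈ 0# → x ≈ 0#
  x²+y²≈0⇒x≈0 {x} {y} eq = x²≈0⇒x≈0 (a+b≈0⇒a≈0 (square-nonNegative x) (square-nonNegative y) eq)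

-- Euclidean plane: the number h, isometries, linear forms on convex hulls.

module Plane (ℝ : RealNumbers) (root : SquareRootOfTwo ℝ) where

  open Reals ℝ public
  open SquareRootOfTwo root public using (√2) renaming (nonNegative to 0≤√2; square to √2²≈2)
  open AmmannBeenker ℝ root public

  2h≈√2 : 2# * h ≈ √2
  2h≈√2 = ≈-from-zero (x-x≈0 (*-inverseʳ 2# (fromℕ≉0 1)))
    (solve 3 (λ t s i → t :* (s :* i) := s :+ s :* (t :* i :- :1)) refl 2# √2 (2# ⁻¹))

  √2≈2h : √2 ≈ 2# * h
  √2≈2h = sym 2h≈√2

  2h²≈1 : 2# * (h * h) ≈ 1#
  2h²≈1 = x-y≈0⇒x≈y (*-cancel (fromℕ≉0 1) (trans
    (solve 1 (λ h → :2 :* (:2 :* (h :* h) :- :1) := (:2 :* h) :* (:2 :* h) :- :2) refl h)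
    (trans (+-cong (*-cong 2h≈√2 2h≈√2) refl) (x-x≈0 √2²≈2))))

  -- The defining relation of `h`. With `≈-from-zero` it reduces an identity involving `h` to a
  -- polynomial identity with an explicit cofactor of this zero.
  2h²-1≈0 : 2# * (h * h) - 1# ≈ 0#
  2h²-1≈0 = x-x≈0 2h²≈1

  0≤h : 0# ≤ h
  0≤h with total 0# h
  ... | inj₁ 0≤h = 0≤h
  ... | inj₂ h≤0 = ⊥-elim (fromℕ≉0 1 (trans (sym √2²≈2)
    (trans (*-cong √2≈0 refl) (zeroˡ _))))
    where
    √2≈0 : √2 ≈ 0#
    √2≈0 = antisym (≤-respˡ √2≈2h (≤-respʳ (*-monoˡ-≤ (fromℕ-nonNegative 2) h≤0) (zeroʳ _))) 0≤√2

  -- From 2h² = 1: (7 - 10h)(7 + 10h) = -1 = 2(7h - 5)(7h + 5).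
  7≤10h : 0# ≤ fromℕ 10 * h - fromℕ 7
  7≤10h with total (fromℕ 7) (fromℕ 10 * h)
  ... | inj₁ p = 0≤y-x p
  ... | inj₂ p = ⊥-elim (1≰0 (x≤y-from-0≤ (≤-respʳ
    (*-nonNegative (0≤y-x p) (+-nonNegative (fromℕ-nonNegative 7) (*-nonNegative (fromℕ-nonNegative 10) 0≤h)))
    (≈-from-zero 2h²-1≈0 (solve 1 (λ h → (con (+ 7) :- con (+ 10) :* h) :* (con (+ 7) :+ con (+ 10) :* h)
       := (:0 :- :1) :+ con (ℤ.- + 50) :* (:2 :* (h :* h) :- :1)) refl h)))))

  7h≤5 : 0# ≤ fromℕ 5 - fromℕ 7 * h
  7h≤5 with total (fromℕ 7 * h) (fromℕ 5)
  ... | inj₁ p = 0≤y-x p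
  ... | inj₂ p = ⊥-elim (1≰0 (x≤y-from-0≤ (≤-respʳ
    (*-nonNegative (fromℕ-nonNegative 2) (*-nonNegative (0≤y-x p) (+-nonNegative (*-nonNegative (fromℕ-nonNegative 7) 0≤h) (fromℕ-nonNegative 5))))
    (≈-from-zero 2h²-1≈0 (solve 1 (λ h → :2 :* ((con (+ 7) :* h :- con (+ 5)) :* (con (+ 7) :* h :+ con (+ 5)))
       := (:0 :- :1) :+ con (+ 49) :* (:2 :* (h :* h) :- :1)) refl h)))))

  h≉0 : ¬ h ≈ 0#
  h≉0 h≈0 = 0≉1 (trans (sym (trans (*-cong refl (trans (*-cong h≈0 refl) (zeroˡ _))) (zeroʳ _))) 2h²≈1)

  ≈ₚ-refl : ∀ {p} → p ≈ₚ p
  ≈ₚ-refl = refl , refl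

  ≈ₚ-sym : ∀ {p q} → p ≈ₚ q → q ≈ₚ p
  ≈ₚ-sym (x , y) = sym x , sym y

  ≈ₚ-trans : ∀ {p q r} → p ≈ₚ q → q ≈ₚ r → p ≈ₚ r
  ≈ₚ-trans (x , y) (x′ , y′) = trans x x′ , trans y y′

  ⊕-cong : ∀ {p p′ q q′} → p ≈ₚ p′ → q ≈ₚ q′ → p ⊕ q ≈ₚ p′ ⊕ q′
  ⊕-cong (x , y) (x′ , y′) = +-cong x x′ , +-cong y y′

  ⊖-cong : ∀ {p p′ q q′} → p ≈ₚ p′ → q ≈ₚ q′ → p ⊖ q ≈ₚ p′ ⊖ q′
  ⊖-cong (x , y) (x′ , y′) = +-cong x (-‿cong x′) , +-cong y (-‿cong y′)

  ·-cong : ∀ {r r′ p p′} → r ≈ r′ → p ≈ₚ p′ → r · p ≈ₚ r′ · p′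
  ·-cong r (x , y) = *-cong r x , *-cong r y

  dot : Point → Point → Carrier
  dot (x , y) (x′ , y′) = x * x′ + y * y′

  dot-cong : ∀ {p p′ q q′} → p ≈ₚ p′ → q ≈ₚ q′ → dot p q ≈ dot p′ q′
  dot-cong (x , y) (x′ , y′) = +-cong (*-cong x x′) (*-cong y y′)

  dot≈0⇒≈0 : ∀ {p} → dot p p ≈ 0# → p ≈ₚ (0# , 0#)
  dot≈0⇒≈0 eq = x²+y²≈0⇒x≈0 eq , x²+y²≈0⇒x≈0 (trans (+-comm _ _) eq)

  ⊖≈0⇒≈ₚ : ∀ {p q} → p ⊖ q ≈ₚ (0# , 0#) → p ≈ₚ q
  ⊖≈0⇒≈ₚ (x , y) = x-y≈0⇒x≈y x , x-y≈0⇒x≈y y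

  dist²≈0⇒≈ₚ : ∀ {p q} → dist² p q ≈ 0# → p ≈ₚ q
  dist²≈0⇒≈ₚ = ⊖≈0⇒≈ₚ ∘ dot≈0⇒≈0

  dist²-cong : ∀ {p p′ q q′} → p ≈ₚ p′ → q ≈ₚ q′ → dist² p q ≈ dist² p′ q′
  dist²-cong p q = dot-cong (⊖-cong p q) (⊖-cong p q)

  ≈ₚ⇒dist²≈0 : ∀ {p q} → p ≈ₚ q → dist² p q ≈ 0#
  ≈ₚ⇒dist²≈0 {p} {q} p≈q = trans (dist²-cong p≈q ≈ₚ-refl)
    (solve 2 (λ x y → (x :- x) :* (x :- x) :+ (y :- y) :* (y :- y) := :0) refl (proj₁ q) (proj₂ q))

  record IsOrthogonal (A : Point → Point) : Set where
    field
      cong  : ∀ {p q} → p ≈ₚ q → A p ≈ₚ A q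
      ⊕-hom : ∀ p q → A (p ⊕ q) ≈ₚ A p ⊕ A q
      ·-hom : ∀ r p → A (r · p) ≈ₚ r · A p
      dots  : ∀ p q → dot (A p) (A q) ≈ dot p q

    0-hom : A (0# , 0#) ≈ₚ (0# , 0#)
    0-hom = ≈ₚ-trans (cong (sym (zeroˡ 0#) , sym (zeroˡ 0#)))
      (≈ₚ-trans (·-hom 0# _) (zeroˡ _ , zeroˡ _))

    ⊖-hom : ∀ p q → A (p ⊖ q) ≈ₚ A p ⊖ A q
    ⊖-hom p q = ≈ₚ-trans (cong (neg p q)) (≈ₚ-trans (⊕-hom p _)
      (≈ₚ-trans (⊕-cong ≈ₚ-refl (·-hom _ q)) (≈ₚ-sym (neg (A p) (A q)))))
      where
      neg : ∀ p q → p ⊖ q ≈ₚ p ⊕ (- 1#) · q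
      neg (x , y) (x′ , y′) = e x x′ , e y y′
        where e = solve 2 (λ x y → x :- y := x :+ (:- :1) :* y) refl

  open IsOrthogonal

  id-orthogonal : IsOrthogonal id
  id-orthogonal = record
    { cong = id ; ⊕-hom = λ _ _ → ≈ₚ-refl ; ·-hom = λ _ _ → ≈ₚ-refl ; dots = λ _ _ → refl }

  ∘-orthogonal : ∀ {A B} → IsOrthogonal A → IsOrthogonal B → IsOrthogonal (A ∘ B)
  ∘-orthogonal a b = record
    { cong  = cong a ∘ cong b
    ; ⊕-hom = λ p q → ≈ₚ-trans (cong a (⊕-hom b p q)) (⊕-hom a _ _)
    ; ·-hom = λ r p → ≈ₚ-trans (cong a (·-hom b r p)) (·-hom a _ _)
    ; dots  = λ p q → trans (dots a _ _) (dots b p q)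
    }

  rotate : Point → Point
  rotate (x , y) = h * (x - y) , h * (x + y)

  reflect : Point → Point
  reflect (x , y) = x , - y

  rotate-orthogonal : IsOrthogonal rotate
  rotate-orthogonal = record
    { cong  = λ (x , y) → *-cong refl (+-cong x (-‿cong y)) , *-cong refl (+-cong x y)
    ; ⊕-hom = λ (x , y) (x′ , y′) →
        solve 5 (λ h x y x′ y′ → h :* (x :+ x′ :- (y :+ y′)) := h :* (x :- y) :+ h :* (x′ :- y′)) refl h x y x′ y′
      , solve 5 (λ h x y x′ y′ → h :* (x :+ x′ :+ (y :+ y′)) := h :* (x :+ y) :+ h :* (x′ :+ y′)) refl h x y x′ y′
    ; ·-hom = λ r (x , y) →
        solve 4 (λ h r x y → h :* (r :* x :- r :* y) := r :* (h :* (x :- y))) refl h r x y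
      , solve 4 (λ h r x y → h :* (r :* x :+ r :* y) := r :* (h :* (x :+ y))) refl h r x y
    ; dots  = λ (x , y) (x′ , y′) → ≈-from-zero 2h²-1≈0
        (solve 5 (λ h x y x′ y′ →
          h :* (x :- y) :* (h :* (x′ :- y′)) :+ h :* (x :+ y) :* (h :* (x′ :+ y′)) :=
          x :* x′ :+ y :* y′ :+ (x :* x′ :+ y :* y′) :* (:2 :* (h :* h) :- :1)) refl h x y x′ y′)
    }

  reflect-orthogonal : IsOrthogonal reflect
  reflect-orthogonal = record
    { cong  = λ (x , y) → x , -‿cong y
    ; ⊕-hom = λ (x , y) (x′ , y′) → refl , solve 2 (λ y y′ → :- (y :+ y′) := :- y :+ :- y′) refl y y′
    ; ·-hom = λ r (x , y) → refl , solve 2 (λ r y → :- (r :* y) := r :* (:- y)) refl r y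
    ; dots  = λ (x , y) (x′ , y′) → +-cong refl (solve 2 (λ y y′ → (:- y) :* (:- y′) := y :* y′) refl y y′)
    }

  record IsAffineIsometry (f : Point → Point) : Set where
    field
      origin     : Point
      linear     : Point → Point
      orthogonal : IsOrthogonal linear
      formula    : ∀ p → f p ≈ₚ origin ⊕ linear p

    differences : ∀ p q → f p ⊖ f q ≈ₚ linear (p ⊖ q)
    differences p q = ≈ₚ-trans (⊖-cong (formula p) (formula q))
      (≈ₚ-trans (e _ _ _ , e _ _ _) (≈ₚ-sym (⊖-hom orthogonal p q)))
      where e = solve 3 (λ o x y → o :+ x :- (o :+ y) := x :- y) refl

    isometry : Isometry
    isometry = record
      { apply     = f
      ; preserves = λ p q → trans (dot-cong (differences p q) (differences p q)) (dots orthogonal _ _)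
      }

  open IsAffineIsometry

  module _ (g : Isometry) where
    open Isometry g

    -- An `Isometry` is not assumed to respect `≈ₚ`; it does so because points at distance zero are
    -- equal.
    apply-cong : ∀ {p q} → p ≈ₚ q → apply p ≈ₚ apply q
    apply-cong {p} {q} p≈q = dist²≈0⇒≈ₚ (trans (preserves p q) (≈ₚ⇒dist²≈0 p≈q))

    apply-injective : ∀ {p q} → apply p ≈ₚ apply q → p ≈ₚ q
    apply-injective {p} {q} eq = dist²≈0⇒≈ₚ (trans (sym (preserves p q)) (≈ₚ⇒dist²≈0 eq))

    private
      O U V : Point
      O = apply (0# , 0#)
      U = apply (1# , 0#) ⊖ O
      V = apply (0# , 1#) ⊖ O

      dot-⊖ : ∀ a b o → 2# * dot (a ⊖ o) (b ⊖ o) ≈ dist² a o + dist² b o - dist² a b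
      dot-⊖ (a , a′) (b , b′) (o , o′) = solve 6 (λ a a′ b b′ o o′ →
        :2 :* ((a :- o) :* (b :- o) :+ (a′ :- o′) :* (b′ :- o′)) :=
        ((a :- o) :* (a :- o) :+ (a′ :- o′) :* (a′ :- o′)) :+
        ((b :- o) :* (b :- o) :+ (b′ :- o′) :* (b′ :- o′)) :-
        ((a :- b) :* (a :- b) :+ (a′ :- b′) :* (a′ :- b′))) refl a a′ b b′ o o′

      halve : ∀ {x y} → 2# * x ≈ 2# * y → x ≈ y
      halve {x} {y} eq = x-y≈0⇒x≈y (*-cancel (fromℕ≉0 1) (trans
        (solve 2 (λ x y → :2 :* (x :- y) := :2 :* x :- :2 :* y) refl x y) (x-x≈0 eq)))

      -- Polarisation: the inner product relative to the image of the origin is a combination of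
      -- three squared distances.
      dot-apply : ∀ p q → dot (apply p ⊖ O) (apply q ⊖ O) ≈ dot p q
      dot-apply p@(x , y) q@(x′ , y′) = halve (trans (dot-⊖ (apply p) (apply q) O) (trans
        (+-cong (+-cong (preserves _ _) (preserves _ _)) (-‿cong (preserves p q)))
        (solve 4 (λ x y x′ y′ →
          ((x :- :0) :* (x :- :0) :+ (y :- :0) :* (y :- :0)) :+
          ((x′ :- :0) :* (x′ :- :0) :+ (y′ :- :0) :* (y′ :- :0)) :-
          ((x :- x′) :* (x :- x′) :+ (y :- y′) :* (y :- y′)) := :2 :* (x :* x′ :+ y :* y′)) refl x y x′ y′)))

      A : Point → Point
      A (x , y) = x · U ⊕ y · V

      UU : dot U U ≈ 1#
      UU = trans (dot-apply _ _) (solve 0 (:1 :* :1 :+ :0 :* :0 := :1) refl)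
      VV : dot V V ≈ 1#
      VV = trans (dot-apply _ _) (solve 0 (:0 :* :0 :+ :1 :* :1 := :1) refl)
      UV : dot U V ≈ 0#
      UV = trans (dot-apply _ _) (solve 0 (:1 :* :0 :+ :0 :* :1 := :0) refl)

      dot-A : ∀ p q → dot (A p) (A q) ≈ dot p q
      dot-A (x , y) (x′ , y′) = trans (expand U V) (trans
        (+-cong (+-cong (*-cong refl UU) (*-cong refl VV)) (*-cong refl UV))
        (solve 4 (λ x y x′ y′ → x :* x′ :* :1 :+ y :* y′ :* :1 :+ (x :* y′ :+ y :* x′) :* :0 := x :* x′ :+ y :* y′) refl x y x′ y′))
        where
        expand : ∀ U V → dot (x · U ⊕ y · V) (x′ · U ⊕ y′ · V) ≈
          x * x′ * dot U U + y * y′ * dot V V + (x * y′ + y * x′) * dot U V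
        expand (u , u′) (v , v′) = solve 8 (λ x y x′ y′ u u′ v v′ →
          (x :* u :+ y :* v) :* (x′ :* u :+ y′ :* v) :+ (x :* u′ :+ y :* v′) :* (x′ :* u′ :+ y′ :* v′) :=
          x :* x′ :* (u :* u :+ u′ :* u′) :+ y :* y′ :* (v :* v :+ v′ :* v′) :+ (x :* y′ :+ y :* x′) :* (u :* v :+ u′ :* v′))
          refl x y x′ y′ u u′ v v′

      A-orthogonal : IsOrthogonal A
      A-orthogonal = record
        { cong  = λ (x , y) → ⊕-cong (·-cong x ≈ₚ-refl) (·-cong y ≈ₚ-refl)
        ; ⊕-hom = λ (x , y) (x′ , y′) → e x y x′ y′ _ _ , e x y x′ y′ _ _
        ; ·-hom = λ r (x , y) → e′ r x y _ _ , e′ r x y _ _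
        ; dots  = dot-A
        }
        where
        e = solve 6 (λ x y x′ y′ u v → (x :+ x′) :* u :+ (y :+ y′) :* v := x :* u :+ y :* v :+ (x′ :* u :+ y′ :* v)) refl
        e′ = solve 5 (λ r x y u v → r :* x :* u :+ r :* y :* v := r :* (x :* u :+ y :* v)) refl

    -- The images of the unit vectors, taken from the image of the origin, are orthonormal. Every
    -- other image is the combination of them with the original coordinates, because the difference
    -- of the two has norm zero.
    isAffine : IsAffineIsometry apply
    isAffine = record
      { origin = O ; linear = A ; orthogonal = A-orthogonal
      ; formula = λ p → ≈ₚ-trans (≈ₚ-sym (e _ _ , e _ _)) (⊕-cong ≈ₚ-refl (⊖≈0⇒≈ₚ (dot≈0⇒≈0 (residue p))))
      }
      where
      e = solve 2 (λ o x → o :+ (x :- o) := x) refl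
      -- |w - xU - yV|² vanishes for w = g(x, y) - g(0, 0).
      residue : ∀ p → let r = (apply p ⊖ O) ⊖ A p in dot r r ≈ 0#
      residue p@(x , y) = trans (expand (apply p ⊖ O) U V) (trans
        (+-cong (+-cong (dot-apply p p) (dot-A p p)) (-‿cong (*-cong refl
          (+-cong (*-cong refl (dot-apply p _)) (*-cong refl (dot-apply p _))))))
        (solve 2 (λ x y → (x :* x :+ y :* y) :+ (x :* x :+ y :* y) :-
           :2 :* (x :* (x :* :1 :+ y :* :0) :+ y :* (x :* :0 :+ y :* :1)) := :0) refl x y))
        where
        expand : ∀ w U V → let a = x · U ⊕ y · V in
          dot (w ⊖ a) (w ⊖ a) ≈ dot w w + dot a a - 2# * (x * dot w U + y * dot w V)
        expand (w , w′) (u , u′) (v , v′) = solve 8 (λ x y w w′ u u′ v v′ →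
          let a = x :* u :+ y :* v ; a′ = x :* u′ :+ y :* v′ in
          (w :- a) :* (w :- a) :+ (w′ :- a′) :* (w′ :- a′) :=
          (w :* w :+ w′ :* w′) :+ (a :* a :+ a′ :* a′) :- :2 :* (x :* (w :* u :+ w′ :* u′) :+ y :* (w :* v :+ w′ :* v′)))
          refl x y w w′ u u′ v v′

  ∘-affine : ∀ {f g} → IsAffineIsometry f → IsAffineIsometry g → IsAffineIsometry (f ∘ g)
  ∘-affine {f} {g} F G = record
    { origin     = origin F ⊕ linear F (origin G)
    ; linear     = linear F ∘ linear G
    ; orthogonal = ∘-orthogonal (orthogonal F) (orthogonal G)
    ; formula    = λ p → ≈ₚ-trans (formula F _) (≈ₚ-trans (⊕-cong ≈ₚ-refl
        (≈ₚ-trans (cong (orthogonal F) (formula G p)) (⊕-hom (orthogonal F) _ _)))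
        (sym (+-assoc _ _ _) , sym (+-assoc _ _ _)))
    }

  record IsLinearForm (f : Point → Carrier) : Set where
    field
      cong  : ∀ {p q} → p ≈ₚ q → f p ≈ f q
      ⊕-hom : ∀ p q → f (p ⊕ q) ≈ f p + f q
      ·-hom : ∀ r p → f (r · p) ≈ r * f p

  coordinate-form : ∀ {A} → IsOrthogonal A → IsLinearForm (proj₁ ∘ A)
  coordinate-form a = record
    { cong = proj₁ ∘ cong a ; ⊕-hom = λ p q → proj₁ (⊕-hom a p q) ; ·-hom = λ r p → proj₁ (·-hom a r p) }

  negated-form : ∀ {f} → IsLinearForm f → IsLinearForm (-_ ∘ f)
  negated-form F = record
    { cong  = -‿cong ∘ F.cong
    ; ⊕-hom = λ p q → trans (-‿cong (F.⊕-hom p q)) (solve 2 (λ x y → :- (x :+ y) := :- x :+ :- y) refl _ _)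
    ; ·-hom = λ r p → trans (-‿cong (F.·-hom r p)) (solve 2 (λ x y → :- (x :* y) := x :* (:- y)) refl _ _)
    } where module F = IsLinearForm F

  module _ {f : Point → Carrier} (F : IsLinearForm f) where
    private module F = IsLinearForm F

    combination-≥ : ∀ {n c} (ws : Vec Carrier n) (ps : Vec Point n) → VecAll.All (0# ≤_) ws →
      (∀ i → c ≤ f (lookup ps i)) → c * sum ws ≤ f (combination ws ps)
    combination-≥ {c = c} [] [] [] c≤ = ≤-reflexive (trans (zeroʳ c) (sym
      (trans (F.cong (sym (zeroˡ 0#) , sym (zeroˡ 0#))) (trans (F.·-hom 0# (0# , 0#)) (zeroˡ _)))))
    combination-≥ {c = c} (w ∷ ws) (p ∷ ps) (0≤w ∷ 0≤ws) c≤ =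
      ≤-respˡ (solve 3 (λ c w s → c :* (w :+ s) := w :* c :+ c :* s) refl c w (sum ws))
      (≤-respʳ (+-mono-≤ (*-monoˡ-≤ 0≤w (c≤ zero)) (combination-≥ ws ps 0≤ws (c≤ ∘ suc)))
      (sym (trans (F.⊕-hom _ _) (+-cong (F.·-hom w p) refl))))

    hull-≥ : ∀ {n c} (ps : Vec Point n) → (∀ i → c ≤ f (lookup ps i)) →
      ∀ {x} → x ∈ ConvexHull ps → c ≤ f x
    hull-≥ {c = c} ps c≤ (ws , 0≤ws , Σ≈1 , eq) =
      ≤-respˡ (trans (sym (trans (*-comm c 1#) (*-identityˡ c))) (*-cong refl (sym Σ≈1)))
      (≤-respʳ (combination-≥ ws ps 0≤ws c≤) (F.cong eq))

  neg-≤ : ∀ {x y} → x ≤ y → - y ≤ - x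
  neg-≤ {x} {y} x≤y = x≤y-from-0≤ (≤-respʳ (0≤y-x x≤y) (solve 2 (λ x y → y :- x := :- x :- :- y) refl x y))

  hull-≤ : ∀ {f} → IsLinearForm f → ∀ {n c} (ps : Vec Point n) → (∀ i → f (lookup ps i) ≤ c) →
    ∀ {x} → x ∈ ConvexHull ps → f x ≤ c
  hull-≤ F ps ≤c x∈ = x≤y-from-0≤ (≤-respʳ (0≤y-x (hull-≥ (negated-form F) ps (λ i → neg-≤ (≤c i)) x∈))
    (solve 2 (λ x c → :- x :- :- c := c :- x) refl _ _))

  hull-separated : ∀ {f} → IsLinearForm f → ∀ {m n} (ps : Vec Point m) (qs : Vec Point n) →
    (∀ i j → f (lookup ps i) ≤ f (lookup qs j)) →
    ∀ {x y} → x ∈ ConvexHull ps → y ∈ ConvexHull qs → f x ≤ f y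
  hull-separated F ps qs p≤q x∈ y∈ = hull-≥ F qs (λ j → hull-≤ F ps (λ i → p≤q i j) x∈) y∈

  hull-resp : ∀ {n} {ps : Vec Point n} {x y} → x ≈ₚ y → x ∈ ConvexHull ps → y ∈ ConvexHull ps
  hull-resp x≈y (ws , 0≤ws , Σ≈1 , eq) = ws , 0≤ws , Σ≈1 , ≈ₚ-trans eq x≈y

  module _ {f : Point → Point} (F : IsAffineIsometry f) where

    -- Partial sums of weights are not normalised, so the induction carries the translation part
    -- with the factor `sum ws`; it becomes 1 only for a full convex combination.
    combination-image : ∀ {n} (ws : Vec Carrier n) ps →
      combination ws (Vec.map f ps) ≈ₚ sum ws · origin F ⊕ linear F (combination ws ps)
    combination-image [] [] = ≈ₚ-sym (≈ₚ-trans (⊕-cong (zeroˡ _ , zeroˡ _) (0-hom (orthogonal F)))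
      (+-identityˡ _ , +-identityˡ _))
    combination-image (w ∷ ws) (p ∷ ps) = ≈ₚ-trans
      (⊕-cong (·-cong refl (formula F p)) (combination-image ws ps)) (≈ₚ-trans
      (e _ _ _ _ _ , e _ _ _ _ _)
      (⊕-cong ≈ₚ-refl (≈ₚ-sym (≈ₚ-trans (⊕-hom (orthogonal F) _ _) (⊕-cong (·-hom (orthogonal F) w p) ≈ₚ-refl)))))
      where e = solve 5 (λ w o l s r → w :* (o :+ l) :+ (s :* o :+ r) := (w :+ s) :* o :+ (w :* l :+ r)) refl

    private
      image-point : ∀ {n} (ws : Vec Carrier n) ps → sum ws ≈ 1# →
        combination ws (Vec.map f ps) ≈ₚ f (combination ws ps)
      image-point ws ps Σ≈1 = ≈ₚ-trans (combination-image ws ps) (≈ₚ-trans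
        (⊕-cong (≈ₚ-trans (·-cong Σ≈1 ≈ₚ-refl) (*-identityˡ _ , *-identityˡ _)) ≈ₚ-refl)
        (≈ₚ-sym (formula F _)))

    hull-preimage : ∀ {n} {ps : Vec Point n} {x} → x ∈ ConvexHull (Vec.map f ps) →
      ∃[ x′ ] x′ ∈ ConvexHull ps × x ≈ₚ f x′
    hull-preimage {ps = ps} (ws , 0≤ws , Σ≈1 , eq) = combination ws ps , (ws , 0≤ws , Σ≈1 , ≈ₚ-refl) ,
      ≈ₚ-trans (≈ₚ-sym eq) (image-point ws ps Σ≈1)

-- The lattice ℤ[ζ], the dihedral group and the finite computations.

module Lattice (ℝ : RealNumbers) (root : SquareRootOfTwo ℝ) where

  open AmmannBeenker ℝ root using (Shape; tri; rho)
  open ≡ using (refl; cong; cong₂; sym; trans)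

  -- The element n₀ + n₁ζ + n₂ζ² + n₃ζ³ of ℤ[ζ] ⊆ ℂ, where ζ = exp(πi/4).
  record ℤ[ζ] : Set where
    constructor lat
    field n₀ n₁ n₂ n₃ : ℤ

  lat-cong : ∀ {a b c d a′ b′ c′ d′} → a ≡ a′ → b ≡ b′ → c ≡ c′ → d ≡ d′ → lat a b c d ≡ lat a′ b′ c′ d′
  lat-cong refl refl refl refl = refl

  infixl 6 _⊞_ _⊟_

  _⊞_ _⊟_ : ℤ[ζ] → ℤ[ζ] → ℤ[ζ]
  lat a b c d ⊞ lat a′ b′ c′ d′ = lat (a ℤ.+ a′) (b ℤ.+ b′) (c ℤ.+ c′) (d ℤ.+ d′)
  lat a b c d ⊟ lat a′ b′ c′ d′ = lat (a ℤ.- a′) (b ℤ.- b′) (c ℤ.- c′) (d ℤ.- d′)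

  ζ·_ conj inflate : ℤ[ζ] → ℤ[ζ]
  ζ· lat a b c d = lat (ℤ.- d) a b c
  conj (lat a b c d) = lat a (ℤ.- d) (ℤ.- c) (ℤ.- b)
  -- multiplication by 1 + √2 = 1 + ζ - ζ³
  inflate (lat a b c d) = lat (a ℤ.+ (b ℤ.- d)) (b ℤ.+ (a ℤ.+ c)) (c ℤ.+ (b ℤ.+ d)) (d ℤ.+ (c ℤ.- a))

  -- (k , b) stands for z ↦ ζᵏ z if b is false, and for z ↦ ζᵏ z̄ otherwise.
  D₈ : Set
  D₈ = Fin 8 × Bool

  next opposite : Fin 8 → Fin 8
  next 0F = 1F
  next 1F = 2F
  next 2F = 3F
  next 3F = 4F
  next 4F = 5F
  next 5F = 6F
  next 6F = 7F
  next 7F = 0F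
  opposite 0F = 0F
  -- Reversal of `Fin 7` sends i to 6 - i, so the value is 8 - (i + 1): negation modulo 8.
  opposite (suc i) = suc (Fin.opposite i)

  spin mirror : D₈ → D₈
  spin (k , b) = next k , b
  mirror (k , b) = opposite k , not b

  iterate : {A : Set} → (A → A) → ℕ → A → A
  iterate f zero    x = x
  iterate f (suc n) x = f (iterate f n x)

  when : {A : Set} → Bool → (A → A) → A → A
  when true  f x = f x
  when false f x = x

  infixr 7 _⊙_

  -- Composition, expressed by the two generators instead of addition modulo 8, so that `act-⊙`
  -- follows from the laws for `spin` and `mirror`.
  _⊙_ : D₈ → D₈ → D₈
  (k , b) ⊙ σ = iterate spin (Fin.toℕ k) (when b mirror σ)

  act : D₈ → ℤ[ζ] → ℤ[ζ]
  act (k , b) z = iterate ζ·_ (Fin.toℕ k) (when b conj z)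

  parity : D₈ → Bool
  parity (k , b) = iterate not (Fin.toℕ k) b

  record Motion : Set where
    constructor motion
    field
      shift  : ℤ[ζ]
      linear : D₈
  open Motion public

  infixr 7 _⊚_

  move : Motion → ℤ[ζ] → ℤ[ζ]
  move (motion s ρ) z = s ⊞ act ρ z

  _⊚_ : Motion → Motion → Motion
  m ⊚ motion s ρ = motion (move m s) (linear m ⊙ ρ)

  -- The conjugate of a motion by the expansion: 1 + √2 is a real scalar and commutes with the
  -- dihedral part, so only the shift is multiplied.
  inflateMotion : Motion → Motion
  inflateMotion (motion s ρ) = motion (inflate s) ρ

  still : Motion
  still = motion (lat (+ 0) (+ 0) (+ 0) (+ 0)) (0F , false)

  size : Shape → ℕ
  size tri = 3
  size rho = 4

  corners : (s : Shape) → Vec ℤ[ζ] (size s)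
  corners tri = lat (+ 0) (+ 0) (+ 0) (+ 0) ∷ lat (+ 0) (+ 1) (+ 0) -[1+ 0 ] ∷ lat (+ 0) (+ 1) (+ 0) (+ 0) ∷ []
  corners rho = lat (+ 0) (+ 0) (+ 0) (+ 0) ∷ lat (+ 1) (+ 0) (+ 0) (+ 0) ∷ lat (+ 1) (+ 1) (+ 0) (+ 0) ∷ lat (+ 0) (+ 1) (+ 0) (+ 0) ∷ []

  corner : (s : Shape) → Fin (size s) → ℤ[ζ]
  corner s = lookup (corners s)

  subtiles : Shape → List (Shape × Motion)
  subtiles tri =
       (tri , motion (lat (+ 1) (+ 0) (+ 1) (+ 0)) (5F , false))
    ∷ (tri , motion (lat (+ 1) (+ 1) (+ 0) -[1+ 0 ]) (4F , true))
    ∷ (tri , motion (lat (+ 2) (+ 1) (+ 0) (+ 0)) (3F , false))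
    ∷ (rho , motion (lat (+ 1) (+ 0) (+ 0) (+ 0)) (2F , true))
    ∷ (rho , motion (lat (+ 2) (+ 1) (+ 0) -[1+ 0 ]) (3F , false))
    ∷ []
  subtiles rho =
       (rho , motion (lat (+ 0) (+ 0) (+ 0) (+ 0)) (0F , false))
    ∷ (rho , motion (lat (+ 1) (+ 1) (+ 0) -[1+ 0 ]) (2F , false))
    ∷ (rho , motion (lat (+ 1) (+ 1) (+ 1) -[1+ 0 ]) (0F , false))
    ∷ (tri , motion (lat (+ 0) (+ 1) (+ 0) (+ 0)) (1F , true))
    ∷ (tri , motion (lat (+ 1) (+ 0) (+ 0) (+ 0)) (0F , false))
    ∷ (tri , motion (lat (+ 2) (+ 1) (+ 1) -[1+ 0 ]) (5F , true))
    ∷ (tri , motion (lat (+ 1) (+ 2) (+ 1) -[1+ 0 ]) (4F , false))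
    ∷ []

  -- Relative positions, found by following pairs of subtiles of one tile through the substitution.
  neighbours : List (Shape × Shape × Motion)
  neighbours =
       (tri , rho , motion (lat (+ 0) (+ 1) (+ 0) (+ 0)) (5F , true))
    ∷ (tri , rho , motion (lat (+ 0) (+ 1) (+ 0) -[1+ 0 ]) (2F , false))
    ∷ (tri , rho , motion (lat -[1+ 0 ] (+ 0) (+ 0) (+ 0)) (1F , true))
    ∷ (tri , rho , motion (lat (+ 0) (+ 1) (+ 1) (+ 0)) (7F , true))
    ∷ (tri , rho , motion (lat -[1+ 0 ] (+ 0) (+ 0) (+ 0)) (0F , false))
    ∷ (rho , tri , motion (lat (+ 1) (+ 0) (+ 0) (+ 0)) (5F , true))
    ∷ (rho , tri , motion (lat (+ 0) (+ 1) (+ 0) (+ 1)) (6F , false))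
    ∷ (rho , tri , motion (lat (+ 0) (+ 1) (+ 1) (+ 0)) (7F , true))
    ∷ (rho , tri , motion (lat (+ 0) (+ 1) (+ 0) (+ 0)) (1F , true))
    ∷ (rho , tri , motion (lat (+ 1) (+ 0) (+ 0) (+ 0)) (0F , false))
    ∷ (rho , tri , motion (lat (+ 1) (+ 0) -[1+ 0 ] (+ 0)) (3F , true))
    ∷ (rho , tri , motion (lat (+ 1) (+ 0) (+ 0) -[1+ 0 ]) (2F , false))
    ∷ (rho , tri , motion (lat (+ 0) (+ 1) (+ 0) (+ 0)) (4F , false))
    ∷ (tri , rho , motion (lat (+ 0) (+ 1) (+ 0) -[1+ 0 ]) (3F , true))
    ∷ (tri , rho , motion (lat (+ 0) (+ 1) (+ 1) (+ 0)) (6F , false))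
    ∷ (tri , rho , motion (lat (+ 0) (+ 1) (+ 0) (+ 0)) (4F , false))
    ∷ (tri , tri , motion (lat (+ 0) (+ 0) (+ 0) (+ 0)) (0F , true))
    ∷ (rho , rho , motion (lat (+ 1) (+ 1) (+ 0) (+ 0)) (5F , false))
    ∷ (rho , rho , motion (lat (+ 0) (+ 0) (+ 0) (+ 0)) (7F , false))
    ∷ (rho , rho , motion (lat (+ 1) (+ 0) -[1+ 0 ] (+ 0)) (1F , false))
    ∷ (rho , rho , motion (lat (+ 1) (+ 0) (+ 0) -[1+ 0 ]) (4F , true))
    ∷ (rho , rho , motion (lat (+ 1) (+ 0) -[1+ 0 ] (+ 0)) (2F , true))
    ∷ (rho , rho , motion (lat (+ 1) (+ 0) (+ 0) -[1+ 0 ]) (3F , false))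
    ∷ (rho , rho , motion (lat (+ 0) (+ 0) (+ 0) (+ 0)) (1F , false))
    ∷ (rho , rho , motion (lat (+ 1) (+ 1) (+ 0) (+ 0)) (4F , true))
    ∷ (rho , rho , motion (lat (+ 0) (+ 1) (+ 0) (+ 1)) (7F , false))
    ∷ (rho , rho , motion (lat (+ 0) (+ 0) (+ 0) (+ 0)) (0F , true))
    ∷ (rho , rho , motion (lat (+ 0) (+ 1) (+ 1) (+ 0)) (6F , true))
    ∷ (rho , rho , motion (lat (+ 1) (+ 1) (+ 0) (+ 0)) (6F , true))
    ∷ (tri , tri , motion (lat (+ 0) (+ 2) (+ 0) (+ 0)) (6F , true))
    ∷ (rho , rho , motion (lat (+ 0) (+ 0) (+ 0) (+ 0)) (2F , true))
    ∷ []

  -- re z = n₀ + (n₁ - n₃) h, and 7/10 ≤ h ≤ 5/7.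
  record Bound (c : ℤ) (z : ℤ[ζ]) : Set where
    constructor bounded
    open ℤ[ζ] z
    field
      certificate :
        + 0 ℤ.≤ n₁ ℤ.- n₃ × c ℤ.≤ + 10 ℤ.* n₀ ℤ.+ + 7 ℤ.* (n₁ ℤ.- n₃) ⊎
        + 0 ℤ.≤ n₃ ℤ.- n₁ × c ℤ.≤ + 7 ℤ.* n₀ ℤ.- + 5 ℤ.* (n₃ ℤ.- n₁)

  NonNegative Positive : ℤ[ζ] → Set
  NonNegative = Bound (+ 0)
  Positive    = Bound (+ 1)

  isTriangle : Shape → Bool
  isTriangle tri = true
  isTriangle rho = false

  Same : Shape → Motion → Shape → Motion → Set
  Same s m t n = (s , m) ≡ (t , n)

  Neighbour : Shape → Motion → Shape → Motion → Shape × Shape × Motion → Set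
  Neighbour s m t n (s′ , t′ , r) = s ≡ s′ × t ≡ t′ × m ⊚ r ≡ n

  -- Two lines at an angle of 45° both separate the tiles.
  Apart : Shape → Motion → Shape → Motion → D₈ → Set
  Apart s m t n ρ = ∀ i j → let w = act ρ (move n (corner t j) ⊟ move m (corner s i)) in
    NonNegative w × NonNegative (ζ· w)

  Related : Shape → Motion → Shape → Motion → Set
  Related s m t n = Same s m t n ⊎ Any (Neighbour s m t n) neighbours ⊎ ∃ (Apart s m t n)

  -- Containment in the expanded tile as far as lines orthogonal to the direction `ρ` can see it:
  -- each corner of the subtile lies between two corners of the expanded tile. Unlike containment
  -- itself, this is a finite set of sign tests.
  Enclosed : Shape → Shape × Motion → D₈ → Set
  Enclosed s (t , d) ρ = ∀ j →
    (∃[ i ] NonNegative (act ρ (inflate (corner s i) ⊟ move d (corner t j)))) ×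
    (∃[ i ] NonNegative (act ρ (move d (corner t j) ⊟ inflate (corner s i))))

  all-Bool? : {P : Bool → Set} → Decidable P → Dec (∀ b → P b)
  all-Bool? P? = map′ (λ { (t , f) true → t ; (t , f) false → f }) (λ p → p true , p false)
    (P? true ×-dec P? false)

  any-Bool? : {P : Bool → Set} → Decidable P → Dec (∃ P)
  any-Bool? P? = map′ [ true ,_ , false ,_ ]′ (λ { (true , p) → inj₁ p ; (false , p) → inj₂ p })
    (P? true ⊎-dec P? false)

  all-D₈? : {P : D₈ → Set} → Decidable P → Dec (∀ ρ → P ρ)
  all-D₈? P? = map′ (λ p (k , b) → p k b) (λ p k b → p (k , b)) (all? λ k → all-Bool? λ b → P? (k , b))

  any-D₈? : {P : D₈ → Set} → Decidable P → Dec (∃ P)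
  any-D₈? P? = map′ (λ (k , b , p) → (k , b) , p) (λ ((k , b) , p) → k , b , p)
    (any? λ k → any-Bool? λ b → P? (k , b))

  infix 4 _≟-D₈_ _≟-lat_ _≟-motion_ _≟-shape_

  _≟-D₈_ : DecidableEquality D₈
  _≟-D₈_ = Product.≡-dec Fin._≟_ Bool._≟_

  _≟-lat_ : DecidableEquality ℤ[ζ]
  lat a b c d ≟-lat lat a′ b′ c′ d′ = map′
    (λ (p , q , r , s) → lat-cong p q r s) (λ { refl → refl , refl , refl , refl })
    (a ℤ.≟ a′ ×-dec b ℤ.≟ b′ ×-dec c ℤ.≟ c′ ×-dec d ℤ.≟ d′)

  _≟-motion_ : DecidableEquality Motion
  motion s ρ ≟-motion motion s′ ρ′ = map′ (λ { (refl , refl) → refl }) (λ { refl → refl , refl })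
    (s ≟-lat s′ ×-dec ρ ≟-D₈ ρ′)

  _≟-shape_ : DecidableEquality Shape
  tri ≟-shape tri = yes refl
  tri ≟-shape rho = no λ ()
  rho ≟-shape tri = no λ ()
  rho ≟-shape rho = yes refl

  bound? : ∀ c → Decidable (Bound c)
  bound? c (lat n₀ n₁ _ n₃) = map′ bounded Bound.certificate ((_ ℤ.≤? _ ×-dec _ ℤ.≤? _) ⊎-dec (_ ℤ.≤? _ ×-dec _ ℤ.≤? _))

  related? : ∀ s m t n → Dec (Related s m t n)
  related? s m t n = Product.≡-dec _≟-shape_ _≟-motion_ (s , m) (t , n)
    ⊎-dec Any.any? (λ (s′ , t′ , r) → s ≟-shape s′ ×-dec t ≟-shape t′ ×-dec m ⊚ r ≟-motion n) neighbours
    ⊎-dec any-D₈? λ ρ → all? λ i → all? λ j → bound? _ _ ×-dec bound? _ _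

  enclosed? : ∀ s t ρ → Dec (Enclosed s t ρ)
  enclosed? s t ρ = all? λ j → any? (λ i → bound? _ _) ×-dec any? (λ i → bound? _ _)

  abstract
    -- Evaluation of all 16³ triples. Marking such facts `abstract` keeps the evaluated witnesses
    -- from being unfolded where they are used.
    ⊙-assoc : ∀ ρ σ τ → (ρ ⊙ σ) ⊙ τ ≡ ρ ⊙ (σ ⊙ τ)
    ⊙-assoc = toWitness {a? = all-D₈? λ ρ → all-D₈? λ σ → all-D₈? λ τ → (ρ ⊙ σ) ⊙ τ ≟-D₈ ρ ⊙ (σ ⊙ τ)} _

  abstract
    parity-⊙ : ∀ ρ σ → parity (ρ ⊙ σ) ≡ parity ρ xor parity σ
    parity-⊙ = toWitness {a? = all-D₈? λ ρ → all-D₈? λ σ → parity (ρ ⊙ σ) Bool.≟ parity ρ xor parity σ} _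

  abstract
    -- Converts a separating direction found in the frame of a tile into a direction of the plane.
    ⊙-divide : ∀ ρ σ → ∃[ τ ] τ ⊙ σ ≡ ρ
    ⊙-divide = toWitness {a? = all-D₈? λ ρ → all-D₈? λ σ → any-D₈? λ τ → τ ⊙ σ ≟-D₈ ρ} _

  SubtilesRelated : Shape → Shape → Motion → Set
  SubtilesRelated s t r = All (λ (s′ , d) → All (λ (t′ , e) →
    Related s′ d t′ (inflateMotion r ⊚ e)) (subtiles t)) (subtiles s)

  subtilesRelated? : ∀ s t r → Dec (SubtilesRelated s t r)
  subtilesRelated? s t r = All.all? (λ (s′ , d) → All.all? (λ (t′ , e) → related? _ _ _ _) (subtiles t)) (subtiles s)

  abstract
    enclosed : ∀ s → All (λ t → ∀ ρ → Enclosed s t ρ) (subtiles s)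
    enclosed tri = toWitness {a? = All.all? (λ t → all-D₈? (enclosed? tri t)) (subtiles tri)} _
    enclosed rho = toWitness {a? = All.all? (λ t → all-D₈? (enclosed? rho t)) (subtiles rho)} _

  abstract
    tile-subtiles-related : ∀ s → SubtilesRelated s s still
    tile-subtiles-related tri = toWitness {a? = subtilesRelated? tri tri still} _
    tile-subtiles-related rho = toWitness {a? = subtilesRelated? rho rho still} _

  abstract
    -- However the list was found, this closure under substitution is what certifies it in the
    -- induction on generations.
    neighbour-subtiles-related : All (λ (s , t , r) → SubtilesRelated s t r) neighbours
    neighbour-subtiles-related = toWitness {a? = All.all? (λ (s , t , r) → subtilesRelated? s t r) neighbours} _

  abstract
    neighbour-parity : All (λ (s , t , r) → isTriangle t xor parity (linear r) ≡ not (isTriangle s)) neighbours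
    neighbour-parity = toWitness {a? = All.all? (λ (s , t , r) → isTriangle t xor parity (linear r) Bool.≟ not (isTriangle s)) neighbours} _

-- The test point near an edge, and the laws of motions on the lattice.

module LatticeLaws (ℝ : RealNumbers) (root : SquareRootOfTwo ℝ) where

  open AmmannBeenker ℝ root using (Shape; tri; rho)
  open ≡ using (refl; cong; cong₂; sym; trans)
  open Lattice ℝ root public

  -- A point of the plane just outside the first edge of either tile.
  below : ℤ[ζ]
  below = lat (+ 0) -[1+ 0 ] (+ 2) -[1+ 1 ]

  Avoids : Shape → Motion → Set
  Avoids t r = ∃[ ρ ] ∀ j → Positive (act ρ (move r (corner t j) ⊟ below))

  successor : ∀ s → Fin (size s) → Fin (size s)
  successor tri 0F = 1F
  successor tri 1F = 2F
  successor tri 2F = 0F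
  successor rho 0F = 1F
  successor rho 1F = 2F
  successor rho 2F = 3F
  successor rho 3F = 0F

  base-end : Shape → ℤ[ζ]
  base-end tri = corner tri 1F
  base-end rho = corner rho 1F

  origin-lat : ℤ[ζ]
  origin-lat = lat (+ 0) (+ 0) (+ 0) (+ 0)

  -- Both orders of the endpoints are allowed, since neighbours may run through the common edge in
  -- either sense.
  HasBase : Shape → Shape → Motion → Set
  HasBase s t r = ∃[ j ]
    (move r (corner t j) ≡ origin-lat × move r (corner t (successor t j)) ≡ base-end s ⊎
     move r (corner t j) ≡ base-end s × move r (corner t (successor t j)) ≡ origin-lat)

  avoids? : ∀ t r → Dec (Avoids t r)
  avoids? t r = any-D₈? λ ρ → all? λ j → bound? _ _

  hasBase? : ∀ s t r → Dec (HasBase s t r)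
  hasBase? s t r = any? λ j → (_ ≟-lat _ ×-dec _ ≟-lat _) ⊎-dec (_ ≟-lat _ ×-dec _ ≟-lat _)

  abstract
    tile-avoids-below : ∀ s → Avoids s still
    tile-avoids-below tri = toWitness {a? = avoids? tri still} _
    tile-avoids-below rho = toWitness {a? = avoids? rho still} _

  abstract
    -- Explains the choice of `below`, which is the point (h, 2 - 3h). It lies about 0.12 under the
    -- midpoint of the hypotenuse and, for the rhombus, under an interior point of the first side.
    -- This is near enough that a listed neighbour not containing the base as an edge is strictly
    -- cut off from it by a line.
    neighbour-base-or-avoids : All (λ (s , t , r) → HasBase s t r ⊎ Avoids t r) neighbours
    neighbour-base-or-avoids = toWitness {a? = All.all? (λ (s , t , r) → hasBase? s t r ⊎-dec avoids? t r) neighbours} _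

  -- Of two directions at 45°, at least one has a corner of the tile strictly beyond `below`. The
  -- point is too close to the base to lie behind both lines that separate a tile from another one.
  BelowInside : Shape → D₈ → Set
  BelowInside s ρ = ∃[ i ] let w = act ρ (corner s i ⊟ below) in Positive w ⊎ Positive (ζ· w)

  abstract
    below-inside : ∀ s ρ → BelowInside s ρ
    below-inside tri = toWitness {a? = all-D₈? λ ρ → any? λ i → bound? _ (act ρ (corner tri i ⊟ below)) ⊎-dec bound? _ _} _
    below-inside rho = toWitness {a? = all-D₈? λ ρ → any? λ i → bound? _ (act ρ (corner rho i ⊟ below)) ⊎-dec bound? _ _} _

  private
    neg-neg : ∀ i → ℤ.- ℤ.- i ≡ i
    neg-neg = ℤ.neg-involutive

  ζ⁸≡1 : ∀ z → iterate ζ·_ 8 z ≡ z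
  ζ⁸≡1 (lat a b c d) = lat-cong (neg-neg a) (neg-neg b) (neg-neg c) (neg-neg d)

  conj-conj : ∀ z → conj (conj z) ≡ z
  conj-conj (lat a b c d) = lat-cong refl (neg-neg b) (neg-neg c) (neg-neg d)

  ζ-conj-ζ : ∀ z → ζ· conj (ζ· z) ≡ conj z
  ζ-conj-ζ (lat a b c d) = lat-cong (neg-neg a) refl refl refl

  act-spin : ∀ σ z → act (spin σ) z ≡ ζ· act σ z
  act-spin (0F , _) z = refl
  act-spin (1F , _) z = refl
  act-spin (2F , _) z = refl
  act-spin (3F , _) z = refl
  act-spin (4F , _) z = refl
  act-spin (5F , _) z = refl
  act-spin (6F , _) z = refl
  act-spin (7F , b) z = sym (ζ⁸≡1 (when b conj z))

  private
    iterate-+ : ∀ {A : Set} (f : A → A) m {n} x → iterate f (m ℕ.+ n) x ≡ iterate f m (iterate f n x)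
    iterate-+ f zero    x = refl
    iterate-+ f (suc m) x = cong f (iterate-+ f m x)

    conj-ζ^ : ∀ n z → iterate ζ·_ n (conj (iterate ζ·_ n z)) ≡ conj z
    conj-ζ^ zero    z = refl
    conj-ζ^ (suc n) z = trans (iterate-out n _) (trans (cong (iterate ζ·_ n) (ζ-conj-ζ _)) (conj-ζ^ n z))
      where
      iterate-out : ∀ n x → ζ· iterate ζ·_ n x ≡ iterate ζ·_ n (ζ· x)
      iterate-out zero    x = refl
      iterate-out (suc n) x = cong ζ·_ (iterate-out n x)

    -- Multiplication by ζⁿ takes the conjugate of ζⁿz back to that of z. Applying ζᵐ with m + n = 8
    -- and ζ⁸ = 1 gives the claim; for 0 both sides already agree.
    opposite-ζ : ∀ k z → iterate ζ·_ (Fin.toℕ (opposite k)) (conj z) ≡ conj (iterate ζ·_ (Fin.toℕ k) z)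
    opposite-ζ k z = go k
      where
      step : ∀ m n → m ℕ.+ n ≡ 8 → iterate ζ·_ m (conj z) ≡ conj (iterate ζ·_ n z)
      step m n eq = trans (cong (iterate ζ·_ m) (sym (conj-ζ^ n z))) (trans (sym (iterate-+ ζ·_ m w))
        (trans (cong (λ k → iterate ζ·_ k w) eq) (ζ⁸≡1 w)))
        where w = conj (iterate ζ·_ n z)
      go : ∀ k → iterate ζ·_ (Fin.toℕ (opposite k)) (conj z) ≡ conj (iterate ζ·_ (Fin.toℕ k) z)
      go 0F = refl
      go 1F = step 7 1 refl
      go 2F = step 6 2 refl
      go 3F = step 5 3 refl
      go 4F = step 4 4 refl
      go 5F = step 3 5 refl
      go 6F = step 2 6 refl
      go 7F = step 1 7 refl

  act-mirror : ∀ σ z → act (mirror σ) z ≡ conj (act σ z)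
  act-mirror (k , false) z = opposite-ζ k z
  act-mirror (k , true)  z = trans (cong (iterate ζ·_ (Fin.toℕ (opposite k))) (sym (conj-conj z))) (opposite-ζ k (conj z))

  act-⊙ : ∀ ρ σ z → act (ρ ⊙ σ) z ≡ act ρ (act σ z)
  act-⊙ (k , b) σ z = trans (spins (Fin.toℕ k) (when b mirror σ)) (cong (iterate ζ·_ (Fin.toℕ k)) (mirrors b))
    where
    spins : ∀ n τ → act (iterate spin n τ) z ≡ iterate ζ·_ n (act τ z)
    spins zero    τ = refl
    spins (suc n) τ = trans (act-spin (iterate spin n τ) z) (cong ζ·_ (spins n τ))
    mirrors : ∀ b → act (when b mirror σ) z ≡ when b conj (act σ z)
    mirrors false = refl
    mirrors true  = act-mirror σ z

  private
    act-induction : (P : (ℤ[ζ] → ℤ[ζ]) → Set) → P id → (∀ {f} → P f → P (ζ·_ ∘ f)) → P conj → ∀ ρ → P (act ρ)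
    act-induction P p-id p-ζ p-conj (k , b) = iterates (Fin.toℕ k)
      where
      start : ∀ b → P (when b conj)
      start false = p-id
      start true  = p-conj
      iterates : ∀ n → P (λ z → iterate ζ·_ n (when b conj z))
      iterates zero    = start b
      iterates (suc n) = p-ζ (iterates n)

  open +-*-Solver

  act-⊞ : ∀ ρ w z → act ρ (w ⊞ z) ≡ act ρ w ⊞ act ρ z
  act-⊞ = act-induction (λ f → ∀ w z → f (w ⊞ z) ≡ f w ⊞ f z) (λ _ _ → refl)
    (λ {f} p w z → trans (cong ζ·_ (p w z)) (ζ-⊞ (f w) (f z)))
    (λ w z → lat-cong refl (ℤ.neg-distrib-+ (n₃ w) (n₃ z)) (ℤ.neg-distrib-+ (n₂ w) (n₂ z)) (ℤ.neg-distrib-+ (n₁ w) (n₁ z)))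
    where
    open ℤ[ζ]
    ζ-⊞ : ∀ w z → ζ· (w ⊞ z) ≡ (ζ· w) ⊞ (ζ· z)
    ζ-⊞ w z = lat-cong (ℤ.neg-distrib-+ (n₃ w) (n₃ z)) refl refl refl

  act-inflate : ∀ ρ z → act ρ (inflate z) ≡ inflate (act ρ z)
  act-inflate = act-induction (λ f → ∀ z → f (inflate z) ≡ inflate (f z)) (λ _ → refl)
    (λ {f} p z → trans (cong ζ·_ (p z)) (ζ-inflate (f z)))
    (λ (lat a b c d) → lat-cong
      (solve 3 (λ a b d → a :+ (b :- d) := a :+ (:- d :- :- b)) refl a b d)
      (solve 3 (λ a c d → :- (d :+ (c :- a)) := :- d :+ (a :+ :- c)) refl a c d)
      (solve 3 (λ b c d → :- (c :+ (b :+ d)) := :- c :+ (:- d :+ :- b)) refl b c d)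
      (solve 3 (λ a b c → :- (b :+ (a :+ c)) := :- b :+ (:- c :- a)) refl a b c))
    where
    ζ-inflate : ∀ z → ζ· inflate z ≡ inflate (ζ· z)
    ζ-inflate (lat a b c d) = lat-cong
      (solve 3 (λ a c d → :- (d :+ (c :- a)) := :- d :+ (a :- c)) refl a c d)
      (solve 3 (λ a b d → a :+ (b :- d) := a :+ (:- d :+ b)) refl a b d)
      (solve 3 (λ a b c → b :+ (a :+ c) := b :+ (a :+ c)) refl a b c)
      (solve 3 (λ b c d → c :+ (b :+ d) := c :+ (b :- :- d)) refl b c d)

  inflate-⊞ : ∀ w z → inflate (w ⊞ z) ≡ inflate w ⊞ inflate z
  inflate-⊞ (lat a b c d) (lat a′ b′ c′ d′) = lat-cong (e a b d a′ b′ d′) (e′ b a c b′ a′ c′) (e′ c b d c′ b′ d′) (e d c a d′ c′ a′)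
    where
    e = solve 6 (λ a b d a′ b′ d′ → a :+ a′ :+ (b :+ b′ :- (d :+ d′)) := a :+ (b :- d) :+ (a′ :+ (b′ :- d′))) refl
    e′ = solve 6 (λ a b d a′ b′ d′ → a :+ a′ :+ (b :+ b′ :+ (d :+ d′)) := a :+ (b :+ d) :+ (a′ :+ (b′ :+ d′))) refl

  ⊞-assoc : ∀ u v w → u ⊞ v ⊞ w ≡ u ⊞ (v ⊞ w)
  ⊞-assoc (lat a b c d) (lat a′ b′ c′ d′) (lat a″ b″ c″ d″) = lat-cong
    (ℤ.+-assoc a a′ a″) (ℤ.+-assoc b b′ b″) (ℤ.+-assoc c c′ c″) (ℤ.+-assoc d d′ d″)

  move-⊚ : ∀ m n z → move (m ⊚ n) z ≡ move m (move n z)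
  move-⊚ (motion s ρ) (motion t σ) z = trans (cong (s ⊞ act ρ t ⊞_) (act-⊙ ρ σ z))
    (trans (⊞-assoc s (act ρ t) (act ρ (act σ z))) (cong (s ⊞_) (sym (act-⊞ ρ t (act σ z)))))

  ⊚-assoc : ∀ l m n → (l ⊚ m) ⊚ n ≡ l ⊚ (m ⊚ n)
  ⊚-assoc l m n = cong₂ motion (move-⊚ l m (shift n)) (⊙-assoc (linear l) (linear m) (linear n))

  inflate-move : ∀ m z → inflate (move m z) ≡ move (inflateMotion m) (inflate z)
  inflate-move (motion s ρ) z = trans (inflate-⊞ s (act ρ z)) (cong (inflate s ⊞_) (sym (act-inflate ρ z)))

  inflateMotion-⊚ : ∀ m n → inflateMotion (m ⊚ n) ≡ inflateMotion m ⊚ inflateMotion n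
  inflateMotion-⊚ m n = cong (λ z → motion z (linear m ⊙ linear n)) (inflate-move m (shift n))

  move-still : ∀ z → move still z ≡ z
  move-still (lat a b c d) = lat-cong (ℤ.+-identityˡ _) (ℤ.+-identityˡ _) (ℤ.+-identityˡ _) (ℤ.+-identityˡ _)

-- Embedding of the lattice in the plane, and the trichotomy for tiles of a patch.

module Placement (ℝ : RealNumbers) (root : SquareRootOfTwo ℝ) where

  open Plane ℝ root public
  open LatticeLaws ℝ root public

  fromℤ-- : ∀ i j → fromℤ (i ℤ.- j) ≈ fromℤ i - fromℤ j
  fromℤ-- i j = trans (fromℤ-+ i (ℤ.- j)) (+-cong refl (fromℤ-neg j))

  fromℤ-mono : ∀ {i j} → i ℤ.≤ j → fromℤ i ≤ fromℤ j
  fromℤ-mono {i} {j} i≤j = x≤y-from-0≤ (≤-respʳ (fromℤ-nonNegative (ℤ.i≤j⇒0≤j-i i≤j)) (fromℤ-- j i))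

  private
    combine : Carrier → Carrier → Carrier → Carrier → Point
    combine a b c d = a + (b - d) * h , c + (b + d) * h

    combine-cong : ∀ {a b c d a′ b′ c′ d′} → a ≈ a′ → b ≈ b′ → c ≈ c′ → d ≈ d′ → combine a b c d ≈ₚ combine a′ b′ c′ d′
    combine-cong p q r s = +-cong p (*-cong (+-cong q (-‿cong s)) refl) , +-cong r (*-cong (+-cong q s) refl)

  ι : ℤ[ζ] → Point
  ι (lat a b c d) = combine (fromℤ a) (fromℤ b) (fromℤ c) (fromℤ d)

  ι-cong : ∀ {w z} → w ≡ z → ι w ≈ₚ ι z
  ι-cong ≡.refl = ≈ₚ-refl

  ι-⊞ : ∀ w z → ι (w ⊞ z) ≈ₚ ι w ⊕ ι z
  ι-⊞ (lat a b c d) (lat a′ b′ c′ d′) = ≈ₚ-trans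
    (combine-cong (fromℤ-+ a a′) (fromℤ-+ b b′) (fromℤ-+ c c′) (fromℤ-+ d d′))
    ( solve 7 (λ h a b d a′ b′ d′ → a :+ a′ :+ (b :+ b′ :- (d :+ d′)) :* h := a :+ (b :- d) :* h :+ (a′ :+ (b′ :- d′) :* h)) refl h _ _ _ _ _ _
    , solve 7 (λ h a b d a′ b′ d′ → a :+ a′ :+ (b :+ b′ :+ (d :+ d′)) :* h := a :+ (b :+ d) :* h :+ (a′ :+ (b′ :+ d′) :* h)) refl h _ _ _ _ _ _)

  ι-⊟ : ∀ w z → ι (w ⊟ z) ≈ₚ ι w ⊖ ι z
  ι-⊟ (lat a b c d) (lat a′ b′ c′ d′) = ≈ₚ-trans
    (combine-cong (fromℤ-- a a′) (fromℤ-- b b′) (fromℤ-- c c′) (fromℤ-- d d′))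
    ( solve 7 (λ h a b d a′ b′ d′ → a :- a′ :+ (b :- b′ :- (d :- d′)) :* h := a :+ (b :- d) :* h :- (a′ :+ (b′ :- d′) :* h)) refl h _ _ _ _ _ _
    , solve 7 (λ h a b d a′ b′ d′ → a :- a′ :+ (b :- b′ :+ (d :- d′)) :* h := a :+ (b :+ d) :* h :- (a′ :+ (b′ :+ d′) :* h)) refl h _ _ _ _ _ _)

  ι-ζ : ∀ z → ι (ζ· z) ≈ₚ rotate (ι z)
  ι-ζ (lat a b c d) = ≈ₚ-trans (combine-cong (fromℤ-neg d) refl refl refl)
    ( ≈-from-zero 2h²-1≈0 (solve 5 (λ h a b c d → (:- d) :+ (a :- c) :* h :=
        h :* (a :+ (b :- d) :* h :- (c :+ (b :+ d) :* h)) :+ d :* (:2 :* (h :* h) :- :1)) refl h _ _ _ _)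
    , ≈-from-zero 2h²-1≈0 (solve 5 (λ h a b c d → b :+ (a :+ c) :* h :=
        h :* (a :+ (b :- d) :* h :+ (c :+ (b :+ d) :* h)) :+ (:- b) :* (:2 :* (h :* h) :- :1)) refl h _ _ _ _))

  ι-conj : ∀ z → ι (conj z) ≈ₚ reflect (ι z)
  ι-conj (lat a b c d) = ≈ₚ-trans (combine-cong refl (fromℤ-neg d) (fromℤ-neg c) (fromℤ-neg b))
    ( solve 4 (λ h a b d → a :+ ((:- d) :- (:- b)) :* h := a :+ (b :- d) :* h) refl h _ _ _
    , solve 4 (λ h b c d → (:- c) :+ ((:- d) :+ (:- b)) :* h := :- (c :+ (b :+ d) :* h)) refl h _ _ _)

  ι-inflate : ∀ z → ι (inflate z) ≈ₚ Λ · ι z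
  ι-inflate (lat a b c d) = ≈ₚ-trans
    (combine-cong (trans (fromℤ-+ a _) (+-cong refl (fromℤ-- b d))) (trans (fromℤ-+ b _) (+-cong refl (fromℤ-+ a c)))
      (trans (fromℤ-+ c _) (+-cong refl (fromℤ-+ b d))) (trans (fromℤ-+ d _) (+-cong refl (fromℤ-- c a)))) (≈ₚ-trans
    ( ≈-from-zero 2h²-1≈0 (solve 5 (λ h a b c d → a :+ (b :- d) :+ (b :+ (a :+ c) :- (d :+ (c :- a))) :* h :=
        (:1 :+ :2 :* h) :* (a :+ (b :- d) :* h) :+ (d :- b) :* (:2 :* (h :* h) :- :1)) refl h _ _ _ _)
    , ≈-from-zero 2h²-1≈0 (solve 5 (λ h a b c d → c :+ (b :+ d) :+ (b :+ (a :+ c) :+ (d :+ (c :- a))) :* h :=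
        (:1 :+ :2 :* h) :* (c :+ (b :+ d) :* h) :+ (:0 :- b :- d) :* (:2 :* (h :* h) :- :1)) refl h _ _ _ _))
    (·-cong (+-cong refl 2h≈√2) ≈ₚ-refl))

  actR : D₈ → Point → Point
  actR (k , b) p = iterate rotate (Fin.toℕ k) (when b reflect p)

  actR-orthogonal : ∀ ρ → IsOrthogonal (actR ρ)
  actR-orthogonal (k , b) = iterates (Fin.toℕ k)
    where
    start : ∀ b → IsOrthogonal (when b reflect)
    start false = id-orthogonal
    start true  = reflect-orthogonal
    iterates : ∀ n → IsOrthogonal (λ p → iterate rotate n (when b reflect p))
    iterates zero    = start b
    iterates (suc n) = ∘-orthogonal rotate-orthogonal (iterates n)

  ι-act : ∀ ρ z → ι (act ρ z) ≈ₚ actR ρ (ι z)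
  ι-act (k , b) z = iterates (Fin.toℕ k)
    where
    start : ∀ b → ι (when b conj z) ≈ₚ when b reflect (ι z)
    start false = ≈ₚ-refl
    start true  = ι-conj z
    iterates : ∀ n → ι (iterate ζ·_ n (when b conj z)) ≈ₚ iterate rotate n (when b reflect (ι z))
    iterates zero    = start b
    iterates (suc n) = ≈ₚ-trans (ι-ζ (iterate ζ·_ n (when b conj z))) (IsOrthogonal.cong rotate-orthogonal (iterates n))

  iterate-rotate-8 : ∀ p → iterate rotate 8 p ≈ₚ p
  iterate-rotate-8 p = ≈ₚ-trans (R.cong (R.cong (R.cong (R.cong (half p)))))
    (≈ₚ-trans (half (- proj₁ p , - proj₂ p)) (e _ , e _))
    where
    module R = IsOrthogonal rotate-orthogonal
    e = solve 1 (λ x → :- (:- x) := x) refl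
    quarter : ∀ p → rotate (rotate p) ≈ₚ (- proj₂ p , proj₁ p)
    quarter (x , y) =
        ≈-from-zero 2h²-1≈0 (solve 3 (λ h x y → h :* (h :* (x :- y) :- h :* (x :+ y)) := (:- y) :+ (:- y) :* (:2 :* (h :* h) :- :1)) refl h x y)
      , ≈-from-zero 2h²-1≈0 (solve 3 (λ h x y → h :* (h :* (x :- y) :+ h :* (x :+ y)) := x :+ x :* (:2 :* (h :* h) :- :1)) refl h x y)
    half : ∀ p → iterate rotate 4 p ≈ₚ (- proj₁ p , - proj₂ p)
    half p = ≈ₚ-trans (R.cong (R.cong (quarter p))) (quarter _)

  actR-spin : ∀ ρ p → actR (spin ρ) p ≈ₚ rotate (actR ρ p)
  actR-spin (0F , _) p = ≈ₚ-refl
  actR-spin (1F , _) p = ≈ₚ-refl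
  actR-spin (2F , _) p = ≈ₚ-refl
  actR-spin (3F , _) p = ≈ₚ-refl
  actR-spin (4F , _) p = ≈ₚ-refl
  actR-spin (5F , _) p = ≈ₚ-refl
  actR-spin (6F , _) p = ≈ₚ-refl
  actR-spin (7F , b) p = ≈ₚ-sym (iterate-rotate-8 (when b reflect p))

  re : ℤ[ζ] → Carrier
  re z = proj₁ (ι z)

  -- The scale is the denominator of the bound for `h` used: 7/10 from below where `h` has a
  -- nonnegative coefficient, 5/7 from above otherwise.
  bound-sound : ∀ {c} z → Bound c z → fromℤ c ≤ fromℕ 10 * re z ⊎ fromℤ c ≤ fromℕ 7 * re z
  bound-sound {c} (lat a b _ d) (bounded (inj₁ (0≤b-d , c≤))) = inj₁
    (≤-respˡ (sym (+-identityʳ _)) (≤-respʳ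
      (+-mono-≤ (fromℤ-mono c≤) (*-nonNegative (fromℤ-nonNegative 0≤b-d) 7≤10h))
      (trans (+-cong (trans (fromℤ-+ (+ 10 ℤ.* a) _) (+-cong (fromℤ-* (+ 10) a) (trans (fromℤ-* (+ 7) (b ℤ.- d)) (*-cong refl (fromℤ-- b d)))))
          (*-cong (fromℤ-- b d) refl))
        (solve 4 (λ h a b d → con (+ 10) :* a :+ con (+ 7) :* (b :- d) :+ (b :- d) :* (con (+ 10) :* h :- con (+ 7)) :=
          con (+ 10) :* (a :+ (b :- d) :* h)) refl h _ _ _))))
  bound-sound {c} (lat a b _ d) (bounded (inj₂ (0≤d-b , c≤))) = inj₂
    (≤-respˡ (sym (+-identityʳ _)) (≤-respʳ
      (+-mono-≤ (fromℤ-mono c≤) (*-nonNegative (fromℤ-nonNegative 0≤d-b) 7h≤5))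
      (trans (+-cong (trans (fromℤ-- (+ 7 ℤ.* a) _) (+-cong (fromℤ-* (+ 7) a) (-‿cong (trans (fromℤ-* (+ 5) (d ℤ.- b)) (*-cong refl (fromℤ-- d b))))))
          (*-cong (fromℤ-- d b) refl))
        (solve 4 (λ h a b d → con (+ 7) :* a :- con (+ 5) :* (d :- b) :+ (d :- b) :* (con (+ 5) :- con (+ 7) :* h) :=
          con (+ 7) :* (a :+ (b :- d) :* h)) refl h _ _ _))))

  nonNegative-scaled : ∀ n {x} → 0# ≤ fromℕ (suc n) * x → 0# ≤ x
  nonNegative-scaled n {x} 0≤nx with total 0# x
  ... | inj₁ 0≤x = 0≤x
  ... | inj₂ x≤0 = ≤-reflexive (sym (*-cancel (fromℕ≉0 n) (antisym
    (≤-respʳ (*-monoˡ-≤ (fromℕ-nonNegative (suc n)) x≤0) (zeroʳ _)) 0≤nx)))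

  nonNegative-sound : ∀ z → NonNegative z → 0# ≤ re z
  nonNegative-sound z b with bound-sound z b
  ... | inj₁ p = nonNegative-scaled 9 p
  ... | inj₂ p = nonNegative-scaled 6 p

  -- One constant for both cases of the certificate. A gap uniform over the corners of a tile is
  -- what passes to their convex hull.
  positive-scaled : ∀ z → Positive z → 1# ≤ fromℕ 10 * re z
  positive-scaled z b with bound-sound z b
  ... | inj₁ p = p
  ... | inj₂ p = ≤-trans p (≤-respˡ (sym (+-identityʳ _)) (≤-respʳ
    (+-mono-≤ ≤-refl (*-nonNegative (fromℕ-nonNegative 3) (nonNegative-scaled 6 (≤-trans 0≤1 p))))
    (solve 1 (λ x → con (+ 7) :* x :+ con (+ 3) :* x := con (+ 10) :* x) refl (re z))))

  positive-sound : ∀ z → Positive z → ¬ re z ≤ 0#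
  positive-sound z b re≤0 = 1≰0 (≤-trans (positive-scaled z b) (≤-respʳ (*-monoˡ-≤ (fromℕ-nonNegative 10) re≤0) (zeroʳ _)))

  form : D₈ → Point → Carrier
  form ρ p = proj₁ (actR ρ p)

  form-linear : ∀ ρ → IsLinearForm (form ρ)
  form-linear ρ = coordinate-form (actR-orthogonal ρ)

  -- In the frame of `ρ` the two forms are x and h(x - y), which determine x and y because `h` is
  -- nonzero.
  forms-separate-points : ∀ ρ {p q} → form ρ p ≈ form ρ q → form (spin ρ) p ≈ form (spin ρ) q → p ≈ₚ q
  forms-separate-points ρ {p} {q} eq eq′ = ⊖≈0⇒≈ₚ (dot≈0⇒≈0 (trans (sym (A.dots _ _)) (trans (dot-cong zero′ zero′)
    (solve 0 (:0 :* :0 :+ :0 :* :0 := :0) refl))))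
    where
    module A = IsOrthogonal (actR-orthogonal ρ)
    r = actR ρ (p ⊖ q)
    x≈0 : proj₁ r ≈ 0#
    x≈0 = trans (proj₁ (A.⊖-hom p q)) (x-x≈0 eq)
    h⟨x-y⟩≈0 : h * (proj₁ r - proj₂ r) ≈ 0#
    h⟨x-y⟩≈0 = trans (proj₁ (≈ₚ-sym (actR-spin ρ (p ⊖ q))))
      (trans (proj₁ (IsOrthogonal.⊖-hom (actR-orthogonal (spin ρ)) p q)) (x-x≈0 eq′))
    zero′ : r ≈ₚ (0# , 0#)
    zero′ = x≈0 , trans (sym (x-y≈0⇒x≈y (*-cancel h≉0 h⟨x-y⟩≈0))) x≈0

  -- Shifts cancel in a difference, so a comparison along `ρ` in the plane is a sign question about
  -- one lattice element in the frame of `m`.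
  form-difference : ∀ ρ m w z → form ρ (ι (move m w)) - form ρ (ι (move m z)) ≈ re (act (ρ ⊙ linear m) (w ⊟ z))
  form-difference ρ m@(motion s σ) w z = trans (sym (proj₁ (A.⊖-hom _ _))) (proj₁ (≈ₚ-sym (≈ₚ-trans
      (ι-cong (act-⊙ ρ σ (w ⊟ z))) (≈ₚ-trans (ι-act ρ _) (A.cong (≈ₚ-trans (ι-act σ _) (≈ₚ-trans (B.cong (ι-⊟ w z))
      (≈ₚ-trans (B.⊖-hom _ _) (≈ₚ-sym (≈ₚ-trans (⊖-cong (moved w) (moved z)) (e _ _ _ , e _ _ _)))))))))))
    where
    module A = IsOrthogonal (actR-orthogonal ρ)
    module B = IsOrthogonal (actR-orthogonal σ)
    moved : ∀ w → ι (move m w) ≈ₚ ι s ⊕ actR σ (ι w)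
    moved w = ≈ₚ-trans (ι-⊞ s _) (⊕-cong ≈ₚ-refl (ι-act σ w))
    e = solve 3 (λ o x y → o :+ x :- (o :+ y) := x :- y) refl

  form-≤ : ∀ ρ m w z → NonNegative (act (ρ ⊙ linear m) (w ⊟ z)) → form ρ (ι (move m z)) ≤ form ρ (ι (move m w))
  form-≤ ρ m w z p = x≤y-from-0≤ (≤-respʳ (nonNegative-sound _ p) (sym (form-difference ρ m w z)))

  form-≰ : ∀ ρ m w z → Positive (act (ρ ⊙ linear m) (w ⊟ z)) → ¬ form ρ (ι (move m w)) ≤ form ρ (ι (move m z))
  form-≰ ρ m w z p w≤z = positive-sound _ p (≤-respˡ (sym (form-difference ρ m w z))
    (≤-respʳ (+-monoˡ-≤ _ w≤z) (-‿inverseʳ _)))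

  form-move-⊚ : ∀ ρ m n z → form ρ (ι (move (m ⊚ n) z)) ≈ form ρ (ι (move m (move n z)))
  form-move-⊚ ρ m n z = IsLinearForm.cong (form-linear ρ) (ι-cong (move-⊚ m n z))

  vertex : ∀ s → Motion → Fin (size s) → Point
  vertex s m i = ι (move m (corner s i))

  Precedes : D₈ → Shape → Motion → Shape → Motion → Set
  Precedes ρ s m t n = ∀ i j → form ρ (vertex s m i) ≤ form ρ (vertex t n j)

  -- `Related` for absolute positions. The separated case keeps real inequalities instead of integer
  -- certificates: there is no finite table of separated positions to recheck, whereas an inequality
  -- survives multiplication by `Λ`.
  data Relation (s : Shape) (m : Motion) : Shape → Motion → Set where
    same      : Relation s m s m
    neighbour : ∀ {t r} → (s , t , r) ∈ˡ neighbours → Relation s m t (m ⊚ r)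
    separated : ∀ {t n} ρ → Precedes ρ s m t n → Precedes (spin ρ) s m t n → Relation s m t n

  spin-⊙ : ∀ ρ σ w → act (spin ρ ⊙ σ) w ≡ ζ· act (ρ ⊙ σ) w
  spin-⊙ ρ σ w = ≡.trans (act-⊙ (spin ρ) σ w) (≡.trans (act-spin ρ (act σ w)) (≡.cong ζ·_ (≡.sym (act-⊙ ρ σ w))))

  -- A common motion on the left keeps equality and the relative position; a separating direction σ
  -- turns into the ρ for which `ρ ⊙ linear m` is σ.
  related⇒relation : ∀ m {s t d e} → Related s d t e → Relation s (m ⊚ d) t (m ⊚ e)
  related⇒relation m (inj₁ ≡.refl) = same
  related⇒relation m {s} {t} {d} (inj₂ (inj₁ any)) with find any
  ... | _ , ∈neighbours , ≡.refl , ≡.refl , ≡.refl =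
    ≡.subst (Relation s (m ⊚ d) t) (⊚-assoc m d _) (neighbour ∈neighbours)
  related⇒relation m {s} {t} {d} {e} (inj₂ (inj₂ (σ , apart))) with ⊙-divide σ (linear m)
  ... | ρ , ≡.refl = separated ρ
    (λ i j → precede ρ i j (proj₁ (apart i j)))
    (λ i j → precede (spin ρ) i j (≡.subst NonNegative (≡.sym (spin-⊙ ρ (linear m) (move e (corner t j) ⊟ move d (corner s i)))) (proj₂ (apart i j))))
    where
    precede : ∀ ρ i j → NonNegative (act (ρ ⊙ linear m) (move e (corner t j) ⊟ move d (corner s i))) →
      form ρ (vertex s (m ⊚ d) i) ≤ form ρ (vertex t (m ⊚ e) j)
    precede ρ i j p = ≤-respˡ (form-move-⊚ ρ m d (corner s i)) (≤-respʳ
      (form-≤ ρ m (move e (corner t j)) (move d (corner s i)) p) (sym (form-move-⊚ ρ m e (corner t j))))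

  0≤Λ : 0# ≤ Λ
  0≤Λ = +-nonNegative 0≤1 0≤√2

  private
    form-inflate : ∀ ρ m z → form ρ (ι (move (inflateMotion m) (inflate z))) ≈ Λ * form ρ (ι (move m z))
    form-inflate ρ m z = trans (F.cong (≈ₚ-trans (ι-cong (≡.sym (inflate-move m z))) (ι-inflate (move m z)))) (F.·-hom _ _)
      where module F = IsLinearForm (form-linear ρ)

  -- A chain through expanded corners: `enclosed` puts the corner of the first subtile below one of
  -- the first expanded tile, and the corner of the second subtile above one of the second. Between
  -- them stands the hypothesis multiplied by `Λ`.
  subtiles-precede : ∀ ρ {s m t n} → Precedes ρ s m t n → ∀ {s′ d t′ e} → (s′ , d) ∈ˡ subtiles s → (t′ , e) ∈ˡ subtiles t →
    Precedes ρ s′ (inflateMotion m ⊚ d) t′ (inflateMotion n ⊚ e)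
  subtiles-precede ρ {s} {m} {t} {n} before {s′} {d} {t′} {e} d∈ e∈ i j
    with All.lookup (enclosed s) d∈ (ρ ⊙ linear m) i | All.lookup (enclosed t) e∈ (ρ ⊙ linear n) j
  ... | (k , p) , _ | _ , (l , q)
    = ≤-respˡ (form-move-⊚ ρ (inflateMotion m) d (corner s′ i))
      (≤-trans (form-≤ ρ (inflateMotion m) (inflate (corner s k)) _ p)
      (≤-respˡ (form-inflate ρ m (corner s k))
      (≤-trans (*-monoˡ-≤ 0≤Λ (before k l))
      (≤-respˡ (sym (form-inflate ρ n (corner t l)))
      (≤-respʳ (form-≤ ρ (inflateMotion n) _ (inflate (corner t l)) q)
      (sym (form-move-⊚ ρ (inflateMotion n) e (corner t′ j))))))))

  subtiles-relation : ∀ {s m t n} → Relation s m t n → ∀ {s′ d t′ e} → (s′ , d) ∈ˡ subtiles s → (t′ , e) ∈ˡ subtiles t →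
    Relation s′ (inflateMotion m ⊚ d) t′ (inflateMotion n ⊚ e)
  subtiles-relation {s} {m} same {d = d} {e = e} d∈ e∈ = related⇒relation (inflateMotion m)
    -- Composition with `inflateMotion still` leaves the linear part unchanged by computation; for
    -- the shift this is `move-still`.
    (≡.subst (Related _ d _) (≡.cong (λ z → motion z (linear e)) (move-still (shift e)))
      (All.lookup (All.lookup (tile-subtiles-related s) d∈) e∈))
  subtiles-relation {m = m} (neighbour {r = r} r∈) {s′} {d} {t′} {e} d∈ e∈ = ≡.subst (Relation s′ (inflateMotion m ⊚ d) t′)
    (≡.sym (≡.trans (≡.cong (_⊚ e) (inflateMotion-⊚ m r)) (⊚-assoc (inflateMotion m) (inflateMotion r) e)))
    (related⇒relation (inflateMotion m) (All.lookup (All.lookup (All.lookup neighbour-subtiles-related r∈) d∈) e∈))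
  subtiles-relation {m = m} {n = n} (separated ρ p q) d∈ e∈ = separated ρ
    (subtiles-precede ρ {m = m} {n = n} p d∈ e∈) (subtiles-precede (spin ρ) {m = m} {n = n} q d∈ e∈)

  -- Since ω expands about the origin before dissecting, a child is placed relative to the inflated
  -- position of its parent. The generation is an index so that two descendants can be traced back
  -- in step to one ancestor.
  data Descendant (s : Shape) : ℕ → Shape → Motion → Set where
    ancestor : Descendant s zero s still
    child    : ∀ {n t m t′ d} → Descendant s n t m → (t′ , d) ∈ˡ subtiles t →
               Descendant s (suc n) t′ (inflateMotion m ⊚ d)

  descendants-related : ∀ {s n t m t′ m′} → Descendant s n t m → Descendant s n t′ m′ → Relation t m t′ m′
  descendants-related ancestor ancestor = same
  descendants-related (child p d∈) (child q e∈) = subtiles-relation (descendants-related p q) d∈ e∈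

-- Lattice description of the tiles of ωⁿ.

module Patches (ℝ : RealNumbers) (root : SquareRootOfTwo ℝ) where

  open Placement ℝ root public
  open IsAffineIsometry

  ≐-refl : ∀ {t} → t ≐ t
  ≐-refl {triangle _ _ _}  = ≈ₚ-refl , ≈ₚ-refl , ≈ₚ-refl
  ≐-refl {rhombus _ _ _ _} = ≈ₚ-refl , ≈ₚ-refl , ≈ₚ-refl , ≈ₚ-refl

  ≐-sym : ∀ {t u} → t ≐ u → u ≐ t
  ≐-sym {triangle _ _ _}  {triangle _ _ _}  (p , q , r)     = ≈ₚ-sym p , ≈ₚ-sym q , ≈ₚ-sym r
  ≐-sym {rhombus _ _ _ _} {rhombus _ _ _ _} (p , q , r , s) = ≈ₚ-sym p , ≈ₚ-sym q , ≈ₚ-sym r , ≈ₚ-sym s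

  ≐-trans : ∀ {t u v} → t ≐ u → u ≐ v → t ≐ v
  ≐-trans {triangle _ _ _} {triangle _ _ _} {triangle _ _ _} (p , q , r) (p′ , q′ , r′) =
    ≈ₚ-trans p p′ , ≈ₚ-trans q q′ , ≈ₚ-trans r r′
  ≐-trans {rhombus _ _ _ _} {rhombus _ _ _ _} {rhombus _ _ _ _} (p , q , r , s) (p′ , q′ , r′ , s′) =
    ≈ₚ-trans p p′ , ≈ₚ-trans q q′ , ≈ₚ-trans r r′ , ≈ₚ-trans s s′

  mapTile-cong : ∀ {f g : Point → Point} → (∀ {p q} → p ≈ₚ q → f p ≈ₚ g q) → ∀ {t u} → t ≐ u → mapTile f t ≐ mapTile g u
  mapTile-cong f≈g {triangle _ _ _}  {triangle _ _ _}  (p , q , r)     = f≈g p , f≈g q , f≈g r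
  mapTile-cong f≈g {rhombus _ _ _ _} {rhombus _ _ _ _} (p , q , r , s) = f≈g p , f≈g q , f≈g r , f≈g s

  tileOf : Shape → (ℤ[ζ] → Point) → Tile
  tileOf tri f = triangle (f (corner tri 0F)) (f (corner tri 1F)) (f (corner tri 2F))
  tileOf rho f = rhombus (f (corner rho 0F)) (f (corner rho 1F)) (f (corner rho 2F)) (f (corner rho 3F))

  tileOf-cong : ∀ s {f g} → (∀ z → f z ≈ₚ g z) → tileOf s f ≐ tileOf s g
  tileOf-cong tri f≈g = f≈g _ , f≈g _ , f≈g _
  tileOf-cong rho f≈g = f≈g _ , f≈g _ , f≈g _ , f≈g _

  mapTile-tileOf : ∀ s g f → mapTile g (tileOf s f) ≡ tileOf s (g ∘ f)
  mapTile-tileOf tri g f = ≡.refl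
  mapTile-tileOf rho g f = ≡.refl

  place : Shape → Motion → Tile
  place s m = tileOf s (ι ∘ move m)

  private
    coordinate : ℤ → ℤ → Carrier
    coordinate i j = fromℤ i + fromℤ j * h

    ι-coordinates : ∀ a b c d → ι (lat a b c d) ≈ₚ (coordinate a (b ℤ.- d) , coordinate c (b ℤ.+ d))
    ι-coordinates a b c d = +-cong refl (*-cong (sym (fromℤ-- b d)) refl) , +-cong refl (*-cong (sym (fromℤ-+ b d)) refl)

    -- A record instead of the bare equation, so that the lattice point can be inferred from the
    -- expected type; `ι` would be unfolded.
    record _∼_ (p : Point) (z : ℤ[ζ]) : Set where
      constructor represents
      field represented : p ≈ₚ ι z
    open _∼_

    at : ∀ {z : ℤ[ζ]} {x y : Carrier} → let lat a b c d = z in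
      x ≈ coordinate a (b ℤ.- d) → y ≈ coordinate c (b ℤ.+ d) → (x , y) ∼ z
    at {lat a b c d} x y = represents (≈ₚ-trans (x , y) (≈ₚ-sym (ι-coordinates a b c d)))

    Presents : Tile → Shape × Motion → Set
    Presents (triangle p q r)  (tri , m) = let z = move m ∘ corner tri in p ∼ z 0F × q ∼ z 1F × r ∼ z 2F
    Presents (rhombus p q r s) (rho , m) = let z = move m ∘ corner rho in p ∼ z 0F × q ∼ z 1F × r ∼ z 2F × s ∼ z 3F
    Presents _                 _         = ⊥

    presents⇒≐ : ∀ t s m → Presents t (s , m) → t ≐ place s m
    presents⇒≐ (triangle _ _ _)  tri _ (p , q , r)     = represented p , represented q , represented r
    presents⇒≐ (rhombus _ _ _ _) rho _ (p , q , r , s) = represented p , represented q , represented r , represented s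

    0≈ : 0# ≈ coordinate (+ 0) (+ 0)
    0≈ = solve 1 (λ h → :0 := :0 :+ :0 :* h) refl h
    1≈ : 1# ≈ coordinate (+ 1) (+ 0)
    1≈ = solve 1 (λ h → :1 := :1 :+ :0 :* h) refl h
    h≈ : h ≈ coordinate (+ 0) (+ 1)
    h≈ = solve 1 (λ h → h := :0 :+ :1 :* h) refl h
    √2≈ : √2 ≈ coordinate (+ 0) (+ 2)
    √2≈ = trans √2≈2h (solve 1 (λ h → :2 :* h := :0 :+ :2 :* h) refl h)
    Λ≈ : Λ ≈ coordinate (+ 1) (+ 2)
    Λ≈ = +-cong refl √2≈2h
    1+h≈ : 1# + h ≈ coordinate (+ 1) (+ 1)
    1+h≈ = solve 1 (λ h → :1 :+ h := :1 :+ :1 :* h) refl h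
    2+h≈ : 2# + h ≈ coordinate (+ 2) (+ 1)
    2+h≈ = solve 1 (λ h → :2 :+ h := :2 :+ :1 :* h) refl h
    2+√2≈ : 2# + √2 ≈ coordinate (+ 2) (+ 2)
    2+√2≈ = +-cong refl √2≈2h
    Λ+1≈ : Λ + 1# ≈ coordinate (+ 2) (+ 2)
    Λ+1≈ = trans (+-cong Λ≈ refl) (solve 1 (λ h → :1 :+ :2 :* h :+ :1 := :2 :+ :2 :* h) refl h)
    1+3h≈ : 1# + 3# * h ≈ coordinate (+ 1) (+ 3)
    1+3h≈ = solve 1 (λ h → :1 :+ (:2 :+ :1) :* h := :1 :+ con (+ 3) :* h) refl h
    2+3h≈ : 2# + 3# * h ≈ coordinate (+ 2) (+ 3)
    2+3h≈ = solve 1 (λ h → :2 :+ (:2 :+ :1) :* h := :2 :+ con (+ 3) :* h) refl h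

  prototile-place : ∀ s → prototile s ≐ place s still
  prototile-place tri = presents⇒≐ (prototile tri) tri still (at 0≈ 0≈ , at √2≈ 0≈ , at h≈ h≈)
  prototile-place rho = presents⇒≐ (prototile rho) rho still (at 0≈ 0≈ , at 1≈ 0≈ , at 1+h≈ h≈ , at h≈ h≈)

  private
    -- Certifies the table `subtiles` against the coordinates of `dissection`, entry by entry and
    -- vertex by vertex.
    dissection-presents : ∀ s → Pointwise Presents (dissection s) (subtiles s)
    dissection-presents tri =
        (at 1≈ 1≈ , at 0≈ 0≈ , at 1≈ 0≈)
      ∷ (at Λ≈ 0≈ , at 1≈ 0≈ , at 1+h≈ h≈)
      ∷ (at 2+h≈ h≈ , at 1+h≈ 1+h≈ , at 1+h≈ h≈)
      ∷ (at 1≈ 0≈ , at 1≈ 1≈ , at 1+h≈ 1+h≈ , at 1+h≈ h≈)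
      ∷ (at 2+√2≈ 0≈ , at 2+h≈ h≈ , at 1+h≈ h≈ , at Λ≈ 0≈)
      ∷ []
    dissection-presents rho =
        (at 0≈ 0≈ , at 1≈ 0≈ , at 1+h≈ h≈ , at h≈ h≈)
      ∷ (at Λ≈ 0≈ , at Λ≈ 1≈ , at 1+h≈ 1+h≈ , at 1+h≈ h≈)
      ∷ (at Λ≈ 1≈ , at Λ+1≈ 1≈ , at 2+3h≈ 1+h≈ , at 1+3h≈ 1+h≈)
      ∷ (at h≈ h≈ , at 1+h≈ 1+h≈ , at 1+h≈ h≈)
      ∷ (at 1≈ 0≈ , at Λ≈ 0≈ , at 1+h≈ h≈)
      ∷ (at Λ+1≈ 1≈ , at Λ≈ 0≈ , at Λ≈ 1≈)
      ∷ (at 1+3h≈ 1+h≈ , at 1+h≈ 1+h≈ , at Λ≈ 1≈)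
      ∷ []

  dissection-place : ∀ s → Pointwise (λ t (t′ , d) → t ≐ place t′ d) (dissection s) (subtiles s)
  dissection-place s = Pointwise.map (λ {t} {(t′ , d)} → presents⇒≐ t t′ d) (dissection-presents s)

  moveR : Motion → Point → Point
  moveR (motion s ρ) p = ι s ⊕ actR ρ p

  moveR-affine : ∀ m → IsAffineIsometry (moveR m)
  moveR-affine (motion s ρ) = record
    { origin = ι s ; linear = actR ρ ; orthogonal = actR-orthogonal ρ ; formula = λ _ → ≈ₚ-refl }

  moveR-cong : ∀ m {p q} → p ≈ₚ q → moveR m p ≈ₚ moveR m q
  moveR-cong m = apply-cong (isometry (moveR-affine m))

  ι-move : ∀ m z → ι (move m z) ≈ₚ moveR m (ι z)
  ι-move (motion s ρ) z = ≈ₚ-trans (ι-⊞ s _) (⊕-cong ≈ₚ-refl (ι-act ρ z))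

  place-⊚ : ∀ s m n → mapTile (moveR m) (place s n) ≐ place s (m ⊚ n)
  place-⊚ s m n rewrite mapTile-tileOf s (moveR m) (ι ∘ move n) =
    tileOf-cong s λ z → ≈ₚ-trans (≈ₚ-sym (ι-move m (move n z))) (ι-cong (≡.sym (move-⊚ m n z)))

  place-prototile : ∀ s m → mapTile (moveR m) (prototile s) ≐ place s m
  place-prototile s m = ≐-trans {u = mapTile (moveR m) (tileOf s ι)}
    (mapTile-cong (moveR-cong m) {u = tileOf s ι} (≐-trans {u = place s still} (prototile-place s) (tileOf-cong s λ z → ι-cong (move-still z))))
    (≡.subst (_≐ place s m) (≡.sym (mapTile-tileOf s (moveR m) ι)) (tileOf-cong s λ z → ≈ₚ-sym (ι-move m z)))

  frame-cong : ∀ {t u} → t ≐ u → ∀ p → frame t p ≈ₚ frame u p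
  frame-cong {triangle _ _ _} {triangle _ _ _} (s , t , a) p =
    ⊕-cong (⊕-cong s (·-cong refl (·-cong refl (⊖-cong t s))))
      (·-cong refl (·-cong refl (⊖-cong (·-cong refl (⊖-cong a s)) (⊖-cong t s))))
  frame-cong {rhombus _ _ _ _} {rhombus _ _ _ _} (a , b , _ , d) p =
    ⊕-cong (⊕-cong a (·-cong refl (⊖-cong b a))) (·-cong refl (⊖-cong (·-cong refl (⊖-cong d a)) (⊖-cong b a)))

  module _ {f : Point → Point} (F : IsAffineIsometry f) where
    private
      module A = IsOrthogonal (orthogonal F)
      f-cong : ∀ {p q} → p ≈ₚ q → f p ≈ₚ f q
      f-cong = apply-cong (isometry F)

    image-⊕ : ∀ p v → f p ⊕ linear F v ≈ₚ f (p ⊕ v)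
    image-⊕ p v = ≈ₚ-trans (⊕-cong (formula F p) ≈ₚ-refl) (≈ₚ-trans (+-assoc _ _ _ , +-assoc _ _ _)
      (≈ₚ-trans (⊕-cong ≈ₚ-refl (≈ₚ-sym (A.⊕-hom p v))) (≈ₚ-sym (formula F _))))

    -- An affine map passes through the expression defining `frame`, so only the prototile has to be
    -- considered; its frame is the identity by 2h² = 1.
    frame-image : ∀ s p → frame (mapTile f (prototile s)) p ≈ₚ f p
    frame-image tri (x , y) = ≈ₚ-trans
      (⊕-cong (⊕-cong ≈ₚ-refl (scaled² (differences F _ _)))
        (scaled² (≈ₚ-trans (⊖-cong (scaled (differences F _ _)) (differences F _ _)) (≈ₚ-sym (A.⊖-hom _ _)))))
      (≈ₚ-trans (⊕-cong (image-⊕ _ _) ≈ₚ-refl) (≈ₚ-trans (image-⊕ _ _) (f-cong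
      ( ≈-from-zero 2h²-1≈0 (trans (+-cong (+-cong refl (*-cong refl (*-cong refl (+-cong √2≈2h refl)))) (*-cong refl (*-cong refl (+-cong refl (-‿cong (+-cong √2≈2h refl))))))
          (solve 3 (λ h x y → :0 :+ x :* (h :* (:2 :* h :- :0)) :+ y :* (h :* (:2 :* (h :- :0) :- (:2 :* h :- :0))) := x :+ x :* (:2 :* (h :* h) :- :1)) refl h x y))
      , ≈-from-zero 2h²-1≈0
          (solve 3 (λ h x y → :0 :+ x :* (h :* (:0 :- :0)) :+ y :* (h :* (:2 :* (h :- :0) :- (:0 :- :0))) := y :+ y :* (:2 :* (h :* h) :- :1)) refl h x y)))))
      where
      scaled : ∀ {r v w} → v ≈ₚ linear F w → r · v ≈ₚ linear F (r · w)
      scaled eq = ≈ₚ-trans (·-cong refl eq) (≈ₚ-sym (A.·-hom _ _))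
      scaled² : ∀ {r r′ v w} → v ≈ₚ linear F w → r · r′ · v ≈ₚ linear F (r · r′ · w)
      scaled² = scaled ∘ scaled
    frame-image rho (x , y) = ≈ₚ-trans
      (⊕-cong (⊕-cong ≈ₚ-refl (scaled (differences F _ _)))
        (scaled (≈ₚ-trans (⊖-cong (scaled (differences F _ _)) (differences F _ _)) (≈ₚ-sym (A.⊖-hom _ _)))))
      (≈ₚ-trans (⊕-cong (image-⊕ _ _) ≈ₚ-refl) (≈ₚ-trans (image-⊕ _ _) (f-cong
      ( ≈-from-zero 2h²-1≈0 (trans (+-cong refl (*-cong refl (+-cong (*-cong √2≈2h refl) refl)))
          (solve 3 (λ h x y → :0 :+ x :* (:1 :- :0) :+ y :* (:2 :* h :* (h :- :0) :- (:1 :- :0)) := x :+ y :* (:2 :* (h :* h) :- :1)) refl h x y))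
      , ≈-from-zero 2h²-1≈0 (trans (+-cong refl (*-cong refl (+-cong (*-cong √2≈2h refl) refl)))
          (solve 3 (λ h x y → :0 :+ x :* (:0 :- :0) :+ y :* (:2 :* h :* (h :- :0) :- (:0 :- :0)) := y :+ y :* (:2 :* (h :* h) :- :1)) refl h x y))))))
      where
      scaled : ∀ {r v w} → v ≈ₚ linear F w → r · v ≈ₚ linear F (r · w)
      scaled eq = ≈ₚ-trans (·-cong refl eq) (≈ₚ-sym (A.·-hom _ _))

  Λ≉0 : ¬ Λ ≈ 0#
  Λ≉0 Λ≈0 = 1≰0 (≤-respʳ (≤-respˡ (sym (+-identityʳ 1#)) (+-mono-≤ ≤-refl 0≤√2)) Λ≈0)

  -- Λ(o + A(Λ⁻¹p)) = Λo + Ap, because the linear part A commutes with scalars.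
  expandedFrame-place : ∀ {t} s m → t ≐ place s m → ∀ p → expandedFrame t p ≈ₚ moveR (inflateMotion m) p
  expandedFrame-place {t} s m@(motion z ρ) t≐ p = ≈ₚ-trans
    (·-cong refl (≈ₚ-trans (frame-cong (≐-trans {t} {place s m} t≐ (≐-sym (place-prototile s m))) _) (frame-image (moveR-affine m) s _)))
    (≈ₚ-trans (e _ _ _ , e _ _ _) (⊕-cong (≈ₚ-sym (ι-inflate z))
      (≈ₚ-trans (≈ₚ-sym (A.·-hom _ _)) (A.cong (e′ _ , e′ _)))))
    where
    module A = IsOrthogonal (actR-orthogonal ρ)
    e = solve 3 (λ l o x → l :* (o :+ x) := l :* o :+ l :* x) refl
    e′ : ∀ x → Λ * (Λ ⁻¹ * x) ≈ x
    e′ x = trans (sym (*-assoc _ _ _)) (trans (*-cong (*-inverseʳ Λ Λ≉0) refl) (*-identityˡ x))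

  private
    pointwise-∈ : ∀ {A B : Set} {R : A → B → Set} {as bs a} → Pointwise R as bs → a ∈ˡ as → ∃[ b ] b ∈ˡ bs × R a b
    pointwise-∈ (r ∷ _)  (here ≡.refl) = _ , here ≡.refl , r
    pointwise-∈ (_ ∷ rs) (there a∈) with pointwise-∈ rs a∈
    ... | b , b∈ , r = b , there b∈ , r

    shape-≐ : ∀ {t} s f → t ≐ tileOf s f → shape t ≡ s
    shape-≐ {triangle _ _ _}  tri f _ = ≡.refl
    shape-≐ {rhombus _ _ _ _} rho f _ = ≡.refl

  patch-descendant : ∀ s n {t} → t ∈ˡ ω^ n (prototile s) → ∃[ t′ ] ∃[ m ] Descendant s n t′ m × t ≐ place t′ m
  patch-descendant s zero (here ≡.refl) = s , still , ancestor , prototile-place s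
  patch-descendant s (suc n) {t} t∈ with find (List.∈-concatMap⁻ ω {xs = ω^ n (prototile s)} t∈)
  ... | u , u∈ , t∈ω with List.∈-map⁻ (mapTile (expandedFrame u)) t∈ω | patch-descendant s n u∈
  -- `ω` dissects according to `shape u`, which must be identified with the lattice shape `s′`
  -- before the table of subtiles applies.
  ... | w , w∈ , ≡.refl | s′ , m , desc , u≐ with ≡.subst (λ s → w ∈ˡ dissection s) (shape-≐ s′ _ u≐) w∈
  ... | w∈′ with pointwise-∈ (dissection-place s′) w∈′
  ... | (t′ , d) , d∈ , w≐ = t′ , inflateMotion m ⊚ d , child desc d∈ ,
    ≐-trans {u = mapTile (moveR (inflateMotion m)) (place t′ d)}
      (mapTile-cong (λ {p} p≈q → ≈ₚ-trans (expandedFrame-place s′ m u≐ p) (moveR-cong (inflateMotion m) p≈q)) {u = place t′ d} w≐)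
      (place-⊚ t′ (inflateMotion m) d)

-- Metric characterisation of the vertices of a prototile.

module Copies (ℝ : RealNumbers) (root : SquareRootOfTwo ℝ) where

  open Patches ℝ root public
  open IsAffineIsometry
  open Equivalence using (to; from)

  hull-cong : ∀ {n} {ps qs : Vec Point n} → VecPointwise.Pointwise _≈ₚ_ ps qs → ∀ {x} → x ∈ ConvexHull ps → x ∈ ConvexHull qs
  hull-cong ps≈qs (ws , 0≤ws , Σ≈1 , eq) = ws , 0≤ws , Σ≈1 , ≈ₚ-trans (≈ₚ-sym (combination-cong ws ps≈qs)) eq
    where
    combination-cong : ∀ {n} (ws : Vec Carrier n) {ps qs : Vec Point n} → VecPointwise.Pointwise _≈ₚ_ ps qs →
      combination ws ps ≈ₚ combination ws qs
    combination-cong []       []             = ≈ₚ-refl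
    combination-cong (w ∷ ws) (p≈q ∷ ps≈qs) = ⊕-cong (·-cong refl p≈q) (combination-cong ws ps≈qs)

  region-cong : ∀ {t u} → t ≐ u → ∀ {x} → x ∈ region t → x ∈ region u
  region-cong {triangle _ _ _}  {triangle _ _ _}  (p , q , r)     = hull-cong (p ∷ q ∷ r ∷ [])
  region-cong {rhombus _ _ _ _} {rhombus _ _ _ _} (p , q , r , s) = hull-cong (p ∷ q ∷ r ∷ s ∷ [])

  ≐⇒≅ : ∀ {t u} → t ≐ u → t ≅ u
  ≐⇒≅ {t@(triangle _ _ _)}  {u@(triangle _ _ _)} eq@(p , q , _) =
    p , q , λ x → mk⇔ (region-cong {t} {u} eq) (region-cong {u} {t} (≐-sym {t} {u} eq))
  ≐⇒≅ {t@(rhombus _ _ _ _)} {u@(rhombus _ _ _ _)} eq =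
    λ x → mk⇔ (region-cong {t} {u} eq) (region-cong {u} {t} (≐-sym {t} {u} eq))

  ≅-sym : ∀ {t u} → t ≅ u → u ≅ t
  ≅-sym {triangle _ _ _}  {triangle _ _ _}  (p , q , r) = ≈ₚ-sym p , ≈ₚ-sym q , λ x → mk⇔ (from (r x)) (to (r x))
  ≅-sym {rhombus _ _ _ _} {rhombus _ _ _ _} r           = λ x → mk⇔ (from (r x)) (to (r x))

  ≅-trans : ∀ {t u v} → t ≅ u → u ≅ v → t ≅ v
  ≅-trans {triangle _ _ _} {triangle _ _ _} {triangle _ _ _} (p , q , r) (p′ , q′ , r′) =
    ≈ₚ-trans p p′ , ≈ₚ-trans q q′ , λ x → mk⇔ (to (r′ x) ∘ to (r x)) (from (r x) ∘ from (r′ x))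
  ≅-trans {rhombus _ _ _ _} {rhombus _ _ _ _} {rhombus _ _ _ _} r r′ =
    λ x → mk⇔ (to (r′ x) ∘ to (r x)) (from (r x) ∘ from (r′ x))

  ≅⇒SameRegion : ∀ {t u} → t ≅ u → SameRegion t u
  ≅⇒SameRegion {triangle _ _ _}  {triangle _ _ _}  (_ , _ , r) = r
  ≅⇒SameRegion {rhombus _ _ _ _} {rhombus _ _ _ _} r           = r

  private
    unit : ∀ {n} → Fin n → Vec Carrier n
    unit {suc n} zero    = 1# ∷ Vec.replicate n 0#
    unit {suc n} (suc i) = 0# ∷ unit i

    zeros : ∀ n → VecAll.All (0# ≤_) (Vec.replicate n 0#) × sum (Vec.replicate n 0#) ≈ 0# ×
      ∀ ps → combination (Vec.replicate n 0#) ps ≈ₚ (0# , 0#)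
    zeros zero    = [] , refl , λ { [] → ≈ₚ-refl }
    zeros (suc n) with zeros n
    ... | 0≤ , Σ≈0 , c≈0 = ≤-refl ∷ 0≤ , trans (+-identityˡ _) Σ≈0 ,
      λ { ((x , y) ∷ ps) → ≈ₚ-trans (⊕-cong (zeroˡ x , zeroˡ y) (c≈0 ps)) (+-identityˡ _ , +-identityˡ _) }

    units : ∀ {n} (i : Fin n) → VecAll.All (0# ≤_) (unit i) × sum (unit i) ≈ 1# ×
      ∀ ps → combination (unit i) ps ≈ₚ lookup ps i
    units {suc n} zero with zeros n
    ... | 0≤ , Σ≈0 , c≈0 = 0≤1 ∷ 0≤ , trans (+-cong refl Σ≈0) (+-identityʳ 1#) ,
      λ { ((x , y) ∷ ps) → ≈ₚ-trans (⊕-cong (*-identityˡ x , *-identityˡ y) (c≈0 ps)) (+-identityʳ x , +-identityʳ y) }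
    units {suc n} (suc i) with units i
    ... | 0≤ , Σ≈1 , c≈ = ≤-refl ∷ 0≤ , trans (+-identityˡ _) Σ≈1 ,
      λ { ((x , y) ∷ ps) → ≈ₚ-trans (⊕-cong (zeroˡ x , zeroˡ y) (c≈ ps)) (+-identityˡ _ , +-identityˡ _) }

  vertex∈hull : ∀ {n} (ps : Vec Point n) i → lookup ps i ∈ ConvexHull ps
  vertex∈hull ps i with units i
  ... | 0≤ , Σ≈1 , c≈ = unit i , 0≤ , Σ≈1 , c≈ ps

  boundary⊆region : ∀ t {x} → x ∈ boundary t → x ∈ region t
  boundary⊆region (triangle (s , s′) (t , t′) (a , a′)) = λ
    { (inj₁ (v ∷ w ∷ [] , 0≤v ∷ 0≤w ∷ [] , Σ≈1 , eq)) →
        v ∷ w ∷ 0# ∷ [] , 0≤v ∷ 0≤w ∷ ≤-refl ∷ [] , trans (solve 2 (λ v w → v :+ (w :+ (:0 :+ :0)) := v :+ (w :+ :0)) refl v w) Σ≈1 ,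
        ≈ₚ-trans (e₁ v w s t a , e₁ v w s′ t′ a′) eq
    ; (inj₂ (inj₁ (v ∷ w ∷ [] , 0≤v ∷ 0≤w ∷ [] , Σ≈1 , eq))) →
        0# ∷ v ∷ w ∷ [] , ≤-refl ∷ 0≤v ∷ 0≤w ∷ [] , trans (solve 2 (λ v w → :0 :+ (v :+ (w :+ :0)) := v :+ (w :+ :0)) refl v w) Σ≈1 ,
        ≈ₚ-trans (e₂ v w s t a , e₂ v w s′ t′ a′) eq
    ; (inj₂ (inj₂ (v ∷ w ∷ [] , 0≤v ∷ 0≤w ∷ [] , Σ≈1 , eq))) →
        w ∷ 0# ∷ v ∷ [] , 0≤w ∷ ≤-refl ∷ 0≤v ∷ [] , trans (solve 2 (λ v w → w :+ (:0 :+ (v :+ :0)) := v :+ (w :+ :0)) refl v w) Σ≈1 ,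
        ≈ₚ-trans (e₃ v w s t a , e₃ v w s′ t′ a′) eq }
    where
    e₁ = solve 5 (λ v w s t a → v :* s :+ (w :* t :+ (:0 :* a :+ :0)) := v :* s :+ (w :* t :+ :0)) refl
    e₂ = solve 5 (λ v w s t a → :0 :* s :+ (v :* t :+ (w :* a :+ :0)) := v :* t :+ (w :* a :+ :0)) refl
    e₃ = solve 5 (λ v w s t a → w :* s :+ (:0 :* t :+ (v :* a :+ :0)) := v :* a :+ (w :* s :+ :0)) refl
  boundary⊆region (rhombus (a , a′) (b , b′) (c , c′) (d , d′)) = λ
    { (inj₁ (v ∷ w ∷ [] , 0≤v ∷ 0≤w ∷ [] , Σ≈1 , eq)) →
        v ∷ w ∷ 0# ∷ 0# ∷ [] , 0≤v ∷ 0≤w ∷ ≤-refl ∷ ≤-refl ∷ [] , trans (solve 2 (λ v w → v :+ (w :+ (:0 :+ (:0 :+ :0))) := v :+ (w :+ :0)) refl v w) Σ≈1 ,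
        ≈ₚ-trans (e₁ v w a b c d , e₁ v w a′ b′ c′ d′) eq
    ; (inj₂ (inj₁ (v ∷ w ∷ [] , 0≤v ∷ 0≤w ∷ [] , Σ≈1 , eq))) →
        0# ∷ v ∷ w ∷ 0# ∷ [] , ≤-refl ∷ 0≤v ∷ 0≤w ∷ ≤-refl ∷ [] , trans (solve 2 (λ v w → :0 :+ (v :+ (w :+ (:0 :+ :0))) := v :+ (w :+ :0)) refl v w) Σ≈1 ,
        ≈ₚ-trans (e₂ v w a b c d , e₂ v w a′ b′ c′ d′) eq
    ; (inj₂ (inj₂ (inj₁ (v ∷ w ∷ [] , 0≤v ∷ 0≤w ∷ [] , Σ≈1 , eq)))) →
        0# ∷ 0# ∷ v ∷ w ∷ [] , ≤-refl ∷ ≤-refl ∷ 0≤v ∷ 0≤w ∷ [] , trans (solve 2 (λ v w → :0 :+ (:0 :+ (v :+ (w :+ :0))) := v :+ (w :+ :0)) refl v w) Σ≈1 ,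
        ≈ₚ-trans (e₃ v w a b c d , e₃ v w a′ b′ c′ d′) eq
    ; (inj₂ (inj₂ (inj₂ (v ∷ w ∷ [] , 0≤v ∷ 0≤w ∷ [] , Σ≈1 , eq)))) →
        w ∷ 0# ∷ 0# ∷ v ∷ [] , 0≤w ∷ ≤-refl ∷ ≤-refl ∷ 0≤v ∷ [] , trans (solve 2 (λ v w → w :+ (:0 :+ (:0 :+ (v :+ :0))) := v :+ (w :+ :0)) refl v w) Σ≈1 ,
        ≈ₚ-trans (e₄ v w a b c d , e₄ v w a′ b′ c′ d′) eq }
    where
    e₁ = solve 6 (λ v w a b c d → v :* a :+ (w :* b :+ (:0 :* c :+ (:0 :* d :+ :0))) := v :* a :+ (w :* b :+ :0)) refl
    e₂ = solve 6 (λ v w a b c d → :0 :* a :+ (v :* b :+ (w :* c :+ (:0 :* d :+ :0))) := v :* b :+ (w :* c :+ :0)) refl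
    e₃ = solve 6 (λ v w a b c d → :0 :* a :+ (:0 :* b :+ (v :* c :+ (w :* d :+ :0))) := v :* c :+ (w :* d :+ :0)) refl
    e₄ = solve 6 (λ v w a b c d → w :* a :+ (:0 :* b :+ (:0 :* c :+ (v :* d :+ :0))) := v :* d :+ (w :* a :+ :0)) refl

  private
    S T P A B C D : Point
    S = 0# , 0#
    T = √2 , 0#
    P = h , h
    A = 0# , 0#
    B = 1# , 0#
    C = 1# + h , h
    D = h , h

  -- The distances to both ends of the hypotenuse leave two points, mirror images in it. A point of
  -- the triangle has y = wh with w ≥ 0, which excludes the lower one.
  apex-unique : ∀ {p} → p ∈ region (prototile tri) → dist² p S ≈ dist² P S → dist² p T ≈ dist² P T → p ≈ₚ P
  apex-unique {x , y} (u ∷ v ∷ w ∷ [] , _ ∷ _ ∷ 0≤w ∷ [] , _ , _ , eq) dS dT = x≈h , y≈h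
    where
    x≈h : x ≈ h
    -- The radical axis of the two circles: their equations differ by 2√2(x - h), and the last term
    -- of the identity replaces √2 by 2h.
    x≈h = x-y≈0⇒x≈y (*-cancel h≉0 (*-cancel (fromℕ≉0 3) (trans (solve 4 (λ h r x y →
        con (+ 4) :* (h :* (x :- h)) :=
        ((x :- :0) :* (x :- :0) :+ (y :- :0) :* (y :- :0) :- ((h :- :0) :* (h :- :0) :+ (h :- :0) :* (h :- :0))) :-
        ((x :- r) :* (x :- r) :+ (y :- :0) :* (y :- :0) :- ((h :- r) :* (h :- r) :+ (h :- :0) :* (h :- :0))) :-
        :2 :* (x :- h) :* (r :- :2 :* h)) refl h √2 x y)
      (trans (+-cong (+-cong (x-x≈0 dS) (-‿cong (x-x≈0 dT))) (-‿cong (*-cong refl (x-x≈0 √2≈2h))))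
        (solve 1 (λ z → :0 :- :0 :- z :* :0 := :0) refl _)))))
    y≈wh : y ≈ w * h
    y≈wh = trans (sym eq) (solve 4 (λ u v w h → u :* :0 :+ (v :* :0 :+ (w :* h :+ :0)) := w :* h) refl u v w h)
    0≤y : 0# ≤ y
    0≤y = ≤-respʳ (*-nonNegative 0≤w 0≤h) (sym y≈wh)
    y≈h : y ≈ h
    y²≈h² : (y - h) * (y + h) ≈ 0#
    y²≈h² = trans (solve 3 (λ h x y → (y :- h) :* (y :+ h) :=
        ((x :- :0) :* (x :- :0) :+ (y :- :0) :* (y :- :0) :- ((h :- :0) :* (h :- :0) :+ (h :- :0) :* (h :- :0))) :- (x :- h) :* (x :+ h)) refl h x y)
      (trans (+-cong (x-x≈0 dS) (-‿cong (*-cong (x-x≈0 x≈h) refl))) (solve 1 (λ z → :0 :- :0 :* z := :0) refl (x + h)))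
    y≈h = [ x-y≈0⇒x≈y , (λ y+h≈0 → ⊥-elim (h≉0 (a+b≈0⇒a≈0 0≤h 0≤y (trans (+-comm h y) y+h≈0)))) ]′ (xy≈0⇒ y²≈h²)

  private
    InSquare : Carrier → Set
    InSquare s = 0# ≤ s × 0# ≤ 1# - s

    -- Oblique coordinates along the sides 1 and ζ, in which the rhombus is the unit square.
    from-square : Carrier → Carrier → Point
    from-square s t = s + h * t , h * t

    square-coordinates : ∀ {p} → p ∈ region (prototile rho) →
      ∃[ s ] ∃[ t ] InSquare s × InSquare t × p ≈ₚ from-square s t
    square-coordinates {p} (a ∷ b ∷ c ∷ d ∷ [] , 0≤a ∷ 0≤b ∷ 0≤c ∷ 0≤d ∷ [] , Σ≈1 , eq) =
      b + c , c + d ,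
      (+-nonNegative 0≤b 0≤c , ≤-respʳ (+-nonNegative 0≤a 0≤d) (trans
        (solve 4 (λ a b c d → a :+ d := a :+ (b :+ (c :+ (d :+ :0))) :- (b :+ c)) refl a b c d) (+-cong Σ≈1 refl))) ,
      (+-nonNegative 0≤c 0≤d , ≤-respʳ (+-nonNegative 0≤a 0≤b) (trans
        (solve 4 (λ a b c d → a :+ b := a :+ (b :+ (c :+ (d :+ :0))) :- (c :+ d)) refl a b c d) (+-cong Σ≈1 refl))) ,
      ≈ₚ-trans (≈ₚ-sym eq)
        ( solve 5 (λ a b c d h → a :* :0 :+ (b :* :1 :+ (c :* (:1 :+ h) :+ (d :* h :+ :0))) := b :+ c :+ h :* (c :+ d)) refl a b c d h
        , solve 5 (λ a b c d h → a :* :0 :+ (b :* :0 :+ (c :* h :+ (d :* h :+ :0))) := h :* (c :+ d)) refl a b c d h)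

    -- The distance from (s, t) to (s′, t′) is p² + q² + 2hpq with p = s′ - s and
    -- q = t′ - t in [-1, 1]; this is at most 2 + 2h, with equality iff p = q = ±1.
    square-diameter : ∀ {p q} → 0# ≤ 1# - p → 0# ≤ 1# + p → 0# ≤ 1# - q → 0# ≤ 1# + q →
      p * p + q * q + 2# * h * (p * q) ≈ 2# + 2# * h → 1# - p ≈ 0# × 1# - q ≈ 0# ⊎ 1# + p ≈ 0# × 1# + q ≈ 0#
    square-diameter {p} {q} p⁻ p⁺ q⁻ q⁺ eq = conclude (xy≈0⇒ 1-p²≈0)
      where
      hpq = *-nonNegative 0≤h (+-nonNegative (*-nonNegative p⁻ q⁺) (*-nonNegative p⁺ q⁻))
      total≈0 : (1# - p) * (1# + p) + ((1# - q) * (1# + q) + h * ((1# - p) * (1# + q) + (1# + p) * (1# - q))) ≈ 0#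
      total≈0 = trans (solve 3 (λ h p q → (:1 :- p) :* (:1 :+ p) :+ ((:1 :- q) :* (:1 :+ q) :+ h :* ((:1 :- p) :* (:1 :+ q) :+ (:1 :+ p) :* (:1 :- q))) :=
        :2 :+ :2 :* h :- (p :* p :+ q :* q :+ :2 :* h :* (p :* q))) refl h p q) (x-x≈0 (sym eq))
      1-p²≈0 : (1# - p) * (1# + p) ≈ 0#
      1-p²≈0 = a+b≈0⇒a≈0 (*-nonNegative p⁻ p⁺) (+-nonNegative (*-nonNegative q⁻ q⁺) hpq) total≈0
      rest≈0 : h * ((1# - p) * (1# + q) + (1# + p) * (1# - q)) + (1# - q) * (1# + q) ≈ 0#
      rest≈0 = trans (+-comm _ _) (trans (sym (+-identityˡ _)) (trans (+-cong (sym 1-p²≈0) refl) total≈0))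
      1-pq≈0 : (1# - p) * (1# + q) + (1# + p) * (1# - q) ≈ 0#
      1-pq≈0 = *-cancel h≉0 (a+b≈0⇒a≈0 hpq (*-nonNegative q⁻ q⁺) rest≈0)
      conclude : 1# - p ≈ 0# ⊎ 1# + p ≈ 0# → 1# - p ≈ 0# × 1# - q ≈ 0# ⊎ 1# + p ≈ 0# × 1# + q ≈ 0#
      conclude (inj₁ 1-p≈0) = inj₁ (1-p≈0 , *-cancel (fromℕ≉0 1) (trans
        (solve 2 (λ p q → :2 :* (:1 :- q) := ((:1 :- p) :* (:1 :+ q) :+ (:1 :+ p) :* (:1 :- q)) :+ (:1 :- p) :* (:0 :- :2 :* q)) refl p q)
        (trans (+-cong 1-pq≈0 (*-cong 1-p≈0 refl)) (solve 1 (λ z → :0 :+ :0 :* z := :0) refl (0# - 2# * q)))))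
      conclude (inj₂ 1+p≈0) = inj₂ (1+p≈0 , *-cancel (fromℕ≉0 1) (trans
        (solve 2 (λ p q → :2 :* (:1 :+ q) := ((:1 :- p) :* (:1 :+ q) :+ (:1 :+ p) :* (:1 :- q)) :+ (:1 :+ p) :* (:2 :* q)) refl p q)
        (trans (+-cong 1-pq≈0 (*-cong 1+p≈0 refl)) (solve 1 (λ z → :0 :+ :0 :* z := :0) refl (2# * q)))))

    from-square-cong : ∀ {s s′ t t′} → s ≈ s′ → t ≈ t′ → from-square s t ≈ₚ from-square s′ t′
    from-square-cong s t = +-cong s (*-cong refl t) , *-cong refl t

    corner-00 : from-square 0# 0# ≈ₚ A
    corner-00 = solve 1 (λ h → :0 :+ h :* :0 := :0) refl h , zeroʳ h
    corner-10 : from-square 1# 0# ≈ₚ B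
    corner-10 = solve 1 (λ h → :1 :+ h :* :0 := :1) refl h , zeroʳ h
    corner-11 : from-square 1# 1# ≈ₚ C
    corner-11 = solve 1 (λ h → :1 :+ h :* :1 := :1 :+ h) refl h , trans (*-comm h 1#) (*-identityˡ h)
    corner-01 : from-square 0# 1# ≈ₚ D
    corner-01 = solve 1 (λ h → :0 :+ h :* :1 := h) refl h , trans (*-comm h 1#) (*-identityˡ h)

    square-dist² : ∀ s t s′ t′ → let p = s′ - s ; q = t′ - t in
      dist² (from-square s t) (from-square s′ t′) ≈ p * p + q * q + 2# * h * (p * q)
    square-dist² s t s′ t′ = ≈-from-zero 2h²-1≈0 (solve 5 (λ h s t s′ t′ → let p = s′ :- s ; q = t′ :- t in
      (s :+ h :* t :- (s′ :+ h :* t′)) :* (s :+ h :* t :- (s′ :+ h :* t′)) :+ (h :* t :- h :* t′) :* (h :* t :- h :* t′) :=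
      p :* p :+ q :* q :+ :2 :* h :* (p :* q) :+ q :* q :* (:2 :* (h :* h) :- :1)) refl h s t s′ t′)

    dist²-AC : dist² A C ≈ 2# + 2# * h
    dist²-AC = ≈-from-zero 2h²-1≈0 (solve 1 (λ h → (:0 :- (:1 :+ h)) :* (:0 :- (:1 :+ h)) :+ (:0 :- h) :* (:0 :- h) :=
      :2 :+ :2 :* h :+ :1 :* (:2 :* (h :* h) :- :1)) refl h)

  -- The acute vertices are recognised in the bare region as the only pair of points realising its
  -- diameter.
  long-diagonal-unique : ∀ {p q} → p ∈ region (prototile rho) → q ∈ region (prototile rho) →
    dist² p q ≈ dist² A C → p ≈ₚ A × q ≈ₚ C ⊎ p ≈ₚ C × q ≈ₚ A
  long-diagonal-unique p∈ q∈ eq with square-coordinates p∈ | square-coordinates q∈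
  ... | s , t , (0≤s , s≤1) , (0≤t , t≤1) , p≈ | s′ , t′ , (0≤s′ , s′≤1) , (0≤t′ , t′≤1) , q≈ =
    [ (λ (es , et) → inj₁
        ( ≈ₚ-trans p≈ (≈ₚ-trans (from-square-cong (proj₁ (ends⁻ 0≤s s′≤1 es)) (proj₁ (ends⁻ 0≤t t′≤1 et))) corner-00)
        , ≈ₚ-trans q≈ (≈ₚ-trans (from-square-cong (proj₂ (ends⁻ 0≤s s′≤1 es)) (proj₂ (ends⁻ 0≤t t′≤1 et))) corner-11)))
    , (λ (es , et) → inj₂
        ( ≈ₚ-trans p≈ (≈ₚ-trans (from-square-cong (proj₂ (ends⁺ 0≤s′ s≤1 es)) (proj₂ (ends⁺ 0≤t′ t≤1 et))) corner-11)
        , ≈ₚ-trans q≈ (≈ₚ-trans (from-square-cong (proj₁ (ends⁺ 0≤s′ s≤1 es)) (proj₁ (ends⁺ 0≤t′ t≤1 et))) corner-00)))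
    ]′ (square-diameter {s′ - s} {t′ - t} (≤-respʳ (+-nonNegative s′≤1 0≤s) (minus s s′)) (≤-respʳ (+-nonNegative s≤1 0≤s′) (plus s s′))
         (≤-respʳ (+-nonNegative t′≤1 0≤t) (minus t t′)) (≤-respʳ (+-nonNegative t≤1 0≤t′) (plus t t′))
         (trans (sym (square-dist² s t s′ t′)) (trans (dist²-cong (≈ₚ-sym p≈) (≈ₚ-sym q≈)) (trans eq dist²-AC))))
    where
    minus : ∀ s s′ → 1# - s′ + s ≈ 1# - (s′ - s)
    minus = solve 2 (λ s s′ → :1 :- s′ :+ s := :1 :- (s′ :- s)) refl
    plus : ∀ s s′ → 1# - s + s′ ≈ 1# + (s′ - s)
    plus = solve 2 (λ s s′ → :1 :- s :+ s′ := :1 :+ (s′ :- s)) refl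
    ends : ∀ {s s′} → 0# ≤ s → 0# ≤ 1# - s′ → s + (1# - s′) ≈ 0# → s ≈ 0# × s′ ≈ 1#
    ends 0≤s s′≤1 eq = a+b≈0⇒a≈0 0≤s s′≤1 eq , sym (x-y≈0⇒x≈y (a+b≈0⇒a≈0 s′≤1 0≤s (trans (+-comm _ _) eq)))
    ends⁻ : ∀ {s s′} → 0# ≤ s → 0# ≤ 1# - s′ → 1# - (s′ - s) ≈ 0# → s ≈ 0# × s′ ≈ 1#
    ends⁻ {s} {s′} 0≤s s′≤1 eq = ends 0≤s s′≤1 (trans (solve 2 (λ s s′ → s :+ (:1 :- s′) := :1 :- (s′ :- s)) refl s s′) eq)
    ends⁺ : ∀ {s s′} → 0# ≤ s → 0# ≤ 1# - s′ → 1# + (s - s′) ≈ 0# → s ≈ 0# × s′ ≈ 1#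
    ends⁺ {s} {s′} 0≤s s′≤1 eq = ends 0≤s s′≤1 (trans (solve 2 (λ s s′ → s :+ (:1 :- s′) := :1 :+ (s :- s′)) refl s s′) eq)

  -- Intersection of two unit circles. The difference of their equations is linear and gives s + t =
  -- 1; substituting it back leaves (2 - 2h)st = 0.
  short-diagonal-unique : ∀ {p} → p ∈ region (prototile rho) → dist² p A ≈ 1# → dist² p C ≈ 1# → p ≈ₚ B ⊎ p ≈ₚ D
  short-diagonal-unique p∈ eqA eqC with square-coordinates p∈
  ... | s , t , _ , _ , p≈ = conclude (xy≈0⇒ (*-cancel 2-2h≉0 st≈0))
    where
    -- (1 + h)(2 - 2h) = 2 - 2h² = 1.
    2-2h≉0 : ¬ 2# - 2# * h ≈ 0#
    2-2h≉0 eq = 0≉1 (sym (≈-from-zero eq (≈-from-zero 2h²-1≈0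
      (solve 1 (λ h → :1 := :0 :+ (:1 :+ h) :* (:2 :- :2 :* h) :+ :1 :* (:2 :* (h :* h) :- :1)) refl h))))
    2+2h≉0 : ¬ 2# + 2# * h ≈ 0#
    2+2h≉0 eq = fromℕ≉0 1 (a+b≈0⇒a≈0 (fromℕ-nonNegative 2) (*-nonNegative (fromℕ-nonNegative 2) 0≤h) eq)
    fromA : dist² (from-square s t) (from-square 0# 0#) - 1# ≈ 0#
    fromA = x-x≈0 (trans (dist²-cong (≈ₚ-sym p≈) corner-00) eqA)
    fromC : dist² (from-square s t) (from-square 1# 1#) - 1# ≈ 0#
    fromC = x-x≈0 (trans (dist²-cong (≈ₚ-sym p≈) corner-11) eqC)
    s+t≈1 : 1# - s - t ≈ 0#
    s+t≈1 = *-cancel 2+2h≉0 (trans (solve 3 (λ h s t → (:2 :+ :2 :* h) :* (:1 :- s :- t) :=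
      ((:1 :- s) :* (:1 :- s) :+ (:1 :- t) :* (:1 :- t) :+ :2 :* h :* ((:1 :- s) :* (:1 :- t)) :- :1) :-
      ((:0 :- s) :* (:0 :- s) :+ (:0 :- t) :* (:0 :- t) :+ :2 :* h :* ((:0 :- s) :* (:0 :- t)) :- :1)) refl h s t)
      (trans (+-cong (trans (+-cong (sym (square-dist² s t 1# 1#)) refl) fromC) (-‿cong (trans (+-cong (sym (square-dist² s t 0# 0#)) refl) fromA)))
        (-‿inverseʳ 0#)))
    st≈0 : (2# - 2# * h) * (s * t) ≈ 0#
    st≈0 = trans (solve 3 (λ h s t → (:2 :- :2 :* h) :* (s :* t) :=
      (:1 :- s :- t) :* (:0 :- :1 :- s :- t) :-
      ((:0 :- s) :* (:0 :- s) :+ (:0 :- t) :* (:0 :- t) :+ :2 :* h :* ((:0 :- s) :* (:0 :- t)) :- :1)) refl h s t)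
      (trans (+-cong (*-cong s+t≈1 refl) (-‿cong (trans (+-cong (sym (square-dist² s t 0# 0#)) refl) fromA)))
        (solve 1 (λ z → :0 :* z :- :0 := :0) refl (0# - 1# - s - t)))
    other : ∀ {s t} → 1# - s - t ≈ 0# → s ≈ 0# → t ≈ 1#
    other {s} {t} eq s≈0 = sym (x-y≈0⇒x≈y (trans (solve 2 (λ s t → :1 :- t := :1 :- s :- t :+ s) refl s t)
      (trans (+-cong eq s≈0) (+-identityˡ 0#))))
    conclude : s ≈ 0# ⊎ t ≈ 0# → _ ≈ₚ B ⊎ _ ≈ₚ D
    conclude (inj₁ s≈0) = inj₂ (≈ₚ-trans p≈ (≈ₚ-trans (from-square-cong s≈0 (other s+t≈1 s≈0)) corner-01))
    conclude (inj₂ t≈0) = inj₁ (≈ₚ-trans p≈ (≈ₚ-trans (from-square-cong (other t+s≈1 t≈0) t≈0) corner-10))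
      where
      t+s≈1 : 1# - t - s ≈ 0#
      t+s≈1 = trans (solve 2 (λ s t → :1 :- t :- s := :1 :- s :- t) refl s t) s+t≈1

-- Recovery of vertices, boundaries and axes from equality of tiles.

module Recovery (ℝ : RealNumbers) (root : SquareRootOfTwo ℝ) where

  open Copies ℝ root public
  open IsAffineIsometry
  open Equivalence using (to; from)

  record Copy (s : Shape) (t : Tile) : Set where
    constructor copy
    field
      {embedding} : Point → Point
      affine      : IsAffineIsometry embedding
      matches     : t ≐ mapTile embedding (prototile s)

    dist²-copy : ∀ p q → dist² (embedding p) (embedding q) ≈ dist² p q
    dist²-copy = Isometry.preserves (isometry affine)

  open Copy

  copy-mapTile : ∀ {s t f} → IsAffineIsometry f → Copy s t → Copy s (mapTile f t)
  copy-mapTile {s} {t} {f} F (copy {g} G t≐) = copy (∘-affine F G)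
    (≐-trans {u = mapTile f (mapTile g (prototile s))} (mapTile-cong (apply-cong (isometry F)) {t} t≐) (composed s))
    where
    composed : ∀ s → mapTile f (mapTile g (prototile s)) ≐ mapTile (f ∘ g) (prototile s)
    composed tri = ≐-refl {mapTile (f ∘ g) (prototile tri)}
    composed rho = ≐-refl {mapTile (f ∘ g) (prototile rho)}

  copy-preimage : ∀ {s t x} (c : Copy s t) → x ∈ region t → ∃[ p ] p ∈ region (prototile s) × x ≈ₚ embedding c p
  copy-preimage {tri} {t} (copy {f} F t≐) x∈ = hull-preimage F (region-cong {t} {mapTile f (prototile tri)} t≐ x∈)
  copy-preimage {rho} {t} (copy {f} F t≐) x∈ = hull-preimage F (region-cong {t} {mapTile f (prototile rho)} t≐ x∈)

  -- Vertex form of `≅`: the four presentations of a rhombus arise by exchanging the ends of either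
  -- diagonal independently.
  data Match : Tile → Tile → Set where
    triangles : ∀ {s t a s′ t′ a′} → s ≈ₚ s′ → t ≈ₚ t′ → a ≈ₚ a′ → Match (triangle s t a) (triangle s′ t′ a′)
    rhombi    : ∀ {a b c d a′ b′ c′ d′} →
                a′ ≈ₚ a × c′ ≈ₚ c ⊎ a′ ≈ₚ c × c′ ≈ₚ a →
                b′ ≈ₚ b × d′ ≈ₚ d ⊎ b′ ≈ₚ d × d′ ≈ₚ b →
                Match (rhombus a b c d) (rhombus a′ b′ c′ d′)

  private
    match-triangles : ∀ {s t a s′ t′ a′} → Copy tri (triangle s t a) → Copy tri (triangle s′ t′ a′) →
      triangle s t a ≅ triangle s′ t′ a′ → Match (triangle s t a) (triangle s′ t′ a′)
    match-triangles {s} {t} {a} {s′} {t′} {a′} c@(copy F (s≈ , t≈ , a≈)) c′@(copy F′ (s≈′ , t≈′ , a≈′)) (s≈s′ , t≈t′ , same-region)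
      with copy-preimage c (from (same-region a′) (vertex∈hull (s′ ∷ t′ ∷ a′ ∷ []) 2F))
    ... | p , p∈ , a′≈p = triangles s≈s′ t≈t′ (≈ₚ-trans a≈ (≈ₚ-sym (≈ₚ-trans a′≈p (apply-cong (isometry F)
      (apex-unique p∈ (distance s≈s′ s≈ s≈′) (distance t≈t′ t≈ t≈′))))))
      where
      distance : ∀ {x x′ q} → x ≈ₚ x′ → x ≈ₚ embedding c q → x′ ≈ₚ embedding c′ q → dist² p q ≈ dist² (h , h) q
      distance {q = q} x≈x′ x≈ x′≈ = trans (sym (dist²-copy c p q)) (trans
        (dist²-cong (≈ₚ-trans (≈ₚ-sym a′≈p) a≈′) (≈ₚ-trans (≈ₚ-sym x≈) (≈ₚ-trans x≈x′ x′≈))) (dist²-copy c′ _ _))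

    -- The vertices of the second rhombus lie in the first and so have preimages in the prototile,
    -- whose mutual distances are read off from the second copy. The diameter fixes the long
    -- diagonal; the other two vertices are then known by their distance 1 from both its ends.
    match-rhombi : ∀ {a b c d a′ b′ c′ d′} → Copy rho (rhombus a b c d) → Copy rho (rhombus a′ b′ c′ d′) →
      rhombus a b c d ≅ rhombus a′ b′ c′ d′ → Match (rhombus a b c d) (rhombus a′ b′ c′ d′)
    match-rhombi {a} {b} {c} {d} {a′} {b′} {c′} {d′} k@(copy F (a≈ , b≈ , c≈ , d≈)) k′@(copy F′ (a≈′ , b≈′ , c≈′ , d≈′)) same-region = conclude
      (preimage 0F) (preimage 1F) (preimage 2F) (preimage 3F)
      where
      vs = a′ ∷ b′ ∷ c′ ∷ d′ ∷ []
      A B C D : Point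
      A = 0# , 0#
      B = 1# , 0#
      C = 1# + h , h
      D = h , h
      f-cong : ∀ {p q} → p ≈ₚ q → embedding k p ≈ₚ embedding k q
      f-cong = apply-cong (isometry F)
      Preimage : Point → Set
      Preimage x = ∃[ p ] p ∈ region (prototile rho) × x ≈ₚ embedding k p
      preimage : ∀ i → Preimage (lookup vs i)
      preimage i = copy-preimage k (from (same-region (lookup vs i)) (vertex∈hull vs i))
      distance : ∀ {x y p q p′ q′} → x ≈ₚ embedding k p → y ≈ₚ embedding k q → x ≈ₚ embedding k′ p′ → y ≈ₚ embedding k′ q′ →
        dist² p q ≈ dist² p′ q′
      distance x≈ y≈ x≈′ y≈′ = trans (sym (dist²-copy k _ _)) (trans
        (dist²-cong (≈ₚ-trans (≈ₚ-sym x≈) x≈′) (≈ₚ-trans (≈ₚ-sym y≈) y≈′)) (dist²-copy k′ _ _))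
      BA≈1 : dist² B A ≈ 1#
      BA≈1 = solve 0 ((:1 :- :0) :* (:1 :- :0) :+ (:0 :- :0) :* (:0 :- :0) := :1) refl
      DC≈1 : dist² D C ≈ 1#
      DC≈1 = solve 1 (λ h → (h :- (:1 :+ h)) :* (h :- (:1 :+ h)) :+ (h :- h) :* (h :- h) := :1) refl h
      BC≈1 : dist² B C ≈ 1#
      BC≈1 = ≈-from-zero 2h²-1≈0 (solve 1 (λ h → (:1 :- (:1 :+ h)) :* (:1 :- (:1 :+ h)) :+ (:0 :- h) :* (:0 :- h) := :1 :+ :1 :* (:2 :* (h :* h) :- :1)) refl h)
      DA≈1 : dist² D A ≈ 1#
      DA≈1 = ≈-from-zero 2h²-1≈0 (solve 1 (λ h → (h :- :0) :* (h :- :0) :+ (h :- :0) :* (h :- :0) := :1 :+ :1 :* (:2 :* (h :* h) :- :1)) refl h)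
      B≉D : ¬ B ≈ₚ D
      B≉D (_ , 0≈h) = h≉0 (sym 0≈h)
      short-sides : ∀ {x p α γ q} → x ≈ₚ embedding k p → a′ ≈ₚ embedding k α → c′ ≈ₚ embedding k γ → x ≈ₚ embedding k′ q →
        dist² q A ≈ 1# → dist² q C ≈ 1# → α ≈ₚ A × γ ≈ₚ C ⊎ α ≈ₚ C × γ ≈ₚ A → dist² p A ≈ 1# × dist² p C ≈ 1#
      short-sides x≈ a′≈ c′≈ x≈′ qA qC (inj₁ (α≈ , γ≈)) =
          trans (dist²-cong ≈ₚ-refl (≈ₚ-sym α≈)) (trans (distance x≈ a′≈ x≈′ a≈′) qA)
        , trans (dist²-cong ≈ₚ-refl (≈ₚ-sym γ≈)) (trans (distance x≈ c′≈ x≈′ c≈′) qC)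
      short-sides x≈ a′≈ c′≈ x≈′ qA qC (inj₂ (α≈ , γ≈)) =
          trans (dist²-cong ≈ₚ-refl (≈ₚ-sym γ≈)) (trans (distance x≈ c′≈ x≈′ c≈′) qC)
        , trans (dist²-cong ≈ₚ-refl (≈ₚ-sym α≈)) (trans (distance x≈ a′≈ x≈′ a≈′) qA)
      via : ∀ {x y p q} → x ≈ₚ embedding k p → p ≈ₚ q → y ≈ₚ embedding k q → x ≈ₚ y
      via x≈ p≈q y≈ = ≈ₚ-trans x≈ (≈ₚ-trans (f-cong p≈q) (≈ₚ-sym y≈))
      conclude : Preimage a′ → Preimage b′ → Preimage c′ → Preimage d′ → Match (rhombus a b c d) (rhombus a′ b′ c′ d′)
      conclude (α , α∈ , a′≈) (β , β∈ , b′≈) (γ , γ∈ , c′≈) (δ , δ∈ , d′≈) = rhombi (long ends) (short (uncurry (short-diagonal-unique β∈) βs) (uncurry (short-diagonal-unique δ∈) δs))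
        where
        ends : α ≈ₚ A × γ ≈ₚ C ⊎ α ≈ₚ C × γ ≈ₚ A
        ends = long-diagonal-unique α∈ γ∈ (distance a′≈ c′≈ a≈′ c≈′)
        βs = short-sides b′≈ a′≈ c′≈ b≈′ BA≈1 BC≈1 ends
        δs = short-sides d′≈ a′≈ c′≈ d≈′ DA≈1 DC≈1 ends
        long : α ≈ₚ A × γ ≈ₚ C ⊎ α ≈ₚ C × γ ≈ₚ A → a′ ≈ₚ a × c′ ≈ₚ c ⊎ a′ ≈ₚ c × c′ ≈ₚ a
        long (inj₁ (α≈ , γ≈)) = inj₁ (via a′≈ α≈ a≈ , via c′≈ γ≈ c≈)
        long (inj₂ (α≈ , γ≈)) = inj₂ (via a′≈ α≈ c≈ , via c′≈ γ≈ a≈)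
        b′≉d′ : ¬ b′ ≈ₚ d′
        b′≉d′ eq = B≉D (apply-injective (isometry F′) (≈ₚ-trans (≈ₚ-sym b≈′) (≈ₚ-trans eq d≈′)))
        short : β ≈ₚ B ⊎ β ≈ₚ D → δ ≈ₚ B ⊎ δ ≈ₚ D → b′ ≈ₚ b × d′ ≈ₚ d ⊎ b′ ≈ₚ d × d′ ≈ₚ b
        short (inj₁ β≈) (inj₂ δ≈) = inj₁ (via b′≈ β≈ b≈ , via d′≈ δ≈ d≈)
        short (inj₂ β≈) (inj₁ δ≈) = inj₂ (via b′≈ β≈ d≈ , via d′≈ δ≈ b≈)
        -- Distances to the long diagonal do not tell its two sides apart; distinctness of `b′` and
        -- `d′` excludes that both fall on one vertex.
        short (inj₁ β≈) (inj₁ δ≈) = ⊥-elim (b′≉d′ (≈ₚ-trans (via b′≈ β≈ b≈) (≈ₚ-sym (via d′≈ δ≈ b≈))))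
        short (inj₂ β≈) (inj₂ δ≈) = ⊥-elim (b′≉d′ (≈ₚ-trans (via b′≈ β≈ d≈) (≈ₚ-sym (via d′≈ δ≈ d≈))))

  ≅⇒match : ∀ {s s′ t u} → Copy s t → Copy s′ u → t ≅ u → Match t u
  ≅⇒match {tri} {tri} {triangle _ _ _}  {triangle _ _ _}  c c′ eq = match-triangles c c′ eq
  ≅⇒match {rho} {rho} {rhombus _ _ _ _} {rhombus _ _ _ _} c c′ eq = match-rhombi c c′ eq

  segment-cong : ∀ {p q p′ q′ x} → p ≈ₚ p′ → q ≈ₚ q′ → x ∈ Segment p q → x ∈ Segment p′ q′
  segment-cong p q = hull-cong (p ∷ q ∷ [])

  segment-sym : ∀ {p q x} → x ∈ Segment p q → x ∈ Segment q p
  segment-sym (v ∷ w ∷ [] , 0≤v ∷ 0≤w ∷ [] , Σ≈1 , eq) = w ∷ v ∷ [] , 0≤w ∷ 0≤v ∷ [] ,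
    trans (swap v w) Σ≈1 , ≈ₚ-trans (swap _ _ , swap _ _) eq
    where swap = solve 2 (λ x y → y :+ (x :+ :0) := x :+ (y :+ :0)) refl

  match-boundary : ∀ {t u} → Match t u → ∀ {x} → x ∈ boundary u → x ∈ boundary t
  match-boundary (triangles s t a) (inj₁ x)        = inj₁ (segment-cong (≈ₚ-sym s) (≈ₚ-sym t) x)
  match-boundary (triangles s t a) (inj₂ (inj₁ x)) = inj₂ (inj₁ (segment-cong (≈ₚ-sym t) (≈ₚ-sym a) x))
  match-boundary (triangles s t a) (inj₂ (inj₂ x)) = inj₂ (inj₂ (segment-cong (≈ₚ-sym a) (≈ₚ-sym s) x))
  match-boundary (rhombi (inj₁ (a , c)) (inj₁ (b , d))) = λ
    { (inj₁ x)               → inj₁ (segment-cong a b x)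
    ; (inj₂ (inj₁ x))        → inj₂ (inj₁ (segment-cong b c x))
    ; (inj₂ (inj₂ (inj₁ x))) → inj₂ (inj₂ (inj₁ (segment-cong c d x)))
    ; (inj₂ (inj₂ (inj₂ x))) → inj₂ (inj₂ (inj₂ (segment-cong d a x))) }
  match-boundary (rhombi (inj₁ (a , c)) (inj₂ (b , d))) = λ
    { (inj₁ x)               → inj₂ (inj₂ (inj₂ (segment-sym (segment-cong a b x))))
    ; (inj₂ (inj₁ x))        → inj₂ (inj₂ (inj₁ (segment-sym (segment-cong b c x))))
    ; (inj₂ (inj₂ (inj₁ x))) → inj₂ (inj₁ (segment-sym (segment-cong c d x)))
    ; (inj₂ (inj₂ (inj₂ x))) → inj₁ (segment-sym (segment-cong d a x)) }
  match-boundary (rhombi (inj₂ (a , c)) (inj₁ (b , d))) = λ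
    { (inj₁ x)               → inj₂ (inj₁ (segment-sym (segment-cong a b x)))
    ; (inj₂ (inj₁ x))        → inj₁ (segment-sym (segment-cong b c x))
    ; (inj₂ (inj₂ (inj₁ x))) → inj₂ (inj₂ (inj₂ (segment-sym (segment-cong c d x))))
    ; (inj₂ (inj₂ (inj₂ x))) → inj₂ (inj₂ (inj₁ (segment-sym (segment-cong d a x)))) }
  match-boundary (rhombi (inj₂ (a , c)) (inj₂ (b , d))) = λ
    { (inj₁ x)               → inj₂ (inj₂ (inj₁ (segment-cong a b x)))
    ; (inj₂ (inj₁ x))        → inj₂ (inj₂ (inj₂ (segment-cong b c x)))
    ; (inj₂ (inj₂ (inj₁ x))) → inj₁ (segment-cong c d x)
    ; (inj₂ (inj₂ (inj₂ x))) → inj₂ (inj₁ (segment-cong d a x)) }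

  -- The long diagonal of a rhombus; for a triangle, the vector at the same
  -- position in the frame of the prototile.
  axis : Tile → Point
  axis (triangle s t a)  = (a ⊖ s) ⊕ h · (t ⊖ s)
  axis (rhombus a _ c _) = c ⊖ a

  match-axis : ∀ {t u} → Match t u → axis u ≈ₚ axis t ⊎ axis u ≈ₚ (- 1#) · axis t
  match-axis (triangles s t a) = inj₁ (≈ₚ-sym (⊕-cong (⊖-cong a s) (·-cong refl (⊖-cong t s))))
  match-axis (rhombi (inj₁ (a , c)) _) = inj₁ (⊖-cong c a)
  match-axis (rhombi (inj₂ (a , c)) _) = inj₂ (≈ₚ-trans (⊖-cong c a) (e _ _ , e _ _))
    where e = solve 2 (λ a c → a :- c := (:- :1) :* (c :- a)) refl

  match-shape : ∀ {t u} → Match t u → shape t ≡ shape u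
  match-shape (triangles _ _ _) = ≡.refl
  match-shape (rhombi _ _)      = ≡.refl

  proto-axis : Point
  proto-axis = 1# + h , h

  -- Both shapes yield the same vector: for the triangle, (h, h) + h(√2, 0) = (1 + h, h) because h√2
  -- = 1.
  axis-image : ∀ s {f} (F : IsAffineIsometry f) → axis (mapTile f (prototile s)) ≈ₚ linear F proto-axis
  axis-image rho F = ≈ₚ-trans (differences F _ _) (IsOrthogonal.cong (orthogonal F) (e _ , e _))
    where e = solve 1 (λ x → x :- :0 := x) refl
  axis-image tri F = ≈ₚ-trans (⊕-cong (differences F _ _) (≈ₚ-trans (·-cong refl (differences F _ _)) (≈ₚ-sym (A.·-hom _ _))))
    (≈ₚ-trans (≈ₚ-sym (A.⊕-hom _ _)) (A.cong
      ( ≈-from-zero 2h²-1≈0 (trans (+-cong refl (*-cong refl (+-cong √2≈2h refl)))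
          (solve 1 (λ h → h :- :0 :+ h :* (:2 :* h :- :0) := :1 :+ h :+ :1 :* (:2 :* (h :* h) :- :1)) refl h))
      , solve 1 (λ h → h :- :0 :+ h :* (:0 :- :0) := h) refl h)))
    where module A = IsOrthogonal (orthogonal F)

-- The sign of cos 4θ as the character of the dihedral group.

module Colouring (ℝ : RealNumbers) (root : SquareRootOfTwo ℝ) where

  open Recovery ℝ root public
  open IsAffineIsometry
  open Equivalence using (to; from)

  private
    -- The Chebyshev polynomial 8c⁴ - 8c² + 1, homogenised by c² = x²/n and multiplied by n², so
    -- that no vector has to be normalised.
    T₄ : Carrier → Carrier → Carrier
    T₄ n x = n * n - fromℕ 8 * (x * x * (n - x * x))

    T₄-cong : ∀ {n n′ x x′} → n ≈ n′ → x ≈ x′ → T₄ n x ≈ T₄ n′ x′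
    T₄-cong n x = +-cong (*-cong n n) (-‿cong (*-cong refl (*-cong (*-cong x x) (+-cong n (-‿cong (*-cong x x))))))

  -- With |v| = |w| = 1 this is cos 4θ for the angle θ between v and w.
  quadruple-cosine : Point → Point → Carrier
  quadruple-cosine v w = T₄ (dot v v * dot w w) (dot v w)

  quadruple-cosine-cong : ∀ {v v′ w w′} → v ≈ₚ v′ → w ≈ₚ w′ → quadruple-cosine v w ≈ quadruple-cosine v′ w′
  quadruple-cosine-cong v w = T₄-cong (*-cong (dot-cong v v) (dot-cong w w)) (dot-cong v w)

  quadruple-cosine-orthogonal : ∀ {A} → IsOrthogonal A → ∀ v w → quadruple-cosine (A v) (A w) ≈ quadruple-cosine v w
  quadruple-cosine-orthogonal a v w = T₄-cong (*-cong (dots v v) (dots w w)) (dots v w)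
    where open IsOrthogonal a

  private
    dot-comm : ∀ v w → dot v w ≈ dot w v
    dot-comm (a , b) (c , d) = +-cong (*-comm a c) (*-comm b d)

  quadruple-cosine-comm : ∀ v w → quadruple-cosine v w ≈ quadruple-cosine w v
  quadruple-cosine-comm v w = T₄-cong (*-comm (dot v v) (dot w w)) (dot-comm v w)

  quadruple-cosine-neg : ∀ v w → quadruple-cosine ((- 1#) · v) w ≈ quadruple-cosine v w
  quadruple-cosine-neg v@(a , b) w@(c , d) = trans (T₄-cong
    (*-cong (solve 2 (λ a b → (:- :1) :* a :* ((:- :1) :* a) :+ (:- :1) :* b :* ((:- :1) :* b) := a :* a :+ b :* b) refl a b) refl)
    (solve 4 (λ a b c d → (:- :1) :* a :* c :+ (:- :1) :* b :* d := :- (a :* c :+ b :* d)) refl a b c d))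
    (solve 2 (λ n x → n :* n :- con (+ 8) :* ((:- x) :* (:- x) :* (n :- (:- x) :* (:- x))) := n :* n :- con (+ 8) :* (x :* x :* (n :- x :* x))) refl
      (dot v v * dot w w) (dot v w))

  -- cos 4(θ + π/4) = - cos 4θ; here x, z and n = x² + z² are the dot product, the
  -- cross product and the product of the squared norms.
  quadruple-cosine-rotate : ∀ v w → quadruple-cosine (rotate v) w ≈ - quadruple-cosine v w
  quadruple-cosine-rotate v@(a , b) w@(c , d) = trans
    (T₄-cong (trans (*-cong (IsOrthogonal.dots rotate-orthogonal v v) refl) lagrange)
      (solve 5 (λ h a b c d → h :* (a :- b) :* c :+ h :* (a :+ b) :* d := h :* (a :* c :+ b :* d :+ (a :* d :- b :* c))) refl h a b c d))
    (trans (≈-from-zero 2h²-1≈0 (solve 3 (λ h x z → let n = x :* x :+ z :* z ; y = x :+ z in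
        n :* n :- con (+ 8) :* (h :* y :* (h :* y) :* (n :- h :* y :* (h :* y))) :=
        (:- (n :* n :- con (+ 8) :* (x :* x :* (n :- x :* x)))) :+
        (:2 :* (y :* y) :* (y :* y) :* (:2 :* (h :* h) :+ :1) :- con (+ 4) :* (y :* y) :* n) :* (:2 :* (h :* h) :- :1)) refl h (dot v w) z))
      (-‿cong (T₄-cong (sym lagrange) refl)))
    where
    z = a * d - b * c
    lagrange : dot v v * dot w w ≈ dot v w * dot v w + z * z
    lagrange = solve 4 (λ a b c d → (a :* a :+ b :* b) :* (c :* c :+ d :* d) :=
      (a :* c :+ b :* d) :* (a :* c :+ b :* d) :+ (a :* d :- b :* c) :* (a :* d :- b :* c)) refl a b c d

  signed : Bool → Carrier → Carrier
  signed false x = x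
  signed true  x = - x

  signed-cong : ∀ b {x y} → x ≈ y → signed b x ≈ signed b y
  signed-cong false = id
  signed-cong true  = -‿cong

  private
    -‿involutive : ∀ x → - (- x) ≈ x
    -‿involutive = solve 1 (λ x → :- (:- x) := x) refl

  signed-not : ∀ b x → - signed b x ≈ signed (not b) x
  signed-not false x = refl
  signed-not true  x = -‿involutive x

  signed-xor : ∀ b c x → signed b (signed c x) ≈ signed (b xor c) x
  signed-xor false c x = refl
  signed-xor true  c x = signed-not c x

  quadruple-cosine-act : ∀ ρ w → quadruple-cosine (actR ρ proto-axis) w ≈ signed (parity ρ) (quadruple-cosine proto-axis w)
  quadruple-cosine-act (k , b) w = iterates (Fin.toℕ k)
    where
    -- The axis makes an angle of 22.5° with the base, so rotation by 45° undoes its reflection.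
    mirrored : rotate (reflect proto-axis) ≈ₚ proto-axis
    mirrored =
        ≈-from-zero 2h²-1≈0 (solve 1 (λ h → h :* (:1 :+ h :- (:- h)) := :1 :+ h :+ :1 :* (:2 :* (h :* h) :- :1)) refl h)
      , solve 1 (λ h → h :* (:1 :+ h :+ (:- h)) := h) refl h
    start : ∀ b → quadruple-cosine (when b reflect proto-axis) w ≈ signed b (quadruple-cosine proto-axis w)
    start false = refl
    start true  = trans (sym (-‿involutive _)) (-‿cong (trans (sym (quadruple-cosine-rotate (reflect proto-axis) w))
      (quadruple-cosine-cong mirrored ≈ₚ-refl)))
    iterates : ∀ n → quadruple-cosine (iterate rotate n (when b reflect proto-axis)) w ≈ signed (iterate not n b) (quadruple-cosine proto-axis w)
    iterates zero    = start b
    iterates (suc n) = trans (quadruple-cosine-rotate (iterate rotate n (when b reflect proto-axis)) w)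
      (trans (-‿cong (iterates n)) (signed-not (iterate not n b) _))

  -- The eighth power of the length of the axis: not 1, but positive, and only signs are compared.
  unit-cosine : Carrier
  unit-cosine = quadruple-cosine proto-axis proto-axis

  quadruple-cosine-acts : ∀ ρ σ → quadruple-cosine (actR ρ proto-axis) (actR σ proto-axis) ≈ signed (parity ρ xor parity σ) unit-cosine
  quadruple-cosine-acts ρ σ = trans (quadruple-cosine-act ρ (actR σ proto-axis)) (trans
    (signed-cong (parity ρ) (trans (quadruple-cosine-comm proto-axis (actR σ proto-axis)) (quadruple-cosine-act σ proto-axis)))
    (signed-xor (parity ρ) (parity σ) unit-cosine))

  private
    norm : Carrier
    norm = dot proto-axis proto-axis

    unit-cosine≈ : unit-cosine ≈ norm * norm * (norm * norm)
    unit-cosine≈ = solve 1 (λ n → n :* n :* (n :* n) :- con (+ 8) :* (n :* n :* (n :* n :- n :* n)) := n :* n :* (n :* n)) refl norm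

    norm≉0 : ¬ norm ≈ 0#
    norm≉0 eq = h≉0 (proj₂ (dot≈0⇒≈0 {proto-axis} eq))

    0≤unit-cosine : 0# ≤ unit-cosine
    0≤unit-cosine = ≤-respʳ (square-nonNegative (norm * norm)) (sym unit-cosine≈)

    unit-cosine≉0 : ¬ unit-cosine ≈ 0#
    unit-cosine≉0 eq = norm≉0 (x²≈0⇒x≈0 (x²≈0⇒x≈0 (trans (sym unit-cosine≈) eq)))

  sign-of-signed : ∀ b {x} → x ≈ signed b unit-cosine → does (0# ≤? x) ≡ not b
  sign-of-signed b {x} x≈ with 0# ≤? x
  sign-of-signed false x≈ | yes _   = ≡.refl
  sign-of-signed false x≈ | no 0≰x  = ⊥-elim (0≰x (≤-respʳ 0≤unit-cosine (sym x≈)))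
  sign-of-signed true  x≈ | no _    = ≡.refl
  sign-of-signed true  x≈ | yes 0≤x = ⊥-elim (unit-cosine≉0 (antisym
    (≤-respʳ (≤-respˡ (sym (+-identityˡ _)) (≤-respʳ (+-monoˡ-≤ unit-cosine (≤-respʳ 0≤x x≈)) (-‿inverseˡ _))) refl) 0≤unit-cosine))

  colour : Tile → Tile → Bool
  colour t₀ t = isTriangle (shape t) xor does (0# ≤? quadruple-cosine (axis t) (axis t₀))

  private
    does-cong : ∀ {x y} → x ≈ y → does (0# ≤? x) ≡ does (0# ≤? y)
    does-cong {x} {y} x≈y with 0# ≤? x | 0# ≤? y
    ... | yes _   | yes _   = ≡.refl
    ... | no _    | no _    = ≡.refl
    ... | yes 0≤x | no 0≰y  = ⊥-elim (0≰y (≤-respʳ 0≤x x≈y))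
    ... | no 0≰x  | yes 0≤y = ⊥-elim (0≰x (≤-respʳ 0≤y (sym x≈y)))

    Parallel : Point → Point → Set
    Parallel v w = v ≈ₚ w ⊎ v ≈ₚ (- 1#) · w

    cosine-parallel : ∀ {v v′ w w′} → Parallel v v′ → Parallel w w′ → quadruple-cosine v w ≈ quadruple-cosine v′ w′
    cosine-parallel {v} {v′} {w} {w′} p q = trans (left p) (trans (quadruple-cosine-comm v′ w) (trans (left q) (quadruple-cosine-comm w′ v′)))
      where
      left : ∀ {v v′ w} → Parallel v v′ → quadruple-cosine v w ≈ quadruple-cosine v′ w
      left (inj₁ v≈v′)           = quadruple-cosine-cong v≈v′ ≈ₚ-refl
      left {v′ = v′} {w} (inj₂ v≈-v′) = trans (quadruple-cosine-cong v≈-v′ ≈ₚ-refl) (quadruple-cosine-neg v′ w)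

  colour-cong : ∀ t₀ {t u} → shape t ≡ shape u → Parallel (axis t) (axis u) → colour t₀ t ≡ colour t₀ u
  colour-cong t₀ {t} {u} shapes axes = ≡.cong₂ _xor_ (≡.cong isTriangle shapes)
    (does-cong (cosine-parallel {axis t} {axis u} {axis t₀} {axis t₀} axes (inj₁ ≈ₚ-refl)))

  colour-match : ∀ t₀ {t u} → Match t u → colour t₀ t ≡ colour t₀ u
  colour-match t₀ {t} {u} m = ≡.sym (colour-cong t₀ {u} {t} (≡.sym (match-shape m)) (match-axis m))

  -- What legality says about one tile. `g`, `s` and `n` are parameters so that several tiles can be
  -- placed in one and the same patch.
  record Located (g : Isometry) (s : Shape) (n : ℕ) (t : Tile) : Set where
    open Isometry g
    field
      kind       : Shape
      position   : Motion
      descendant : Descendant s n kind position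
      congruent  : t ≅ mapTile apply (place kind position)

    placed : Tile
    placed = mapTile apply (place kind position)

    placed-affine : IsAffineIsometry (apply ∘ moveR position)
    placed-affine = ∘-affine (isAffine g) (moveR-affine position)

    placed-matches : placed ≐ mapTile (apply ∘ moveR position) (prototile kind)
    placed-matches = ≐-trans {u = mapTile apply (mapTile (moveR position) (prototile kind))}
      (mapTile-cong (apply-cong g) {place kind position} (≐-sym {mapTile (moveR position) (prototile kind)} (place-prototile kind position)))
      (composed kind)
      where
      composed : ∀ s → mapTile apply (mapTile (moveR position) (prototile s)) ≐ mapTile (apply ∘ moveR position) (prototile s)
      composed tri = ≐-refl {mapTile (apply ∘ moveR position) (prototile tri)}
      composed rho = ≐-refl {mapTile (apply ∘ moveR position) (prototile rho)}

    placed-copy : Copy kind placed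
    placed-copy = copy placed-affine placed-matches

    points : Vec Point (size kind)
    points = Vec.map (ι ∘ move position) (corners kind)

    preimage : ∀ {x} → x ∈ region t → ∃[ p ] p ∈ ConvexHull points × x ≈ₚ apply p
    preimage {x} x∈ = go kind (to (≅⇒SameRegion {t} {placed} congruent x) x∈)
      where
      go : ∀ k → x ∈ region (mapTile apply (place k position)) →
        ∃[ p ] p ∈ ConvexHull (Vec.map (ι ∘ move position) (corners k)) × x ≈ₚ apply p
      go tri = hull-preimage (isAffine g)
      go rho = hull-preimage (isAffine g)

  open Located

  -- Holds only up to sign, since a rhombus of the tiling and its placed copy may be presented from
  -- opposite acute vertices.
  located-axis : ∀ {g s n t s′} (l : Located g s n t) → Copy s′ t →
    Parallel (axis t) (linear (isAffine g) (actR (Motion.linear (position l)) proto-axis))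
  located-axis {g = g} {t = t} l c =
    [ (λ p → inj₁ (≈ₚ-trans p axis≈)) , (λ p → inj₂ (≈ₚ-trans p (·-cong refl axis≈))) ]′
      (match-axis (≅⇒match (placed-copy l) c (≅-sym {t} {placed l} (congruent l))))
    where
    axis-cong : ∀ {t u} → t ≐ u → axis t ≈ₚ axis u
    axis-cong {triangle _ _ _}  {triangle _ _ _}  (s , t , a)     = ⊕-cong (⊖-cong a s) (·-cong refl (⊖-cong t s))
    axis-cong {rhombus _ _ _ _} {rhombus _ _ _ _} (a , _ , c , _) = ⊖-cong c a
    axis≈ : axis (placed l) ≈ₚ linear (isAffine g) (actR (Motion.linear (position l)) proto-axis)
    axis≈ = ≈ₚ-trans (axis-cong {placed l} {mapTile (Isometry.apply g ∘ moveR (position l)) (prototile (kind l))} (placed-matches l)) (axis-image (kind l) (placed-affine l))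

  -- Both axes are images of lattice directions under the linear part of the same `g`. Inner
  -- products do not see it, so only the parity of one position relative to the other remains.
  located-colour : ∀ {g s n t₀ t s₀ s′} (l₀ : Located g s n t₀) (l : Located g s n t) → Copy s₀ t₀ → Copy s′ t →
    colour t₀ t ≡ isTriangle (kind l) xor not (parity (Motion.linear (position l)) xor parity (Motion.linear (position l₀)))
  located-colour {g} {t₀ = t₀} {t = t} l₀ l c₀ c = ≡.cong₂ _xor_
    (≡.cong isTriangle (≡.trans (match-shape (≅⇒match c (placed-copy l) (congruent l))) (shape-placed (kind l))))
    (sign-of-signed (parity ρ xor parity ρ₀) {quadruple-cosine (axis t) (axis t₀)} (trans
      (cosine-parallel {axis t} {A (actR ρ proto-axis)} {axis t₀} {A (actR ρ₀ proto-axis)} (located-axis l c) (located-axis l₀ c₀))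
      (trans (quadruple-cosine-orthogonal (orthogonal (isAffine g)) (actR ρ proto-axis) (actR ρ₀ proto-axis)) (quadruple-cosine-acts ρ ρ₀))))
    where
    A = linear (isAffine g)
    ρ = Motion.linear (position l)
    ρ₀ = Motion.linear (position l₀)
    shape-placed : ∀ k → shape (mapTile (Isometry.apply g) (place k (position l))) ≡ k
    shape-placed tri = ≡.refl
    shape-placed rho = ≡.refl

-- The two-colouring of a tiling and the lower bound.

module Tilings (ℝ : RealNumbers) (root : SquareRootOfTwo ℝ) where

  open Colouring ℝ root public
  open IsAffineIsometry
  open Located
  open Equivalence using (to; from)

  scaled-form : ∀ {f} r → IsLinearForm f → IsLinearForm (λ p → r * f p)
  scaled-form r F = record
    { cong  = *-cong refl ∘ F.cong
    ; ⊕-hom = λ p q → trans (*-cong refl (F.⊕-hom p q)) (solve 3 (λ r x y → r :* (x :+ y) := r :* x :+ r :* y) refl r _ _)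
    ; ·-hom = λ s p → trans (*-cong refl (F.·-hom s p)) (solve 3 (λ r s x → r :* (s :* x) := s :* (r :* x)) refl r s _)
    } where module F = IsLinearForm F

  -- All corners exceed `below` along one direction by at least 1/10, hence so does every point of
  -- the hull, and `below` would exceed itself.
  avoids-hull : ∀ m t r → Avoids t r → ¬ ι (move m below) ∈ ConvexHull (Vec.map (λ z → ι (move m (move r z))) (corners t))
  avoids-hull m t r (σ , positive) x∈ with ⊙-divide σ (Motion.linear m)
  ... | ρ , ≡.refl = 1≰0 (≤-respʳ (≤-respˡ (sym (cancel 1# x)) (+-monoˡ-≤ (- x) 1+x≤x)) (-‿inverseʳ x))
    where
    x = fromℕ 10 * form ρ (ι (move m below))
    cancel : ∀ y x → y + x - x ≈ y
    cancel = solve 2 (λ y x → y :+ x :- x := y) refl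
    gap : ∀ z → Positive (act (ρ ⊙ Motion.linear m) (z ⊟ below)) → 1# + x ≤ fromℕ 10 * form ρ (ι (move m z))
    gap z p = x≤y-from-0≤ (≤-respʳ (0≤y-x (≤-respʳ (positive-scaled _ p) (*-cong refl (sym (form-difference ρ m z below)))))
      (solve 3 (λ k y x → k :* (y :- x) :- :1 := k :* y :- (:1 :+ k :* x)) refl (fromℕ 10) (form ρ (ι (move m z))) (form ρ (ι (move m below)))))
    1+x≤x : 1# + x ≤ x
    1+x≤x = hull-≥ (scaled-form (fromℕ 10) (form-linear ρ)) _
      (λ j → ≤-respʳ (gap (move r (corner t j)) (positive j))
        (reflexive (≡.cong (λ p → fromℕ 10 * form ρ p) (≡.sym (Vec.lookup-map j (λ z → ι (move m (move r z))) (corners t)))))) x∈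

  lookup-vertex : ∀ s m i → lookup (Vec.map (ι ∘ move m) (corners s)) i ≡ vertex s m i
  lookup-vertex s m i = Vec.lookup-map i (ι ∘ move m) (corners s)

  precedes-hulls : ∀ ρ {s m t n} → Precedes ρ s m t n → ∀ {x y} →
    x ∈ ConvexHull (Vec.map (ι ∘ move m) (corners s)) → y ∈ ConvexHull (Vec.map (ι ∘ move n) (corners t)) → form ρ x ≤ form ρ y
  precedes-hulls ρ {s} {m} {t} {n} before = hull-separated (form-linear ρ) _ _ λ i j →
    ≡.subst₂ (λ p q → form ρ p ≤ form ρ q) (≡.sym (lookup-vertex s m i)) (≡.sym (lookup-vertex t n j)) (before i j)

  -- Each common point counts as a point of either tile, so along a separating direction two of them
  -- bound each other from both sides. Two such directions determine the point.
  separated-intersection : ∀ {s m t n} ρ → Precedes ρ s m t n → Precedes (spin ρ) s m t n → ∀ {x x′ y y′} → x ≈ₚ x′ → y ≈ₚ y′ →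
    x ∈ ConvexHull (Vec.map (ι ∘ move m) (corners s)) → x′ ∈ ConvexHull (Vec.map (ι ∘ move n) (corners t)) →
    y ∈ ConvexHull (Vec.map (ι ∘ move m) (corners s)) → y′ ∈ ConvexHull (Vec.map (ι ∘ move n) (corners t)) → x ≈ₚ y
  separated-intersection {s} {m} {t} {n} ρ p q {x} {x′} {y} {y′} x≈ y≈ x∈ x′∈ y∈ y′∈ = forms-separate-points ρ (equal ρ p) (equal (spin ρ) q)
    where
    equal : ∀ ρ → Precedes ρ s m t n → form ρ x ≈ form ρ y
    equal ρ before = antisym
      (≤-respʳ (precedes-hulls ρ {s} {m} {t} {n} before x∈ y′∈) (IsLinearForm.cong (form-linear ρ) (≈ₚ-sym y≈)))
      (≤-respʳ (precedes-hulls ρ {s} {m} {t} {n} before y∈ x′∈) (IsLinearForm.cong (form-linear ρ) (≈ₚ-sym x≈)))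

  -- A tile containing the point would force every corner of `s` to be at most that point in both
  -- directions, against `below-inside`.
  separated-avoids-below : ∀ {s m t n} ρ → Precedes ρ s m t n → Precedes (spin ρ) s m t n →
    ¬ ι (move m below) ∈ ConvexHull (Vec.map (ι ∘ move n) (corners t))
  separated-avoids-below {s} {m} {t} {n} ρ p q x∈ with below-inside s (ρ ⊙ Motion.linear m)
  ... | i , inj₁ pos = form-≰ ρ m (corner s i) below pos (bound ρ p)
    where
    bound : ∀ ρ → Precedes ρ s m t n → form ρ (vertex s m i) ≤ form ρ (ι (move m below))
    bound ρ before = hull-≥ (form-linear ρ) _ (λ j → ≡.subst (λ p → _ ≤ form ρ p) (≡.sym (lookup-vertex t n j)) (before i j)) x∈
  ... | i , inj₂ pos = form-≰ (spin ρ) m (corner s i) below (≡.subst Positive (≡.sym spun) pos) (bound (spin ρ) q)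
    where
    spun : act (spin ρ ⊙ Motion.linear m) (corner s i ⊟ below) ≡ ζ· act (ρ ⊙ Motion.linear m) (corner s i ⊟ below)
    spun = spin-⊙ ρ (Motion.linear m) (corner s i ⊟ below)
    bound : ∀ ρ → Precedes ρ s m t n → form ρ (vertex s m i) ≤ form ρ (ι (move m below))
    bound ρ before = hull-≥ (form-linear ρ) _ (λ j → ≡.subst (λ p → _ ≤ form ρ p) (≡.sym (lookup-vertex t n j)) (before i j)) x∈

  edge⊆boundary : ∀ k (f : ℤ[ζ] → Point) j {x} → x ∈ Segment (f (corner k j)) (f (corner k (successor k j))) → x ∈ boundary (tileOf k f)
  edge⊆boundary tri f 0F = inj₁
  edge⊆boundary tri f 1F = inj₂ ∘ inj₁
  edge⊆boundary tri f 2F = inj₂ ∘ inj₂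
  edge⊆boundary rho f 0F = inj₁
  edge⊆boundary rho f 1F = inj₂ ∘ inj₁
  edge⊆boundary rho f 2F = inj₂ ∘ inj₂ ∘ inj₁
  edge⊆boundary rho f 3F = inj₂ ∘ inj₂ ∘ inj₂

  base-proper : ∀ k → ¬ ι origin-lat ≈ₚ ι (base-end k)
  base-proper tri (eq , _) = h≉0 (*-cancel (fromℕ≉0 1) (trans
    (solve 1 (λ h → :2 :* h := (:0 :+ (:1 :- (:- :1)) :* h) :- (:0 :+ (:0 :- :0) :* h)) refl h) (x-x≈0 (sym eq))))
  base-proper rho (eq , _) = 0≉1 (trans (solve 1 (λ h → :0 := :0 :+ (:0 :- :0) :* h) refl h)
    (trans eq (solve 1 (λ h → :1 :+ (:0 :- :0) :* h := :1) refl h)))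

  -- The test point outside a rhombus depends on which side is called first, that is, on the
  -- presentation; the lower bound therefore runs through all four.
  presentations : Tile → List Tile
  presentations t@(triangle _ _ _)  = t ∷ []
  presentations (rhombus a b c d) = rhombus a b c d ∷ rhombus c b a d ∷ rhombus a d c b ∷ rhombus c d a b ∷ []

  match-presentation : ∀ {t u} → Match t u → Any (u ≐_) (presentations t)
  match-presentation (triangles s t a) = here (≈ₚ-sym s , ≈ₚ-sym t , ≈ₚ-sym a)
  match-presentation (rhombi (inj₁ (a , c)) (inj₁ (b , d))) = here (a , b , c , d)
  match-presentation (rhombi (inj₂ (a , c)) (inj₁ (b , d))) = there (here (a , b , c , d))
  match-presentation (rhombi (inj₁ (a , c)) (inj₂ (b , d))) = there (there (here (a , b , c , d)))
  match-presentation (rhombi (inj₂ (a , c)) (inj₂ (b , d))) = there (there (there (here (a , b , c , d))))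

  to-fin : Bool → Fin 2
  to-fin false = 0F
  to-fin true  = 1F

  to-fin-injective : ∀ {b c} → to-fin b ≡ to-fin c → b ≡ c
  to-fin-injective {false} {false} _ = ≡.refl
  to-fin-injective {true}  {true}  _ = ≡.refl

  -- x and y tell triangles from rhombi, p and q are parities of motions, and r is
  -- the parity of the relative position of the neighbours.
  neighbour-colours-differ : ∀ x y p r q → y xor r ≡ not x → x xor not (p xor q) ≢ y xor not ((p xor r) xor q)
  neighbour-colours-differ false false false true  false _ ()
  neighbour-colours-differ false false false true  true  _ ()
  neighbour-colours-differ false false true  true  false _ ()
  neighbour-colours-differ false false true  true  true  _ ()
  neighbour-colours-differ false true  false false false _ ()
  neighbour-colours-differ false true  false false true  _ ()
  neighbour-colours-differ false true  true  false false _ ()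
  neighbour-colours-differ false true  true  false true  _ ()
  neighbour-colours-differ true  false false false false _ ()
  neighbour-colours-differ true  false false false true  _ ()
  neighbour-colours-differ true  false true  false false _ ()
  neighbour-colours-differ true  false true  false true  _ ()
  neighbour-colours-differ true  true  false true  false _ ()
  neighbour-colours-differ true  true  false true  true  _ ()
  neighbour-colours-differ true  true  true  true  false _ ()
  neighbour-colours-differ true  true  true  true  true  _ ()

  module _ {ℓ : Level} {T : Pred Tile ℓ} (tiling : IsAmmannBeenkerTiling T) where

    open IsAmmannBeenkerTiling tiling
    open IsTiling isTiling

    copies′ : ∀ {t} → t ∈ T → ∃[ s ] Copy s t
    copies′ {t} t∈ with copies t t∈
    ... | s , g , t≐ = s , copy (isAffine g) t≐

    locate : ∀ ts → All (_∈ T) ts → ∃[ n ] ∃[ s ] ∃[ g ] All (Located g s n) ts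
    locate ts ts∈ with legal ts ts∈
    ... | n , s , g , all = n , s , g , All.map located all
      where
      located : ∀ {t} → Any (t ≅_) (List.map (g ∙_) (ω^ n (prototile s))) → Located g s n t
      located {t} any with find (Any.map⁻ any)
      ... | u , u∈ , t≅gu with patch-descendant s n u∈
      ... | k , m , desc , u≐ = record
        { kind = k ; position = m ; descendant = desc
        ; congruent = ≅-trans {t} {g ∙ u} {mapTile (Isometry.apply g) (place k m)} t≅gu
            (≐⇒≅ {g ∙ u} {mapTile (Isometry.apply g) (place k m)} (mapTile-cong (apply-cong g) {u} {place k m} u≐)) }

    adjacent-distinct-colours : ∀ {t₀ t u} → t₀ ∈ T → t ∈ T → u ∈ T → ¬ t ≅ u → Adjacent t u → colour t₀ t ≢ colour t₀ u
    -- The reference tile is located together with the two others, so that both colours are computed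
    -- from positions in one patch.
    adjacent-distinct-colours {t₀} {t} {u} t₀∈ t∈ u∈ t≇u (p , q , p≉q , shared) with locate (t₀ ∷ t ∷ u ∷ []) (t₀∈ ∷ t∈ ∷ u∈ ∷ [])
    ... | n , s , g , l₀ ∷ l ∷ l′ ∷ [] = by-relation (descendants-related (descendant l) (descendant l′))
        (≅-trans {t} {placed l} {u} (congruent l)) (≅-sym {u} {placed l′} (congruent l′)) (preimages p (v∈ 0F)) (preimages q (v∈ 1F))
        (located-colour l₀ l (proj₂ (copies′ t₀∈)) (proj₂ (copies′ t∈))) (located-colour l₀ l′ (proj₂ (copies′ t₀∈)) (proj₂ (copies′ u∈)))
      where
      v∈ : ∀ i → lookup (p ∷ q ∷ []) i ∈ Segment p q
      v∈ = vertex∈hull (p ∷ q ∷ [])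
      Hull : Shape → Motion → Region
      Hull k m = ConvexHull (Vec.map (ι ∘ move m) (corners k))
      Shared : Shape → Motion → Shape → Motion → Point → Set
      Shared k m k′ m′ x = ∃[ y ] ∃[ y′ ] y ∈ Hull k m × y′ ∈ Hull k′ m′ × y ≈ₚ y′ × x ≈ₚ Isometry.apply g y
      preimages : ∀ x → x ∈ Segment p q → Shared (kind l) (position l) (kind l′) (position l′) x
      preimages x x∈ with preimage l (boundary⊆region t (proj₁ (shared x x∈))) | preimage l′ (boundary⊆region u (proj₂ (shared x x∈)))
      ... | y , y∈ , x≈ | y′ , y′∈ , x≈′ = y , y′ , y∈ , y′∈ , apply-injective g (≈ₚ-trans (≈ₚ-sym x≈) x≈′) , x≈
      bit : Shape → Motion → Bool
      bit k m = isTriangle k xor not (parity (Motion.linear m) xor parity (Motion.linear (position l₀)))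
      -- Kinds and positions are generalised to variables, so that `Relation` can be matched on its
      -- indices.
      by-relation : ∀ {k m k′ m′} → Relation k m k′ m′ →
        (mapTile (Isometry.apply g) (place k m) ≅ u → t ≅ u) → mapTile (Isometry.apply g) (place k′ m′) ≅ u →
        Shared k m k′ m′ p → Shared k m k′ m′ q → colour t₀ t ≡ bit k m → colour t₀ u ≡ bit k′ m′ → colour t₀ t ≢ colour t₀ u
      by-relation same t≅ ≅u _ _ _ _ _ = t≇u (t≅ ≅u)
      by-relation {k} {m} (neighbour {k′} {r} r∈) _ _ _ _ ct cu eq = neighbour-colours-differ (isTriangle k) (isTriangle k′)
        (parity (Motion.linear m)) (parity (Motion.linear r)) (parity (Motion.linear (position l₀))) (All.lookup neighbour-parity r∈)
        (≡.trans (≡.sym ct) (≡.trans eq (≡.trans cu (≡.cong (λ b → isTriangle k′ xor not (b xor parity (Motion.linear (position l₀)))) (parity-⊙ (Motion.linear m) (Motion.linear r))))))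
      by-relation {k} {m} {k′} {m′} (separated ρ before before′) _ _ (y , y′ , y∈ , y′∈ , y≈ , p≈) (z , z′ , z∈ , z′∈ , z≈ , q≈) _ _ _ =
        p≉q (≈ₚ-trans p≈ (≈ₚ-trans (apply-cong g (separated-intersection {k} {m} {k′} {m′} ρ before before′ y≈ z≈ y∈ y′∈ z∈ z′∈)) (≈ₚ-sym q≈)))

    Hull : Shape → Motion → Region
    Hull k m = ConvexHull (Vec.map (ι ∘ move m) (corners k))

    avoids-Hull : ∀ {k r} m → Avoids k r → ¬ ι (move m below) ∈ Hull k (m ⊚ r)
    avoids-Hull {k} {r} m avoids x∈ = avoids-hull m k r avoids
      (≡.subst (λ ps → ι (move m below) ∈ ConvexHull ps) (Vec.map-cong (λ z → ≡.cong ι (move-⊚ m r z)) (corners k)) x∈)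

    tile-avoids-Hull : ∀ k m → ¬ ι (move m below) ∈ Hull k m
    tile-avoids-Hull k m x∈ = avoids-hull m k still (tile-avoids-below k)
      (≡.subst (λ ps → ι (move m below) ∈ ConvexHull ps) (Vec.map-cong (λ z → ≡.cong (ι ∘ move m) (≡.sym (move-still z))) (corners k)) x∈)

    corner-0 : ∀ k → ∃[ j ] corner k j ≡ origin-lat × corner k (successor k j) ≡ base-end k
    corner-0 tri = 0F , ≡.refl , ≡.refl
    corner-0 rho = 0F , ≡.refl , ≡.refl

    shared-base : ∀ (g : Isometry) {k m k′ r} → HasBase k k′ r →
      Adjacent (mapTile (Isometry.apply g) (place k m)) (mapTile (Isometry.apply g) (place k′ (m ⊚ r)))
    shared-base g {k} {m} {k′} {r} (j , ends) = f origin-lat , f (base-end k) ,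
      (λ eq → base-proper k (apply-injective (isometry (moveR-affine m)) (≈ₚ-trans (≈ₚ-sym (ι-move m origin-lat))
        (≈ₚ-trans (apply-injective g eq) (ι-move m (base-end k)))))) ,
      λ x x∈ → first k (corner-0 k) x∈ , second ends x∈
      where
      f : ℤ[ζ] → Point
      f z = Isometry.apply g (ι (move m z))
      f′ : ℤ[ζ] → Point
      f′ z = Isometry.apply g (ι (move (m ⊚ r) z))
      first : ∀ k → ∃[ i ] corner k i ≡ origin-lat × corner k (successor k i) ≡ base-end k → ∀ {x} → x ∈ Segment (f origin-lat) (f (base-end k)) →
        x ∈ boundary (mapTile (Isometry.apply g) (place k m))
      first k (i , p , q) x∈ = ≡.subst (λ t → _ ∈ boundary t) (≡.sym (mapTile-tileOf k (Isometry.apply g) (ι ∘ move m)))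
        (edge⊆boundary k f i (≡.subst₂ (λ y z → _ ∈ Segment (f y) (f z)) (≡.sym p) (≡.sym q) x∈))
      f′≡ : ∀ {z w} → move r z ≡ w → f w ≡ f′ z
      f′≡ {z} eq = ≡.cong (Isometry.apply g ∘ ι) (≡.trans (≡.cong (move m) (≡.sym eq)) (≡.sym (move-⊚ m r z)))
      second : (move r (corner k′ j) ≡ origin-lat × move r (corner k′ (successor k′ j)) ≡ base-end k ⊎
                move r (corner k′ j) ≡ base-end k × move r (corner k′ (successor k′ j)) ≡ origin-lat) →
        ∀ {x} → x ∈ Segment (f origin-lat) (f (base-end k)) → x ∈ boundary (mapTile (Isometry.apply g) (place k′ (m ⊚ r)))
      second ends x∈ = ≡.subst (λ t → _ ∈ boundary t) (≡.sym (mapTile-tileOf k′ (Isometry.apply g) (ι ∘ move (m ⊚ r))))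
        (edge⊆boundary k′ f′ j (oriented ends x∈))
        where
        oriented : _ → ∀ {x} → x ∈ Segment (f origin-lat) (f (base-end k)) → x ∈ Segment (f′ (corner k′ j)) (f′ (corner k′ (successor k′ j)))
        oriented (inj₁ (p , q)) x∈ = ≡.subst₂ (λ y z → _ ∈ Segment y z) (f′≡ p) (f′≡ q) x∈
        oriented (inj₂ (p , q)) x∈ = segment-sym (≡.subst₂ (λ y z → _ ∈ Segment y z) (f′≡ q) (f′≡ p) x∈)

    match-adjacent : ∀ {t t′ u u′} → Match t t′ → Match u u′ → Adjacent t′ u′ → Adjacent t u
    match-adjacent m m′ (p , q , p≉q , shared) = p , q , p≉q , λ x x∈ →
      match-boundary m (proj₁ (shared x x∈)) , match-boundary m′ (proj₂ (shared x x∈))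

    -- Legality applies to a list fixed in advance, but only the patch it returns shows which
    -- presentation of `t₀` is the lattice one. The list thus contains a tile covering the test
    -- point of every presentation, and the right one is selected afterwards.
    adjacent-tiles : ∃[ t ] ∃[ u ] t ∈ T × u ∈ T × ¬ t ≅ u × Adjacent t u
    adjacent-tiles = from-located (locate (t₀ ∷ List.map tile-at (presentations t₀)) (t₀∈ ∷ All.map⁺ (All.tabulate λ {v} _ → proj₁ (proj₂ (at v)))))
      where
      t₀ = proj₁ (covers (0# , 0#))
      t₀∈ = proj₁ (proj₂ (covers (0# , 0#)))
      at : ∀ v → ∃[ t ] t ∈ T × frame v (ι below) ∈ region t
      at v = covers (frame v (ι below))
      tile-at : Tile → Tile
      tile-at v = proj₁ (at v)
      from-located : ∃[ n ] ∃[ s ] ∃[ g ] All (Located g s n) (t₀ ∷ List.map tile-at (presentations t₀)) →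
        ∃[ t ] ∃[ u ] t ∈ T × u ∈ T × ¬ t ≅ u × Adjacent t u
      from-located (n , s , g , l₀ ∷ ls) = conclude (find (match-presentation match₀))
        where
        match₀ : Match t₀ (placed l₀)
        match₀ = ≅⇒match (proj₂ (copies′ t₀∈)) (placed-copy l₀) (congruent l₀)
        conclude : ∃[ v ] v ∈ˡ presentations t₀ × placed l₀ ≐ v → ∃[ t ] ∃[ u ] t ∈ T × u ∈ T × ¬ t ≅ u × Adjacent t u
        conclude (v , v∈ , placed≐v) = t₀ , t , t₀∈ , t∈ , t₀≇t ,
          match-adjacent match₀ (≅⇒match (proj₂ (copies′ t∈)) (placed-copy l) (congruent l))
            (by-relation (descendants-related (descendant l₀) (descendant l)) (in-hull l x∈))
          where
          t = tile-at v
          t∈ = proj₁ (proj₂ (at v))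
          l : Located g s n t
          l = All.lookup (All.map⁻ ls) v∈
          x = frame v (ι below)
          x∈ : x ∈ region t
          x∈ = proj₂ (proj₂ (at v))
          k₀ = kind l₀
          m₀ = position l₀
          x≈ : x ≈ₚ Isometry.apply g (ι (move m₀ below))
          -- For the selected presentation, `frame v` agrees with the isometry carrying the
          -- prototile to its place, so `x` is the image of the lattice point `below`.
          x≈ = ≈ₚ-trans (frame-cong {v} {mapTile (Isometry.apply g ∘ moveR m₀) (prototile k₀)}
              (≐-trans {v} {placed l₀} (≐-sym {placed l₀} {v} placed≐v) (placed-matches l₀)) (ι below))
            (≈ₚ-trans (frame-image (placed-affine l₀) k₀ (ι below)) (apply-cong g (≈ₚ-sym (ι-move m₀ below))))
          in-hull : ∀ {u} (l : Located g s n u) → x ∈ region u → ι (move m₀ below) ∈ Hull (kind l) (position l)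
          in-hull l x∈u with preimage l x∈u
          ... | y , y∈ , x≈gy = hull-resp {x = y} (apply-injective g (≈ₚ-trans (≈ₚ-sym x≈gy) x≈)) y∈
          t₀≇t : ¬ t₀ ≅ t
          -- Equal tiles have the same region, so the test point would lie in `t₀` itself.
          t₀≇t eq = tile-avoids-Hull k₀ m₀ (in-hull l₀ (from (≅⇒SameRegion {t₀} {t} eq x) x∈))
          by-relation : ∀ {k m} → Relation k₀ m₀ k m → ι (move m₀ below) ∈ Hull k m →
            Adjacent (mapTile (Isometry.apply g) (place k₀ m₀)) (mapTile (Isometry.apply g) (place k m))
          by-relation same below∈ = ⊥-elim (tile-avoids-Hull k₀ m₀ below∈)
          by-relation (neighbour {k} {r} r∈) below∈ =
            [ shared-base g {k₀} {m₀} {k} {r} , (λ avoids → ⊥-elim (avoids-Hull m₀ avoids below∈)) ]′ (All.lookup neighbour-base-or-avoids r∈)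
          by-relation {k} {m} (separated ρ p q) below∈ = ⊥-elim (separated-avoids-below {k₀} {m₀} {k} {m} ρ p q below∈)

    some-tile : ∃ T
    some-tile = proj₁ (covers (0# , 0#)) , proj₁ (proj₂ (covers (0# , 0#)))

    orientation-colouring : ∃ T → Fin 2
    orientation-colouring (t , _) = to-fin (colour (proj₁ some-tile) t)

    orientation-colouring-proper : IsProperColouring T orientation-colouring
    orientation-colouring-proper = record
      { respects = λ (t , t∈) (u , u∈) t≅u → ≡.cong to-fin (colour-match (proj₁ some-tile) (≅⇒match (proj₂ (copies′ t∈)) (proj₂ (copies′ u∈)) t≅u))
      ; proper   = λ (t , t∈) (u , u∈) t≇u adjacent → adjacent-distinct-colours (proj₂ some-tile) t∈ u∈ t≇u adjacent ∘ to-fin-injective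
      }

    -- A translation has linear part the identity and fixes the axis exactly; what remains is
    -- invariance of the colour under `≅`.
    orientation-colouring-translates : OrientationBased T orientation-colouring
    orientation-colouring-translates (t , t∈) (u , u∈) (v , translated≅u) = ≡.cong to-fin (≡.trans
      (≡.sym (colour-cong t₀ {mapTile (v ⊕_) t} {t} (shape-translate t) (inj₁ (axis-translate t))))
      (colour-match t₀ (≅⇒match (copy-mapTile translation (proj₂ (copies′ t∈))) (proj₂ (copies′ u∈)) translated≅u)))
      where
      t₀ = proj₁ some-tile
      translation : IsAffineIsometry (v ⊕_)
      translation = record { origin = v ; linear = id ; orthogonal = id-orthogonal ; formula = λ _ → ≈ₚ-refl }
      axis-translate : ∀ t → axis (mapTile (v ⊕_) t) ≈ₚ axis t
      axis-translate (triangle s h a)  = ⊕-cong (differences translation a s) (·-cong refl (differences translation h s))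
      axis-translate (rhombus a _ c _) = differences translation c a
      shape-translate : ∀ t → shape (mapTile (v ⊕_) t) ≡ shape t
      shape-translate (triangle _ _ _)  = ≡.refl
      shape-translate (rhombus _ _ _ _) = ≡.refl

    adjacent⇒2≤ : ∀ j → Colourable T j → 2 ℕ.≤ j
    -- A tiling covers the origin and so has a tile, whose colour would be an element of `Fin 0`.
    adjacent⇒2≤ zero          (c , _) with c some-tile
    ... | ()
    adjacent⇒2≤ (suc zero)    (c , c-proper) with adjacent-tiles
    ... | t , u , t∈ , u∈ , t≇u , adjacent = ⊥-elim (IsProperColouring.proper c-proper (t , t∈) (u , u∈) t≇u adjacent (trivial _ _))
      where
      trivial : ∀ (i j : Fin 1) → i ≡ j
      trivial 0F 0F = ≡.refl
    adjacent⇒2≤ (suc (suc j)) _ = s≤s (s≤s z≤n)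

theorem4p3 : (ℝ : RealNumbers) (root : SquareRootOfTwo ℝ) →
    let open AmmannBeenker ℝ root in
    {ℓ : Level} (T : Pred Tile ℓ) → IsAmmannBeenkerTiling T →
    SmallestNumberOfColours T 2 ×
    (∃[ c ] (IsProperColouring T {2} c × OrientationBased T c))
theorem4p3 ℝ root T tiling =
  ((orientation-colouring tiling , orientation-colouring-proper tiling) , adjacent⇒2≤ tiling) ,
  orientation-colouring tiling , orientation-colouring-proper tiling , orientation-colouring-translates tiling
  where open Tilings ℝ root
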